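{- Let $P$ be a finite geometric lattice of rank $n$, fix a total order on its atoms, and let $S=\{s_1<s_2<\dots<s_k\}\subseteq\{1,\dots,n-1\}$. Let $R=\mathrm{Rib}(s_1,s_2-s_1,\dots,s_k-s_{k-1},n-s_k)$. Then the elements $\bar f_{chain}(v_F)$, where $F$ ranges over the standard fillings of $R$ whose reading word is an $\mathrm{NBC}^+$ basis of $P$, form a basis of the top reduced homology $\tilde H_{k-1}(\Delta(P^S);\mathbb C)$ of the rank-selected subposet $P^S$.
   Context: A geometric lattice is a finite atomic semimodular lattice; for $x\in P$, $A(x)$ is the set of atoms $a\le x$. $P^S$ is the set of elements of $P$ with rank in $S$, and $\Delta(P^S)$ its order complex (simplices = chains), with oriented simplices written as chains in increasing order. An NBC independent set is a set $\{a_{1},\dots,a_{l}\}$ of atoms whose join has rank $l$ and such that every atom $a\notin\{a_1,\dots,a_l\}$ with $a\le a_1\vee\dots\vee a_l$ comes later in the atom order than at least one $a_j$. An $\mathrm{NBC}^+$ basis is an ordered NBC independent set $(a_{1},\dots,a_{r})$ with $r=\mathrm{rk}(P)$ such that for each $j$, $a_{j}=\min\big(A(a_1\vee\dots\vee a_j)\setminus A(a_1\vee\dots\vee a_{j-1})\big)$ (minimum in the atom order). The ribbon $\mathrm{Rib}(r_1,\dots,r_m)$ is the connected skew diagram with no $2\times2$ square whose rows, from bottom to top, have lengths $r_1,\dots,r_m$, each row beginning in the column of the last box of the row below (directly above it). A filling places one atom in each box; its reading word lists the entries left to right within rows, rows taken bottom to top. A filling is standard if entries increase (in atom order) left to right along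 rows and from top to bottom down columns. The tabloid $\{F\}$ is the class of $F$ modulo permuting entries within rows. The column group $\mathrm{Col}_F$ consists of permutations of entries preserving each column, and $v_F:=\sum_{\sigma\in\mathrm{Col}_F}\mathrm{sgn}(\sigma)\{\sigma F\}$. For a filling of $R$ whose entries form a basis of the matroid (i.e. $n$ atoms with join $\hat1$) and reading word $(F_1,\dots,F_n)$, $\bar f_{chain}(\{F\})$ is the maximal chain $F_1\vee\dots\vee F_{s_1}<F_1\vee\dots\vee F_{s_2}<\dots<F_1\vee\dots\vee F_{s_k}$ of $P^S$, viewed as an oriented $(k-1)$-simplex; $\bar f_{chain}$ is extended linearly. -}

module Defs where

open import Algebra.Bundles using (AbelianGroup; CommutativeMonoid; CommutativeRing)
open import Algebra.Module.Bundles using (Module)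
open import Algebra.Module.Structures.Biased using (IsModuleFromLeft)
open import Data.Bool.Base using (if_then_else_)
open import Data.List.Base as List using (List; []; _∷_; _++_; length)
open import Data.Nat.Base as ℕ using (ℕ; zero; suc)
import Data.Nat.Properties as ℕₚ
open import Data.Product.Base using (Σ; Σ-syntax; ∃-syntax; _×_; _,_; proj₁; proj₂; map₁)
open import Level using (Level; _⊔_; 0ℓ) renaming (suc to lsuc)
open import Relation.Binary.Bundles using (Setoid; DecSetoid)
open import Relation.Binary.Core using (Rel)
import Relation.Binary.Reasoning.Setoid as ≈-Reasoning
open import Relation.Nullary.Decidable using (yes; no; does; map′; recompute; _×-dec_)
open import Relation.Nullary.Negation using (¬_; contradiction)
open import Relation.Unary using (Pred)

private variable
  a c p q r ℓ ℓ₁ ℓ₂ : Level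

module Reals where
  open import Algebra.Construct.DirectProduct using (abelianGroup)
  open import Data.Rational.Base using (ℚ; 0ℚ; 1ℚ; ½; _+_; _-_; _*_; -_; 1/_; ∣_∣; _<_; _≤_; Positive; NonZero; positive)
  open import Data.Rational.Properties
  open import Data.Sum.Base using (inj₁; inj₂)
  open import Relation.Binary.PropositionalEquality.Core using (_≡_; refl; sym; trans; cong; subst)

  infix 4 _∼_

  -- |xₘ - yₙ| → 0 as m and n tend to infinity independently: x ∼ x says that x is a Cauchy
  -- sequence, and for Cauchy sequences x ∼ y says that x and y have the same limit.
  record _∼_ (x y : ℕ → ℚ) : Set where
    constructor limit
    field
      close : ∀ ε → 0ℚ < ε → ∃[ N ] ∀ m n → N ℕ.≤ m → N ℕ.≤ n → ∣ x m - y n ∣ < ε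
  open _∼_

  record ℝ : Set where
    constructor real
    field
      seq    : ℕ → ℚ
      cauchy : seq ∼ seq
  open ℝ

  infix 4 _≈_
  record _≈_ (x y : ℝ) : Set where
    constructor equal
    field same : seq x ∼ seq y
  open _≈_

  private
    open import Data.Rational.Solver using (module +-*-Solver)
    open +-*-Solver using (solve; _:=_; _:+_; _:*_; _:-_; :-_; con)

    abstract
      ½-pos : ∀ {ε} → 0ℚ < ε → 0ℚ < ½ * ε
      ½-pos {ε} p = positive⁻¹ (½ * ε) {{pos*pos⇒pos ½ ε {{positive p}}}}

      halves : ∀ ε → ½ * ε + ½ * ε ≡ ε
      halves ε = trans (sym (*-distribʳ-+ ε ½ ½)) (*-identityˡ ε)

      swap-diff : ∀ a b → - (a - b) ≡ b - a
      swap-diff = solve 2 (λ a b → :- (a :- b) := b :- a) refl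

      split-diff : ∀ a b c → a - c ≡ (a - b) + (b - c)
      split-diff = solve 3 (λ a b c → a :- c := (a :- b) :+ (b :- c)) refl

      sum-diff : ∀ a b c d → (a + b) - (c + d) ≡ (a - c) + (b - d)
      sum-diff = solve 4 (λ a b c d → (a :+ b) :- (c :+ d) := (a :- c) :+ (b :- d)) refl

      neg-diff : ∀ a b → (- a) - (- b) ≡ b - a
      neg-diff = solve 2 (λ a b → (:- a) :- (:- b) := b :- a) refl

      prod-diff : ∀ a b c d → a * b - c * d ≡ a * (b - d) + (a - c) * d
      prod-diff = solve 4 (λ a b c d → a :* b :- c :* d := a :* (b :- d) :+ (a :- c) :* d) refl

      add-back : ∀ a b → a ≡ (a - b) + b
      add-back = solve 2 (λ a b → a := (a :- b) :+ b) refl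

      assoc-re : ∀ a b c d e f → (a * c - b * d) * e - (a * d + b * c) * f ≡ a * (c * e - d * f) - b * (c * f + d * e)
      assoc-re = solve 6 (λ a b c d e f →
        (a :* c :- b :* d) :* e :- (a :* d :+ b :* c) :* f := a :* (c :* e :- d :* f) :- b :* (c :* f :+ d :* e)) refl

      assoc-im : ∀ a b c d e f → (a * c - b * d) * f + (a * d + b * c) * e ≡ a * (c * f + d * e) + b * (c * e - d * f)
      assoc-im = solve 6 (λ a b c d e f →
        (a :* c :- b :* d) :* f :+ (a :* d :+ b :* c) :* e := a :* (c :* f :+ d :* e) :+ b :* (c :* e :- d :* f)) refl

      comm-re : ∀ a b c d → a * c - b * d ≡ c * a - d * b
      comm-re = solve 4 (λ a b c d → a :* c :- b :* d := c :* a :- d :* b) refl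

      comm-im : ∀ a b c d → a * d + b * c ≡ c * b + d * a
      comm-im = solve 4 (λ a b c d → a :* d :+ b :* c := c :* b :+ d :* a) refl

      identity-re : ∀ a b → 1ℚ * a - 0ℚ * b ≡ a
      identity-re = solve 2 (λ a b → con 1ℚ :* a :- con 0ℚ :* b := a) refl

      identity-im : ∀ a b → 1ℚ * b + 0ℚ * a ≡ b
      identity-im = solve 2 (λ a b → con 1ℚ :* b :+ con 0ℚ :* a := b) refl

      distrib-re : ∀ a b c d e f → a * (c + e) - b * (d + f) ≡ (a * c - b * d) + (a * e - b * f)
      distrib-re = solve 6 (λ a b c d e f →
        a :* (c :+ e) :- b :* (d :+ f) := (a :* c :- b :* d) :+ (a :* e :- b :* f)) refl

      distrib-im : ∀ a b c d e f → a * (d + f) + b * (c + e) ≡ (a * d + b * c) + (a * f + b * e)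
      distrib-im = solve 6 (λ a b c d e f →
        a :* (d :+ f) :+ b :* (c :+ e) := (a :* d :+ b :* c) :+ (a :* f :+ b :* e)) refl

      ∣-∣-swap : ∀ a b → ∣ a - b ∣ ≡ ∣ b - a ∣
      ∣-∣-swap a b = trans (sym (∣-p∣≡∣p∣ (a - b))) (cong ∣_∣ (swap-diff a b))

      below : ∀ {ε w} u v → w ≡ u + v → ∣ u ∣ < ½ * ε → ∣ v ∣ < ½ * ε → ∣ w ∣ < ε
      below {ε} u v refl p q =
        subst (∣ u + v ∣ <_) (halves ε) (≤-<-trans (∣p+q∣≤∣p∣+∣q∣ u v) (+-mono-< p q))

      ∼-sym : ∀ {x y} → x ∼ y → y ∼ x
      ∼-sym {x} {y} p = limit λ ε ε>0 → let N , h = close p ε ε>0 in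
        N , λ m n N≤m N≤n → subst (_< ε) (∣-∣-swap (x n) (y m)) (h n m N≤n N≤m)

      ∼-trans : ∀ {x y z} → x ∼ y → y ∼ z → x ∼ z
      ∼-trans {x} {y} {z} p q = limit λ ε ε>0 →
        let M , f = close p (½ * ε) (½-pos ε>0)
            N , g = close q (½ * ε) (½-pos ε>0)
        in M ℕ.⊔ N , λ m n b≤m b≤n →
           let M≤m = ℕₚ.m⊔n≤o⇒m≤o M N b≤m
               N≤m = ℕₚ.m⊔n≤o⇒n≤o M N b≤m
               N≤n = ℕₚ.m⊔n≤o⇒n≤o M N b≤n
           in below (x m - y m) (y m - z n) (split-diff (x m) (y m) (z n)) (f m m M≤m M≤m) (g m n N≤m N≤n)

      ∼-pointwise : ∀ {x y} → x ∼ x → (∀ n → x n ≡ y n) → x ∼ y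
      ∼-pointwise {x} p x≡y = limit λ ε ε>0 → let N , h = close p ε ε>0 in
        N , λ m n N≤m N≤n → subst (λ t → ∣ x m - t ∣ < ε) (x≡y n) (h m n N≤m N≤n)

      const-∼ : ∀ q → (λ _ → q) ∼ (λ _ → q)
      const-∼ q = limit λ ε ε>0 → 0 , λ _ _ _ _ → subst (_< ε) (sym (cong ∣_∣ (+-inverseʳ q))) ε>0

      +-∼ : ∀ {x x′ y y′} → x ∼ x′ → y ∼ y′ → (λ n → x n + y n) ∼ (λ n → x′ n + y′ n)
      +-∼ {x} {x′} {y} {y′} p q = limit λ ε ε>0 →
        let M , f = close p (½ * ε) (½-pos ε>0)
            N , g = close q (½ * ε) (½-pos ε>0)
        in M ℕ.⊔ N , λ m n b≤m b≤n →
           below (x m - x′ n) (y m - y′ n) (sum-diff (x m) (y m) (x′ n) (y′ n))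
             (f m n (ℕₚ.m⊔n≤o⇒m≤o M N b≤m) (ℕₚ.m⊔n≤o⇒m≤o M N b≤n))
             (g m n (ℕₚ.m⊔n≤o⇒n≤o M N b≤m) (ℕₚ.m⊔n≤o⇒n≤o M N b≤n))

      neg-∼ : ∀ {x y} → x ∼ y → (λ n → - x n) ∼ (λ n → - y n)
      neg-∼ {x} {y} p = limit λ ε ε>0 → let N , h = close p ε ε>0 in
        N , λ m n N≤m N≤n →
          subst (_< ε) (trans (∣-∣-swap (x m) (y n)) (cong ∣_∣ (sym (neg-diff (x m) (y n))))) (h m n N≤m N≤n)

      total : (ℕ → ℚ) → ℕ → ℚ
      total x zero    = ∣ x 0 ∣
      total x (suc N) = ∣ x (suc N) ∣ + total x N

      q≤p+q : ∀ p q → 0ℚ ≤ p → q ≤ p + q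
      q≤p+q p q 0≤p = subst (_≤ p + q) (+-identityˡ q) (+-monoˡ-≤ q 0≤p)

      p≤p+q : ∀ p q → 0ℚ ≤ q → p ≤ p + q
      p≤p+q p q 0≤q = subst (p ≤_) (+-comm q p) (q≤p+q q p 0≤q)

      0≤total : ∀ x N → 0ℚ ≤ total x N
      0≤total x zero    = 0≤∣p∣ (x 0)
      0≤total x (suc N) = ≤-trans (0≤total x N) (q≤p+q _ _ (0≤∣p∣ (x (suc N))))

      ≤total : ∀ x N n → n ℕ.≤ N → ∣ x n ∣ ≤ total x N
      ≤total x zero    zero    ℕ.z≤n = ≤-refl
      ≤total x (suc N) n n≤1+N with ℕₚ.m≤n⇒m<n∨m≡n n≤1+N
      ... | inj₁ n<1+N = ≤-trans (≤total x N n (ℕₚ.≤-pred n<1+N)) (q≤p+q _ _ (0≤∣p∣ (x (suc N))))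
      ... | inj₂ refl  = p≤p+q _ _ (0≤total x N)

      bounded : ∀ {x} → x ∼ x → ∃[ B ] 0ℚ < B × (∀ n → ∣ x n ∣ ≤ B)
      bounded {x} p with close p 1ℚ (positive⁻¹ 1ℚ)
      ... | N , h = B , 0<B , bound
        where
        B : ℚ
        B = 1ℚ + total x N

        0<B : 0ℚ < B
        0<B = <-≤-trans (positive⁻¹ 1ℚ) (p≤p+q 1ℚ (total x N) (0≤total x N))

        bound : ∀ n → ∣ x n ∣ ≤ B
        bound n with ℕₚ.≤-total n N
        ... | inj₁ n≤N = ≤-trans (≤total x N n n≤N) (q≤p+q 1ℚ (total x N) (<⇒≤ (positive⁻¹ 1ℚ)))
        ... | inj₂ N≤n = begin
          ∣ x n ∣                      ≡⟨ cong ∣_∣ (add-back (x n) (x N)) ⟩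
          ∣ (x n - x N) + x N ∣        ≤⟨ ∣p+q∣≤∣p∣+∣q∣ (x n - x N) (x N) ⟩
          ∣ x n - x N ∣ + ∣ x N ∣      ≤⟨ +-mono-≤ (<⇒≤ (h n N N≤n ℕₚ.≤-refl)) (≤total x N N ℕₚ.≤-refl) ⟩
          B                            ∎
          where open ≤-Reasoning

      shrink : ∀ {B ε} → 0ℚ < B → 0ℚ < ε →
               ∃[ δ ] 0ℚ < δ × (∀ a b → ∣ a ∣ ≤ B → ∣ b ∣ < δ → ∣ a * b ∣ < ε)
      shrink {B} {ε} B>0 ε>0 = δ , positive⁻¹ δ {{δ-pos}} , step
        where
        instance
          B-pos : Positive B
          B-pos = positive B>0
          B≢0 : NonZero B
          B≢0 = pos⇒nonZero B
          ε-pos : Positive ε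
          ε-pos = positive ε>0

        δ : ℚ
        δ = 1/ B * ε

        δ-pos : Positive δ
        δ-pos = pos*pos⇒pos (1/ B) {{1/pos⇒pos B}} ε

        B*δ≡ε : B * δ ≡ ε
        B*δ≡ε = trans (sym (*-assoc B (1/ B) ε)) (trans (cong (_* ε) (*-inverseʳ B)) (*-identityˡ ε))

        step : ∀ a b → ∣ a ∣ ≤ B → ∣ b ∣ < δ → ∣ a * b ∣ < ε
        step a b a≤B b<δ = begin-strict
          ∣ a * b ∣      ≡⟨ ∣p*q∣≡∣p∣*∣q∣ a b ⟩
          ∣ a ∣ * ∣ b ∣  ≤⟨ *-monoʳ-≤-nonNeg ∣ b ∣ {{∣-∣-nonNeg b}} a≤B ⟩
          B * ∣ b ∣      <⟨ *-monoʳ-<-pos B b<δ ⟩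
          B * δ          ≡⟨ B*δ≡ε ⟩
          ε              ∎
          where open ≤-Reasoning

      *-∼ : ∀ {x x′ y y′} → x ∼ x → y′ ∼ y′ → x ∼ x′ → y ∼ y′ → (λ n → x n * y n) ∼ (λ n → x′ n * y′ n)
      *-∼ {x} {x′} {y} {y′} cx cy′ p q = limit λ ε ε>0 →
        let B , B>0 , x≤B  = bounded cx
            C , C>0 , y′≤C = bounded cy′
            δ , δ>0 , hδ   = shrink B>0 (½-pos ε>0)
            η , η>0 , hη   = shrink C>0 (½-pos ε>0)
            M , f = close p η η>0
            N , g = close q δ δ>0
        in M ℕ.⊔ N , λ m n b≤m b≤n →
           below (x m * (y m - y′ n)) ((x m - x′ n) * y′ n) (prod-diff (x m) (y m) (x′ n) (y′ n))
             (hδ (x m) (y m - y′ n) (x≤B m)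
               (g m n (ℕₚ.m⊔n≤o⇒n≤o M N b≤m) (ℕₚ.m⊔n≤o⇒n≤o M N b≤n)))
             (subst (λ t → ∣ t ∣ < ½ * ε) (*-comm (y′ n) (x m - x′ n))
               (hη (y′ n) (x m - x′ n) (y′≤C n)
                 (f m n (ℕₚ.m⊔n≤o⇒m≤o M N b≤m) (ℕₚ.m⊔n≤o⇒m≤o M N b≤n))))

    pointwise : ∀ {x y} → (∀ n → seq x n ≡ seq y n) → x ≈ y
    pointwise {x} x≡y = equal (∼-pointwise (cauchy x) x≡y)

  ℝ-commutativeRing : CommutativeRing 0ℓ 0ℓ
  ℝ-commutativeRing = record
    { Carrier = ℝ
    ; _≈_     = _≈_
    ; _+_     = λ x y → real (λ n → seq x n + seq y n) (+-∼ (cauchy x) (cauchy y))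
    ; _*_     = λ x y → real (λ n → seq x n * seq y n) (*-∼ (cauchy x) (cauchy y) (cauchy x) (cauchy y))
    ; -_      = λ x → real (λ n → - seq x n) (neg-∼ (cauchy x))
    ; 0#      = real (λ _ → 0ℚ) (const-∼ 0ℚ)
    ; 1#      = real (λ _ → 1ℚ) (const-∼ 1ℚ)
    ; isCommutativeRing = record
      { isRing = record
        { +-isAbelianGroup = record
          { isGroup = record
            { isMonoid = record
              { isSemigroup = record
                { isMagma = record
                  { isEquivalence = record
                    { refl  = λ {x} → equal (cauchy x)
                    ; sym   = λ p → equal (∼-sym (same p))
                    ; trans = λ p q → equal (∼-trans (same p) (same q))
                    }
                  ; ∙-cong = λ p q → equal (+-∼ (same p) (same q))
                  }
                ; assoc = λ x y z → pointwise (λ n → +-assoc (seq x n) (seq y n) (seq z n))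
                }
              ; identity = (λ x → pointwise (λ n → +-identityˡ (seq x n))) , (λ x → pointwise (λ n → +-identityʳ (seq x n)))
              }
            ; inverse = (λ x → pointwise (λ n → +-inverseˡ (seq x n))) , (λ x → pointwise (λ n → +-inverseʳ (seq x n)))
            ; ⁻¹-cong = λ p → equal (neg-∼ (same p))
            }
          ; comm = λ x y → pointwise (λ n → +-comm (seq x n) (seq y n))
          }
        ; *-cong     = λ {x} {x′} {y} {y′} p q → equal (*-∼ (cauchy x) (cauchy y′) (same p) (same q))
        ; *-assoc    = λ x y z → pointwise (λ n → *-assoc (seq x n) (seq y n) (seq z n))
        ; *-identity = (λ x → pointwise (λ n → *-identityˡ (seq x n))) , (λ x → pointwise (λ n → *-identityʳ (seq x n)))
        ; distrib    = (λ x y z → pointwise (λ n → *-distribˡ-+ (seq x n) (seq y n) (seq z n)))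
                     , (λ x y z → pointwise (λ n → *-distribʳ-+ (seq x n) (seq y n) (seq z n)))
        }
      ; *-comm = λ x y → pointwise (λ n → *-comm (seq x n) (seq y n))
      }
    }

  private module ℛ = CommutativeRing ℝ-commutativeRing

  ℂ : Set
  ℂ = ℝ × ℝ

  ℂ-commutativeRing : CommutativeRing 0ℓ 0ℓ
  ℂ-commutativeRing = record
    { Carrier = ℂ
    ; _≈_     = _≈ᶜ_
    ; _+_     = AbelianGroup._∙_ pairs
    ; _*_     = _*ᶜ_
    ; -_      = AbelianGroup._⁻¹ pairs
    ; 0#      = ℛ.0# , ℛ.0#
    ; 1#      = 1ᶜ
    ; isCommutativeRing = record
      { isRing = record
        { +-isAbelianGroup = AbelianGroup.isAbelianGroup pairs
        ; *-cong     = λ (p , q) (r , s) → ℛ.+-cong (ℛ.*-cong p r) (ℛ.-‿cong (ℛ.*-cong q s))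
                                         , ℛ.+-cong (ℛ.*-cong p s) (ℛ.*-cong q r)
        ; *-assoc    = λ (a , b) (c , d) (e , f) →
            pointwise (λ n → assoc-re (seq a n) (seq b n) (seq c n) (seq d n) (seq e n) (seq f n))
          , pointwise (λ n → assoc-im (seq a n) (seq b n) (seq c n) (seq d n) (seq e n) (seq f n))
        ; *-identity = *-identityᶜ , λ z → ≈ᶜ.trans (*-commᶜ z 1ᶜ) (*-identityᶜ z)
        ; distrib    = distribᶜ , λ x y z → ≈ᶜ.trans (*-commᶜ (y +ᶜ z) x)
            (≈ᶜ.trans (distribᶜ x y z) (≈ᶜ.∙-cong (*-commᶜ x y) (*-commᶜ x z)))
        }
      ; *-comm = *-commᶜ
      }
    }
    where
    pairs : AbelianGroup 0ℓ 0ℓ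
    pairs = abelianGroup ℛ.+-abelianGroup ℛ.+-abelianGroup

    module ≈ᶜ = AbelianGroup pairs
    open AbelianGroup pairs using () renaming (_≈_ to _≈ᶜ_; _∙_ to _+ᶜ_)

    -- (a + bi)(c + di) = (ac - bd) + (ad + bc)i
    _*ᶜ_ : ℂ → ℂ → ℂ
    (a , b) *ᶜ (c , d) = a ℛ.* c ℛ.- b ℛ.* d , a ℛ.* d ℛ.+ b ℛ.* c

    1ᶜ : ℂ
    1ᶜ = ℛ.1# , ℛ.0#

    *-commᶜ : ∀ x y → (x *ᶜ y) ≈ᶜ (y *ᶜ x)
    *-commᶜ (a , b) (c , d) =
        pointwise (λ n → comm-re (seq a n) (seq b n) (seq c n) (seq d n))
      , pointwise (λ n → comm-im (seq a n) (seq b n) (seq c n) (seq d n))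

    *-identityᶜ : ∀ x → (1ᶜ *ᶜ x) ≈ᶜ x
    *-identityᶜ (a , b) =
        pointwise (λ n → identity-re (seq a n) (seq b n))
      , pointwise (λ n → identity-im (seq a n) (seq b n))

    distribᶜ : ∀ x y z → (x *ᶜ (y +ᶜ z)) ≈ᶜ ((x *ᶜ y) +ᶜ (x *ᶜ z))
    distribᶜ (a , b) (c , d) (e , f) =
        pointwise (λ n → distrib-re (seq a n) (seq b n) (seq c n) (seq d n) (seq e n) (seq f n))
      , pointwise (λ n → distrib-im (seq a n) (seq b n) (seq c n) (seq d n) (seq e n) (seq f n))

module Free {c ℓ : Level} (K : CommutativeRing c ℓ) where
  open CommutativeRing K renaming (Carrier to 𝕂)

  -- Formal linear combinations as unreduced lists of terms; two of them are equal when all their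
  -- coefficients agree.
  Combination : Set r → Set (c ⊔ r)
  Combination X = List (𝕂 × X)

  linearExtension : (M : Module K a ℓ₁) {X : Set r} → (X → Module.Carrierᴹ M) → Combination X → Module.Carrierᴹ M
  linearExtension M f []            = Module.0ᴹ M
  linearExtension M f ((k , x) ∷ v) = Module._+ᴹ_ M (Module._*ₗ_ M k (f x)) (linearExtension M f v)

  module _ (X : DecSetoid r ℓ₂) where
    open DecSetoid X using (_≟_) renaming (Carrier to ∣X∣)

    coefficient : Combination ∣X∣ → ∣X∣ → 𝕂
    coefficient []            y = 0#
    coefficient ((k , x) ∷ v) y = (if does (x ≟ y) then k else 0#) + coefficient v y

    scale : 𝕂 → Combination ∣X∣ → Combination ∣X∣
    scale k = List.map (map₁ (k *_))

    coefficient-++ : ∀ v w y → coefficient (v ++ w) y ≈ coefficient v y + coefficient w y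
    coefficient-++ []            w y = sym (+-identityˡ _)
    coefficient-++ ((k , x) ∷ v) w y = trans (+-congˡ (coefficient-++ v w y)) (sym (+-assoc _ _ _))

    coefficient-scale : ∀ k v y → coefficient (scale k v) y ≈ k * coefficient v y
    coefficient-scale k []            y = sym (zeroʳ k)
    coefficient-scale k ((l , x) ∷ v) y =
      trans (+-cong head (coefficient-scale k v y)) (sym (distribˡ _ _ _))
      where
      head : (if does (x ≟ y) then k * l else 0#) ≈ k * (if does (x ≟ y) then l else 0#)
      head with x ≟ y
      ... | yes _ = refl
      ... | no  _ = sym (zeroʳ k)

    infix 4 _≋_
    record _≋_ (v w : Combination ∣X∣) : Set (r ⊔ ℓ) where
      constructor equal
      field at : ∀ y → coefficient v y ≈ coefficient w y
    open _≋_ public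

    free : Module K (c ⊔ r) (r ⊔ ℓ)
    free = record
      { Carrierᴹ = Combination ∣X∣
      ; _≈ᴹ_     = _≋_
      ; _+ᴹ_     = _++_
      ; _*ₗ_     = scale
      ; _*ᵣ_     = λ v k → scale k v
      ; 0ᴹ       = []
      ; -ᴹ_      = scale (- 1#)
      ; isModule = IsModuleFromLeft.isModule {commutativeRing = K} record
        { isLeftModule = record
          { isLeftSemimodule = record
            { +ᴹ-isCommutativeMonoid = record
              { isMonoid = record
                { isSemigroup = record
                  { isMagma = record
                    { isEquivalence = record
                      { refl  = equal λ y → refl
                      ; sym   = λ p → equal λ y → sym (at p y)
                      ; trans = λ p q → equal λ y → trans (at p y) (at q y)
                      }
                    ; ∙-cong = λ {v} {v′} {w} {w′} p q → equal λ y →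
                        via (coefficient-++ v w y) (coefficient-++ v′ w′ y) (+-cong (at p y) (at q y))
                    }
                  ; assoc = λ u v w → equal λ y → via
                      (trans (coefficient-++ (u ++ v) w y) (+-congʳ (coefficient-++ u v y)))
                      (trans (coefficient-++ u (v ++ w) y) (+-congˡ (coefficient-++ v w y)))
                      (+-assoc _ _ _)
                  }
                ; identity = (λ v → equal λ y → refl) , (λ v → equal λ y → trans (coefficient-++ v [] y) (+-identityʳ _))
                }
              ; comm = λ v w → equal λ y → via (coefficient-++ v w y) (coefficient-++ w v y) (+-comm _ _)
              }
            ; isPreleftSemimodule = record
              { *ₗ-cong      = λ {k} {l} {v} {w} p q → equal λ y →
                  via (coefficient-scale k v y) (coefficient-scale l w y) (*-cong p (at q y))
              ; *ₗ-zeroˡ     = λ v → equal λ y → trans (coefficient-scale 0# v y) (zeroˡ _)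
              ; *ₗ-distribʳ  = λ v k l → equal λ y → via
                  (coefficient-scale (k + l) v y)
                  (trans (coefficient-++ (scale k v) (scale l v) y)
                         (+-cong (coefficient-scale k v y) (coefficient-scale l v y)))
                  (distribʳ _ _ _)
              ; *ₗ-identityˡ = λ v → equal λ y → trans (coefficient-scale 1# v y) (*-identityˡ _)
              ; *ₗ-assoc     = λ k l v → equal λ y → via
                  (coefficient-scale (k * l) v y)
                  (trans (coefficient-scale k (scale l v) y) (*-congˡ (coefficient-scale l v y)))
                  (*-assoc _ _ _)
              ; *ₗ-zeroʳ     = λ k → equal λ y → refl
              ; *ₗ-distribˡ  = λ k v w → equal λ y → via
                  (trans (coefficient-scale k (v ++ w) y) (*-congˡ (coefficient-++ v w y)))
                  (trans (coefficient-++ (scale k v) (scale k w) y)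
                         (+-cong (coefficient-scale k v y) (coefficient-scale k w y)))
                  (distribˡ _ _ _)
              }
            }
          ; -ᴹ‿cong    = λ {v} {w} p → equal λ y →
              via (coefficient-scale (- 1#) v y) (coefficient-scale (- 1#) w y) (*-congˡ (at p y))
          ; -ᴹ‿inverse = (λ v → equal λ y → trans (coefficient-++ (scale (- 1#) v) v y) (cancelˡ v y))
                       , (λ v → equal λ y → trans (coefficient-++ v (scale (- 1#) v) y) (trans (+-comm _ _) (cancelˡ v y)))
          }
        }
      }
      where
      via : ∀ {p q r s} → p ≈ r → q ≈ s → r ≈ s → p ≈ q
      via p≈r q≈s r≈s = trans p≈r (trans r≈s (sym q≈s))

      cancelˡ : ∀ v y → coefficient (scale (- 1#) v) y + coefficient v y ≈ 0#
      cancelˡ v y = begin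
        coefficient (scale (- 1#) v) y + coefficient v y  ≈⟨ +-cong (coefficient-scale (- 1#) v y) (sym (*-identityˡ _)) ⟩
        - 1# * coefficient v y + 1# * coefficient v y     ≈⟨ distribʳ _ _ _ ⟨
        (- 1# + 1#) * coefficient v y                     ≈⟨ *-congʳ (-‿inverseˡ 1#) ⟩
        0# * coefficient v y                              ≈⟨ zeroˡ _ ⟩
        0#                                                ∎
        where open ≈-Reasoning setoid

  module _ (M : Module K a ℓ₁) where
    open Module M

    minus : ∀ v → (- 1#) *ₗ v ≈ᴹ -ᴹ v
    minus v = unique _ _ (begin
      (- 1#) *ₗ v +ᴹ v          ≈⟨ +ᴹ-congˡ (*ₗ-identityˡ v) ⟨
      (- 1#) *ₗ v +ᴹ 1# *ₗ v    ≈⟨ *ₗ-distribʳ v (- 1#) 1# ⟨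
      (- 1# + 1#) *ₗ v          ≈⟨ *ₗ-congʳ (-‿inverseˡ 1#) ⟩
      0# *ₗ v                   ≈⟨ *ₗ-zeroˡ v ⟩
      0ᴹ                        ∎)
      where
      open ≈-Reasoning ≈ᴹ-setoid
      open import Algebra.Module.Properties.LeftModule leftModule using () renaming (inverseˡ-uniqueᴹ to unique)

    extension-++ : {X : Set r} (f : X → Carrierᴹ) → ∀ v w →
      linearExtension M f (v ++ w) ≈ᴹ linearExtension M f v +ᴹ linearExtension M f w
    extension-++ f []            w = ≈ᴹ-sym (+ᴹ-identityˡ _)
    extension-++ f ((k , x) ∷ v) w = ≈ᴹ-trans (+ᴹ-congˡ (extension-++ f v w)) (≈ᴹ-sym (+ᴹ-assoc _ _ _))

    extension-scale : (X : DecSetoid r ℓ₂) (f : DecSetoid.Carrier X → Carrierᴹ) → ∀ k v →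
      linearExtension M f (scale X k v) ≈ᴹ k *ₗ linearExtension M f v
    extension-scale X f k []            = ≈ᴹ-sym (*ₗ-zeroʳ k)
    extension-scale X f k ((l , x) ∷ v) =
      ≈ᴹ-trans (+ᴹ-cong (*ₗ-assoc k l (f x)) (extension-scale X f k v)) (≈ᴹ-sym (*ₗ-distribˡ k _ _))

    module _ (X : DecSetoid r ℓ₂) (f : DecSetoid.Carrier X → Carrierᴹ)
             (f-cong : ∀ {s t} → DecSetoid._≈_ X s t → f s ≈ᴹ f t) where
      private
        module X = DecSetoid X
        E = linearExtension M f

        delete : X.Carrier → Combination X.Carrier → Combination X.Carrier
        delete y []            = []
        delete y ((k , x) ∷ v) with x X.≟ y
        ... | yes _ = delete y v
        ... | no  _ = (k , x) ∷ delete y v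

        length-delete : ∀ y v → length (delete y v) ℕ.≤ length v
        length-delete y []            = ℕ.z≤n
        length-delete y ((k , x) ∷ v) with x X.≟ y
        ... | yes _ = ℕₚ.m≤n⇒m≤1+n (length-delete y v)
        ... | no  _ = ℕ.s≤s (length-delete y v)

        coefficient-here : ∀ y v z → y X.≈ z → coefficient X (delete y v) z ≈ 0#
        coefficient-here y []            z y≈z = refl
        coefficient-here y ((k , x) ∷ v) z y≈z with x X.≟ y
        ... | yes _   = coefficient-here y v z y≈z
        ... | no  x≉y with x X.≟ z
        ...   | yes x≈z = contradiction (X.trans x≈z (X.sym y≈z)) x≉y
        ...   | no  _   = trans (+-identityˡ _) (coefficient-here y v z y≈z)

        coefficient-there : ∀ y v z → ¬ y X.≈ z → coefficient X (delete y v) z ≈ coefficient X v z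
        coefficient-there y []            z y≉z = refl
        coefficient-there y ((k , x) ∷ v) z y≉z with x X.≟ y
        ... | no  _   = +-congˡ (coefficient-there y v z y≉z)
        ... | yes x≈y with x X.≟ z
        ...   | yes x≈z = contradiction (X.trans (X.sym x≈y) x≈z) y≉z
        ...   | no  _   = trans (coefficient-there y v z y≉z) (sym (+-identityˡ _))

        split : ∀ y v → E v ≈ᴹ coefficient X v y *ₗ f y +ᴹ E (delete y v)
        split y [] = ≈ᴹ-sym (≈ᴹ-trans (+ᴹ-congʳ (*ₗ-zeroˡ (f y))) (+ᴹ-identityˡ 0ᴹ))
        split y ((k , x) ∷ v) with x X.≟ y
        ... | yes x≈y = begin
          k *ₗ f x +ᴹ E v                                                ≈⟨ +ᴹ-cong (*ₗ-congˡ (f-cong x≈y)) (split y v) ⟩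
          k *ₗ f y +ᴹ (coefficient X v y *ₗ f y +ᴹ E (delete y v))       ≈⟨ +ᴹ-assoc _ _ _ ⟨
          (k *ₗ f y +ᴹ coefficient X v y *ₗ f y) +ᴹ E (delete y v)       ≈⟨ +ᴹ-congʳ (*ₗ-distribʳ (f y) _ _) ⟨
          (k + coefficient X v y) *ₗ f y +ᴹ E (delete y v)               ∎
          where open ≈-Reasoning ≈ᴹ-setoid
        ... | no  _   = begin
          k *ₗ f x +ᴹ E v                                                ≈⟨ +ᴹ-congˡ (split y v) ⟩
          k *ₗ f x +ᴹ (coefficient X v y *ₗ f y +ᴹ E (delete y v))       ≈⟨ +ᴹ-assoc _ _ _ ⟨
          (k *ₗ f x +ᴹ coefficient X v y *ₗ f y) +ᴹ E (delete y v)       ≈⟨ +ᴹ-congʳ (+ᴹ-comm _ _) ⟩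
          (coefficient X v y *ₗ f y +ᴹ k *ₗ f x) +ᴹ E (delete y v)       ≈⟨ +ᴹ-assoc _ _ _ ⟩
          coefficient X v y *ₗ f y +ᴹ (k *ₗ f x +ᴹ E (delete y v))       ≈⟨ +ᴹ-congʳ (*ₗ-congʳ (+-identityˡ _)) ⟨
          (0# + coefficient X v y) *ₗ f y +ᴹ (k *ₗ f x +ᴹ E (delete y v)) ∎
          where open ≈-Reasoning ≈ᴹ-setoid

        delete-head : ∀ k y v → length (delete y ((k , y) ∷ v)) ℕ.≤ length v
        delete-head k y v with y X.≟ y
        ... | yes _   = length-delete y v
        ... | no  y≉y = contradiction X.refl y≉y

        extension-0′ : ∀ n v → length v ℕ.≤ n → _≋_ X v [] → E v ≈ᴹ 0ᴹ
        extension-0′ n       []                _           v≈0 = ≈ᴹ-refl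
        extension-0′ (suc n) v@((k , y) ∷ v′) (ℕ.s≤s len) v≈0 = begin
          E v                                        ≈⟨ split y v ⟩
          coefficient X v y *ₗ f y +ᴹ E (delete y v) ≈⟨ +ᴹ-cong (≈ᴹ-trans (*ₗ-congʳ (at v≈0 y)) (*ₗ-zeroˡ (f y)))
                                                                (extension-0′ n (delete y v) (ℕₚ.≤-trans (delete-head k y v′) len) rest) ⟩
          0ᴹ +ᴹ 0ᴹ                                   ≈⟨ +ᴹ-identityˡ 0ᴹ ⟩
          0ᴹ                                         ∎
          where
          open ≈-Reasoning ≈ᴹ-setoid
          rest : _≋_ X (delete y v) []
          at rest z with y X.≟ z
          ... | yes y≈z = coefficient-here y v z y≈z
          ... | no  y≉z = trans (coefficient-there y v z y≉z) (at v≈0 z)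

      extension-0 : ∀ v → _≋_ X v [] → E v ≈ᴹ 0ᴹ
      extension-0 v = extension-0′ (length v) v ℕₚ.≤-refl

      extension-cong : ∀ v w → _≋_ X v w → E v ≈ᴹ E w
      extension-cong v w v≈w = begin
        E v                                             ≈⟨ +ᴹ-identityʳ _ ⟨
        E v +ᴹ 0ᴹ                                       ≈⟨ +ᴹ-congˡ (-ᴹ‿inverseˡ (E w)) ⟨
        E v +ᴹ (-ᴹ E w +ᴹ E w)                          ≈⟨ +ᴹ-assoc _ _ _ ⟨
        (E v +ᴹ -ᴹ E w) +ᴹ E w                          ≈⟨ +ᴹ-congʳ difference ⟩
        0ᴹ +ᴹ E w                                       ≈⟨ +ᴹ-identityˡ _ ⟩
        E w                                             ∎
        where
        open ≈-Reasoning ≈ᴹ-setoid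
        module F = Module (free X)

        difference : E v +ᴹ -ᴹ E w ≈ᴹ 0ᴹ
        difference = begin
          E v +ᴹ -ᴹ E w             ≈⟨ +ᴹ-congˡ (minus (E w)) ⟨
          E v +ᴹ (- 1#) *ₗ E w      ≈⟨ +ᴹ-congˡ (extension-scale X f (- 1#) w) ⟨
          E v +ᴹ E (scale X (- 1#) w) ≈⟨ extension-++ f v _ ⟨
          E (v F.+ᴹ F.-ᴹ w)         ≈⟨ extension-0 (v F.+ᴹ F.-ᴹ w)
                                         (F.≈ᴹ-trans (F.+ᴹ-congʳ v≈w) (F.-ᴹ‿inverseʳ w)) ⟩
          0ᴹ                        ∎

  record IsSubmodule (M : Module K a ℓ₁) (U : Pred (Module.Carrierᴹ M) p) : Set (c ⊔ a ⊔ ℓ₁ ⊔ p) where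
    open Module M
    field
      respects  : ∀ {v w} → v ≈ᴹ w → U v → U w
      0-closed  : U 0ᴹ
      +-closed  : ∀ {v w} → U v → U w → U (v +ᴹ w)
      *-closed  : ∀ k {v} → U v → U (k *ₗ v)

    -‿closed : ∀ {v} → U v → U (-ᴹ v)
    -‿closed {v} p = respects (minus M v) (*-closed (- 1#) p)

  -- Z / (Z ∩ B), for submodules Z and B of M
  module _ {M : Module K a ℓ₁} {Z : Pred (Module.Carrierᴹ M) p} {B : Pred (Module.Carrierᴹ M) q}
           (isZ : IsSubmodule M Z) (isB : IsSubmodule M B) where
    open Module M
    private
      module Z = IsSubmodule isZ
      module B = IsSubmodule isB
      open import Algebra.Properties.AbelianGroup +ᴹ-abelianGroup using (⁻¹-∙-comm; ⁻¹-anti-homo-//)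
      open import Algebra.Properties.CommutativeSemigroup
        (CommutativeMonoid.commutativeSemigroup +ᴹ-commutativeMonoid)
        using (interchange)
      open ≈-Reasoning ≈ᴹ-setoid

      _−_ : Carrierᴹ → Carrierᴹ → Carrierᴹ
      v − w = v +ᴹ -ᴹ w

      infixl 6 _−_

      ≈⇒B : ∀ {v w} → v ≈ᴹ w → B (v − w)
      ≈⇒B {v} {w} p = B.respects (≈ᴹ-sym (≈ᴹ-trans (+ᴹ-congʳ p) (-ᴹ‿inverseʳ w))) B.0-closed

      flip : ∀ v w → -ᴹ (v − w) ≈ᴹ w − v
      flip v w = ⁻¹-anti-homo-// v w

      telescope : ∀ u v w → (u − v) +ᴹ (v − w) ≈ᴹ u − w
      telescope u v w = begin
        (u − v) +ᴹ (v − w)           ≈⟨ +ᴹ-assoc _ _ _ ⟩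
        u +ᴹ (-ᴹ v +ᴹ (v − w))       ≈⟨ +ᴹ-congˡ (+ᴹ-assoc _ _ _) ⟨
        u +ᴹ ((-ᴹ v +ᴹ v) − w)       ≈⟨ +ᴹ-congˡ (+ᴹ-congʳ (-ᴹ‿inverseˡ v)) ⟩
        u +ᴹ (0ᴹ − w)                ≈⟨ +ᴹ-congˡ (+ᴹ-identityˡ _) ⟩
        u − w                        ∎

      add : ∀ v v′ w w′ → (v − v′) +ᴹ (w − w′) ≈ᴹ (v +ᴹ w) − (v′ +ᴹ w′)
      add v v′ w w′ = ≈ᴹ-trans (interchange _ _ _ _) (+ᴹ-congˡ (⁻¹-∙-comm v′ w′))

      scale-diff : ∀ k v w → k *ₗ (v − w) ≈ᴹ k *ₗ v − k *ₗ w
      scale-diff k v w = begin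
        k *ₗ (v − w)                     ≈⟨ *ₗ-distribˡ k v (-ᴹ w) ⟩
        k *ₗ v +ᴹ k *ₗ -ᴹ w              ≈⟨ +ᴹ-congˡ (*ₗ-congˡ (minus M w)) ⟨
        k *ₗ v +ᴹ k *ₗ ((- 1#) *ₗ w)     ≈⟨ +ᴹ-congˡ (*ₗ-assoc k (- 1#) w) ⟨
        k *ₗ v +ᴹ (k * - 1#) *ₗ w        ≈⟨ +ᴹ-congˡ (*ₗ-congʳ (*-comm k (- 1#))) ⟩
        k *ₗ v +ᴹ (- 1# * k) *ₗ w        ≈⟨ +ᴹ-congˡ (*ₗ-assoc (- 1#) k w) ⟩
        k *ₗ v +ᴹ (- 1#) *ₗ (k *ₗ w)     ≈⟨ +ᴹ-congˡ (minus M (k *ₗ w)) ⟩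
        k *ₗ v − k *ₗ w                  ∎

    subquotient : Module K (a ⊔ p) q
    subquotient = record
      { Carrierᴹ = Σ Carrierᴹ Z
      ; _≈ᴹ_     = λ (v , _) (w , _) → B (v − w)
      ; _+ᴹ_     = λ (v , p) (w , q) → v +ᴹ w , Z.+-closed p q
      ; _*ₗ_     = λ k (v , p) → k *ₗ v , Z.*-closed k p
      ; _*ᵣ_     = λ (v , p) k → k *ₗ v , Z.*-closed k p
      ; 0ᴹ       = 0ᴹ , Z.0-closed
      ; -ᴹ_      = λ (v , p) → -ᴹ v , Z.-‿closed p
      ; isModule = IsModuleFromLeft.isModule {commutativeRing = K} record
        { isLeftModule = record
          { isLeftSemimodule = record
            { +ᴹ-isCommutativeMonoid = record
              { isMonoid = record
                { isSemigroup = record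
                  { isMagma = record
                    { isEquivalence = record
                      { refl  = ≈⇒B ≈ᴹ-refl
                      ; sym   = λ p → B.respects (flip _ _) (B.-‿closed p)
                      ; trans = λ p q → B.respects (telescope _ _ _) (B.+-closed p q)
                      }
                    ; ∙-cong = λ p q → B.respects (add _ _ _ _) (B.+-closed p q)
                    }
                  ; assoc = λ _ _ _ → ≈⇒B (+ᴹ-assoc _ _ _)
                  }
                ; identity = (λ _ → ≈⇒B (+ᴹ-identityˡ _)) , (λ _ → ≈⇒B (+ᴹ-identityʳ _))
                }
              ; comm = λ _ _ → ≈⇒B (+ᴹ-comm _ _)
              }
            ; isPreleftSemimodule = record
              { *ₗ-cong      = λ {k} {l} {(v , _)} {(w , _)} p q → B.respects (telescope (k *ₗ v) (k *ₗ w) (l *ₗ w))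
                  (B.+-closed (B.respects (scale-diff k v w) (B.*-closed k q)) (≈⇒B (*ₗ-congʳ p)))
              ; *ₗ-zeroˡ     = λ _ → ≈⇒B (*ₗ-zeroˡ _)
              ; *ₗ-distribʳ  = λ _ _ _ → ≈⇒B (*ₗ-distribʳ _ _ _)
              ; *ₗ-identityˡ = λ _ → ≈⇒B (*ₗ-identityˡ _)
              ; *ₗ-assoc     = λ _ _ _ → ≈⇒B (*ₗ-assoc _ _ _)
              ; *ₗ-zeroʳ     = λ _ → ≈⇒B (*ₗ-zeroʳ _)
              ; *ₗ-distribˡ  = λ _ _ _ → ≈⇒B (*ₗ-distribˡ _ _ _)
              }
            }
          ; -ᴹ‿cong    = λ {(v , _)} {(w , _)} p → B.respects (≈ᴹ-sym (⁻¹-∙-comm v (-ᴹ w))) (B.-‿closed p)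
          ; -ᴹ‿inverse = (λ _ → ≈⇒B (-ᴹ‿inverseˡ _)) , (λ _ → ≈⇒B (-ᴹ‿inverseʳ _))
          }
        }
      }

  record IsBasis (M : Module K a ℓ₁) (I : DecSetoid r ℓ₂) (e : DecSetoid.Carrier I → Module.Carrierᴹ M)
                 : Set (c ⊔ ℓ ⊔ a ⊔ ℓ₁ ⊔ r) where
    open Module M
    field
      linearlyIndependent : ∀ v → linearExtension M e v ≈ᴹ 0ᴹ → ∀ i → coefficient I v i ≈ 0#
      spanning            : ∀ w → ∃[ v ] linearExtension M e v ≈ᴹ w

open import Data.Fin.Base using (Fin; zero; suc; toℕ)
open import Data.Fin.Permutation using (Permutation′; flip; _∘ₚ_; _⟨$⟩ʳ_; _⟨$⟩ˡ_; insert; inverseʳ; inverseˡ) renaming (id to idₚ)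
import Data.Fin.Properties as Finₚ
open import Data.Irrelevant using ([_])
open import Data.List.Base using (filter; take; drop; map; foldr; upTo; allFin; cartesianProduct; cartesianProductWith)
open import Data.List.Membership.Propositional using (_∈_; _∉_)
import Data.List.Properties as Listₚ
open import Data.List.Relation.Unary.Any using (Any; here; there)
open import Data.Nat.Base using (_∸_; s≤s; z≤n)
open import Data.Nat.ListAction using (sum)
open import Data.Refinement.Base using (Refinement-syntax; _,_; value)
import Data.Refinement.Properties as Refinementₚ
open import Data.Sum.Base using (_⊎_; inj₁; inj₂)
open import Data.Unit.Polymorphic.Base using (⊤)
open import Data.Vec.Base as Vec using (Vec; []; _∷_; lookup; tabulate; removeAt; toList)
import Data.Vec.Membership.Propositional as VecM
import Data.Vec.Membership.Propositional.Properties as VecMₚ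
import Data.Vec.Properties as Vecₚ
import Data.Vec.Relation.Unary.All as VecAll
import Data.Vec.Relation.Unary.All.Properties as VecAllₚ
open import Data.Vec.Relation.Unary.AllPairs using (AllPairs; []; _∷_)
import Data.Vec.Relation.Unary.Any as VecAny
import Data.Vec.Relation.Unary.Any.Properties as VecAnyₚ
open import Function.Base using (_∘_; _on_)
open import Function.Bundles using (_↔_)
open import Function.Properties.Inverse using (↔⇒↣)
import Relation.Binary.Construct.NonStrictToStrict as NonStrictToStrict
import Relation.Binary.Construct.On as On
import Relation.Binary.Construct.StrictToNonStrict as StrictToNonStrict
open import Relation.Binary.Definitions using (DecidableEquality)
open import Relation.Binary.Lattice.Structures using (IsBoundedLattice)
open import Relation.Binary.PropositionalEquality using (_≡_; refl; sym; trans; cong; subst; subst₂)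
open import Relation.Binary.PropositionalEquality.Properties using (decSetoid)

private variable
  k m n : ℕ

module OrderComplex {c ℓ : Level} (K : CommutativeRing c ℓ) {X : Set a} (_≟_ : DecidableEquality X) (_<_ : Rel X r) where
  open CommutativeRing K using (1#; -_; semiring)
  open import Algebra.Properties.Semiring.Exp semiring using (_^_)
  open Free K

  -- Throughout, m is the number of vertices: these are the (m - 1)-dimensional simplices, and
  -- m = 0 gives the empty simplex, which accounts for the augmentation in reduced homology.
  record Simplex (m : ℕ) : Set (a ⊔ r) where
    constructor simplex
    field
      vertices : Vec X m
      .ordered : AllPairs _<_ vertices
  open Simplex public

  vertices-injective : {σ τ : Simplex m} → vertices σ ≡ vertices τ → σ ≡ τ
  vertices-injective refl = refl

  simplices : ℕ → DecSetoid (a ⊔ r) (a ⊔ r)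
  simplices m = decSetoid {A = Simplex m} λ σ τ →
    map′ vertices-injective (cong vertices) (Vecₚ.≡-dec _≟_ (vertices σ) (vertices τ))

  chains : ℕ → Module K (c ⊔ a ⊔ r) (ℓ ⊔ a ⊔ r)
  chains m = free (simplices m)

  Chain : ℕ → Set (c ⊔ a ⊔ r)
  Chain m = Module.Carrierᴹ (chains m)

  All-removeAt : ∀ {P : Pred X p} {v : Vec X (suc n)} i → VecAll.All P v → VecAll.All P (removeAt v i)
  All-removeAt zero                (_ VecAll.∷ ps)                  = ps
  All-removeAt {n = suc _} (suc i) (p VecAll.∷ ps@(_ VecAll.∷ _)) = p VecAll.∷ All-removeAt i ps

  AllPairs-removeAt : ∀ {v : Vec X (suc n)} i → AllPairs _<_ v → AllPairs _<_ (removeAt v i)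
  AllPairs-removeAt zero                (_ ∷ ps) = ps
  AllPairs-removeAt {n = suc _} (suc i) (p ∷ ps@(_ ∷ _)) = All-removeAt i p ∷ AllPairs-removeAt i ps

  face : Fin (suc m) → Simplex (suc m) → Simplex m
  face i (simplex v v<) = simplex (removeAt v i) (AllPairs-removeAt i v<)

  ∂ : Chain (suc m) → Chain m
  ∂ {m} = linearExtension (chains m) λ σ → map (λ i → (- 1#) ^ toℕ i , face i σ) (allFin (suc m))

  IsCycle : Pred (Chain m) (ℓ ⊔ a ⊔ r)
  IsCycle {zero}  z = ⊤
  IsCycle {suc m} z = Module._≈ᴹ_ (chains m) (∂ z) (Module.0ᴹ (chains m))

  IsBoundary : Pred (Chain m) (c ⊔ ℓ ⊔ a ⊔ r)
  IsBoundary {m} z = ∃[ w ] Module._≈ᴹ_ (chains m) (∂ w) z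

  ∂-cong : ∀ (v w : Chain (suc m)) → Module._≈ᴹ_ (chains (suc m)) v w → Module._≈ᴹ_ (chains m) (∂ v) (∂ w)
  ∂-cong {m} v w = extension-cong (chains m) (simplices (suc m)) _ (λ { refl → ≈ᴹ-refl }) v w
    where open Module (chains m)

  ∂-scale : ∀ k (v : Chain (suc m)) →
    Module._≈ᴹ_ (chains m) (∂ (scale (simplices (suc m)) k v)) (scale (simplices m) k (∂ v))
  ∂-scale {m} = extension-scale (chains m) (simplices (suc m)) _

  cycles-submodule : IsSubmodule (chains m) IsCycle
  cycles-submodule {zero}  = _
  cycles-submodule {suc m} = record
    { respects = λ {v} {w} v≈w z → ≈ᴹ-trans (∂-cong w v (Module.≈ᴹ-sym (chains (suc m)) v≈w)) z
    ; 0-closed = ≈ᴹ-refl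
    ; +-closed = λ {v} {w} y z → ≈ᴹ-trans (extension-++ (chains m) _ v w) (≈ᴹ-trans (+ᴹ-cong y z) (+ᴹ-identityˡ 0ᴹ))
    ; *-closed = λ k {v} z → ≈ᴹ-trans (∂-scale k v) (≈ᴹ-trans (*ₗ-congˡ z) (*ₗ-zeroʳ k))
    }
    where open Module (chains m)

  boundaries-submodule : IsSubmodule (chains m) IsBoundary
  boundaries-submodule {m} = record
    { respects = λ v≈w (b , ∂b≈v) → b , ≈ᴹ-trans ∂b≈v v≈w
    ; 0-closed = [] , ≈ᴹ-refl
    ; +-closed = λ (b , ∂b≈v) (b′ , ∂b′≈w) → b ++ b′ , ≈ᴹ-trans (extension-++ (chains m) _ b b′) (+ᴹ-cong ∂b≈v ∂b′≈w)
    ; *-closed = λ k (b , ∂b≈v) → scale (simplices (suc m)) k b , ≈ᴹ-trans (∂-scale k b) (*ₗ-congˡ ∂b≈v)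
    }
    where open Module (chains m)

  -- Reduced homology in dimension m - 1
  H̃[_-1] : ℕ → Module K (c ⊔ ℓ ⊔ a ⊔ r) (c ⊔ ℓ ⊔ a ⊔ r)
  H̃[ m -1] = subquotient (cycles-submodule {m}) (boundaries-submodule {m})

record GeometricLattice c ℓ : Set (lsuc (c ⊔ ℓ)) where
  infix 4 _≤_ _⋖_
  infixr 6 _∨_
  infixr 7 _∧_
  field
    Carrier          : Set c
    _≤_              : Rel Carrier ℓ
    _∨_ _∧_          : Carrier → Carrier → Carrier
    𝟏 𝟎              : Carrier
    isBoundedLattice : IsBoundedLattice _≡_ _≤_ _∨_ _∧_ 𝟏 𝟎
    size             : ℕ
    finite           : Carrier ↔ Fin size

  open IsBoundedLattice isBoundedLattice public
    using (maximum; minimum; x≤x∨y; y≤x∨y; ∨-least)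
    renaming (refl to ≤-refl; reflexive to ≤-reflexive; trans to ≤-trans; antisym to ≤-antisym)

  open NonStrictToStrict _≡_ _≤_ public using (_<_)

  _≟_ : DecidableEquality Carrier
  _≟_ = Finₚ.inj⇒≟ (↔⇒↣ finite)

  _⋖_ : Rel Carrier (c ⊔ ℓ)
  x ⋖ y = x < y × (∀ z → ¬ (x < z × z < y))

  Atom : Set (c ⊔ ℓ)
  Atom = [ a ∈ Carrier ∣ 𝟎 ⋖ a ]

  ⋁ : List Atom → Carrier
  ⋁ = foldr (λ a x → value a ∨ x) 𝟎

  -- Semimodularity is stated as: the lattice is graded and its rank function is submodular.
  field
    atomic      : ∀ x → ∃[ as ] x ≡ ⋁ as
    rk          : Carrier → ℕ
    rk-𝟎        : rk 𝟎 ≡ 0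
    rk-<        : ∀ {x y} → x < y → rk x ℕ.< rk y
    rk-⋖        : ∀ {x y} → x ⋖ y → rk y ≡ suc (rk x)
    semimodular : ∀ x y → rk (x ∧ y) ℕ.+ rk (x ∨ y) ℕ.≤ rk x ℕ.+ rk y

-- Sets {s₁ < … < sₖ} ⊆ {1, …, n - 1}
record RankSet (n k : ℕ) : Set where
  field
    ranks      : Vec ℕ k
    increasing : AllPairs ℕ._<_ ranks
    bounded    : VecAll.All (λ s → 1 ℕ.≤ s × s ℕ.< n) ranks

permutations : ∀ n → List (Permutation′ n)
permutations zero    = idₚ ∷ []
permutations (suc n) = cartesianProductWith (insert zero) (allFin (suc n)) (permutations n)

-- The sign of σ is (-1)^(inversions σ).
inversions : Permutation′ n → ℕ
inversions {n} σ =
  length (filter (λ (i , j) → i Finₚ.<? j ×-dec σ ⟨$⟩ʳ j Finₚ.<? σ ⟨$⟩ʳ i) (cartesianProduct (allFin n) (allFin n)))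

-- Boxes are pairs (row , column), rows numbered from the bottom and columns from the left.
Diagram : Set
Diagram = List (ℕ × ℕ)

-- The boxes of a ribbon in reading order, starting from the given row and column.
ribbonFrom : (row col : ℕ) → List ℕ → Diagram
ribbonFrom row col []       = []
ribbonFrom row col (r ∷ rs) = map (λ j → row , col ℕ.+ j) (upTo r) ++ ribbonFrom (suc row) (col ℕ.+ (r ∸ 1)) rs

Rib : List ℕ → Diagram
Rib = ribbonFrom 0 0

-- s₁ - s₀, s₂ - s₁, …, n - sₖ
gaps : (s₀ n : ℕ) → Vec ℕ k → List ℕ
gaps s₀ n []      = n ∸ s₀ ∷ []
gaps s₀ n (s ∷ S) = s ∸ s₀ ∷ gaps s n S

module NBC (P : GeometricLattice c ℓ) (_≺_ : Rel (GeometricLattice.Atom P) ℓ₂) where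
  open GeometricLattice P
  open StrictToNonStrict _≡_ _≺_ using () renaming (_≤_ to _≼_)

  IsMinimumOf : Pred Atom p → Pred Atom (c ⊔ ℓ ⊔ ℓ₂ ⊔ p)
  IsMinimumOf U a = U a × (∀ b → U b → a ≼ b)

  IsNBCIndependent : Pred (List Atom) (c ⊔ ℓ ⊔ ℓ₂)
  IsNBCIndependent as = rk (⋁ as) ≡ length as × (∀ a → a ∉ as → value a ≤ ⋁ as → Any (_≺ a) as)

  record IsNBC⁺Basis (as : List Atom) : Set (c ⊔ ℓ ⊔ ℓ₂) where
    field
      nbc     : IsNBCIndependent as
      full    : length as ≡ rk 𝟏
      minimal : ∀ j → IsMinimumOf (λ a → value a ≤ ⋁ (take (suc (toℕ j)) as) × ¬ value a ≤ ⋁ (take (toℕ j) as))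
                                  (List.lookup as j)

module Matroid (P : GeometricLattice c ℓ) where
  open GeometricLattice P

  IsMatroidBasis : Pred (List Atom) c
  IsMatroidBasis as = length as ≡ rk 𝟏 × ⋁ as ≡ 𝟏

  abstract
    ∈⇒≤⋁ : ∀ {a as} → a ∈ as → value a ≤ ⋁ as
    ∈⇒≤⋁ (here refl) = x≤x∨y _ _
    ∈⇒≤⋁ (there a∈)  = ≤-trans (∈⇒≤⋁ a∈) (y≤x∨y _ _)

    ⋁-least : ∀ as {x} → (∀ {a} → a ∈ as → value a ≤ x) → ⋁ as ≤ x
    ⋁-least []       h = minimum _
    ⋁-least (a ∷ as) h = ∨-least (h (here refl)) (⋁-least as (h ∘ there))

    ⋁-mono : ∀ {as bs} → (∀ {a} → a ∈ as → a ∈ bs) → ⋁ as ≤ ⋁ bs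
    ⋁-mono {as} h = ⋁-least as (∈⇒≤⋁ ∘ h)

    rk-atom : (a : Atom) → rk (value a) ≡ 1
    rk-atom (a , [ p ]) = recompute (rk a ℕₚ.≟ 1) (trans (rk-⋖ p) (cong suc rk-𝟎))

    rk-∨ : ∀ x y → rk (x ∨ y) ℕ.≤ rk x ℕ.+ rk y
    rk-∨ x y = ℕₚ.≤-trans (ℕₚ.m≤n+m _ _) (semimodular x y)

    rk-⋁ : ∀ as → rk (⋁ as) ℕ.≤ length as
    rk-⋁ []       = ℕₚ.≤-reflexive rk-𝟎
    rk-⋁ (a ∷ as) = ℕₚ.≤-trans (rk-∨ (value a) (⋁ as)) (ℕₚ.+-mono-≤ (ℕₚ.≤-reflexive (rk-atom a)) (rk-⋁ as))

    rk-mono : ∀ {x y} → x ≤ y → rk x ℕ.≤ rk y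
    rk-mono {x} {y} x≤y with x ≟ y
    ... | yes refl = ℕₚ.≤-refl
    ... | no  x≢y  = ℕₚ.<⇒≤ (rk-< (x≤y , x≢y))

    ⋁-++ : ∀ as bs → ⋁ (as ++ bs) ≤ ⋁ as ∨ ⋁ bs
    ⋁-++ []       bs = y≤x∨y _ _
    ⋁-++ (a ∷ as) bs = ∨-least (≤-trans (x≤x∨y _ _) (x≤x∨y _ _))
      (≤-trans (⋁-++ as bs) (∨-least (≤-trans (y≤x∨y _ _) (x≤x∨y _ _)) (y≤x∨y _ _)))

    take-⊆ : ∀ {s t} → s ℕ.≤ t → (as : List Atom) → ∀ {a} → a ∈ take s as → a ∈ take t as
    take-⊆ (s≤s s≤t) (a ∷ as) (here p)  = here p
    take-⊆ (s≤s s≤t) (a ∷ as) (there p) = there (take-⊆ s≤t as p)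

  rk-full : ∀ {x} → rk x ≡ rk 𝟏 → x ≡ 𝟏
  rk-full {x} p with x ≟ 𝟏
  ... | yes x≡𝟏 = x≡𝟏
  ... | no  x≢𝟏 = contradiction p (ℕₚ.<⇒≢ (rk-< (maximum x , x≢𝟏)))

  ⋁-cong-⊆ : ∀ {as bs} → (∀ {a} → a ∈ as → a ∈ bs) → (∀ {a} → a ∈ bs → a ∈ as) → ⋁ as ≡ ⋁ bs
  ⋁-cong-⊆ as⊆bs bs⊆as = ≤-antisym (⋁-mono as⊆bs) (⋁-mono bs⊆as)

  rk-prefix : ∀ {as s} → IsMatroidBasis as → s ℕ.≤ rk 𝟏 → rk (⋁ (take s as)) ≡ s
  rk-prefix {as} {s} (len , span) s≤n = ℕₚ.≤-antisym
    (ℕₚ.≤-trans (rk-⋁ (take s as)) (ℕₚ.≤-trans (ℕₚ.≤-reflexive (Listₚ.length-take s as)) (ℕₚ.m⊓n≤m s _)))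
    (ℕₚ.+-cancelʳ-≤ (rk 𝟏 ∸ s) s _ (begin
      s ℕ.+ (rk 𝟏 ∸ s)                                  ≡⟨ ℕₚ.m+[n∸m]≡n s≤n ⟩
      rk 𝟏                                              ≡⟨ cong rk span ⟨
      rk (⋁ as)                                         ≡⟨ cong (rk ∘ ⋁) (Listₚ.take++drop≡id s as) ⟨
      rk (⋁ (take s as ++ drop s as))                   ≤⟨ rk-mono (⋁-++ (take s as) (drop s as)) ⟩
      rk (⋁ (take s as) ∨ ⋁ (drop s as))                ≤⟨ rk-∨ _ _ ⟩
      rk (⋁ (take s as)) ℕ.+ rk (⋁ (drop s as))         ≤⟨ ℕₚ.+-monoʳ-≤ (rk (⋁ (take s as))) (rk-⋁ (drop s as)) ⟩
      rk (⋁ (take s as)) ℕ.+ length (drop s as)         ≡⟨ cong (rk (⋁ (take s as)) ℕ.+_) (trans (Listₚ.length-drop s as) (cong (_∸ s) len)) ⟩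
      rk (⋁ (take s as)) ℕ.+ (rk 𝟏 ∸ s)                 ∎))
    where open ℕₚ.≤-Reasoning

  prefix-< : ∀ {as s t} → IsMatroidBasis as → t ℕ.≤ rk 𝟏 → s ℕ.< t → ⋁ (take s as) < ⋁ (take t as)
  prefix-< {as} {s} {t} basis t≤n s<t =
    ⋁-mono (take-⊆ (ℕₚ.<⇒≤ s<t) as) ,
    λ eq → ℕₚ.<⇒≢ s<t (trans (sym (rk-prefix basis (ℕₚ.≤-trans (ℕₚ.<⇒≤ s<t) t≤n))) (trans (cong rk eq) (rk-prefix basis t≤n)))

module Fillings (P : GeometricLattice c ℓ) (_≺_ : Rel (GeometricLattice.Atom P) ℓ₂) (D : Diagram) where
  open GeometricLattice P
  open Matroid P
  open NBC P _≺_

  -- A box is referred to by its position in the listing D, which is the reading order.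
  Box : Set
  Box = Fin (length D)

  row col : Box → ℕ
  row = proj₁ ∘ List.lookup D
  col = proj₂ ∘ List.lookup D

  Filling : Set (c ⊔ ℓ)
  Filling = Vec Atom (length D)

  word : Filling → List Atom
  word = toList

  infixr 7 _•_
  _•_ : Permutation′ (length D) → Filling → Filling
  σ • F = tabulate λ b → lookup F (σ ⟨$⟩ˡ b)

  columnGroup : List (Permutation′ (length D))
  columnGroup = filter (λ σ → Finₚ.all? λ b → col (σ ⟨$⟩ʳ b) ℕₚ.≟ col b) (permutations (length D))

  record IsStandard (F : Filling) : Set ℓ₂ where
    field
      along-rows   : ∀ b b′ → row b ≡ row b′ → col b ℕ.< col b′ → lookup F b ≺ lookup F b′
      down-columns : ∀ b b′ → col b ≡ col b′ → row b′ ℕ.< row b → lookup F b ≺ lookup F b′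

  BasisFilling : Set (c ⊔ ℓ)
  BasisFilling = [ F ∈ Filling ∣ IsMatroidBasis (word F) ]

  abstract
    word-• : ∀ σ F {a} → a ∈ word F → a ∈ word (σ • F)
    word-• σ F {a} a∈ =
      let a∈F = VecMₚ.∈-toList⁻ a∈
          i   = VecAny.index a∈F
      in VecMₚ.∈-toList⁺ (subst (VecM._∈ (σ • F))
           (trans (cong (lookup F) (inverseˡ σ)) (sym (VecAnyₚ.lookup-index a∈F)))
           (VecMₚ.∈-tabulate⁺ (λ b → lookup F (σ ⟨$⟩ˡ b)) (σ ⟨$⟩ʳ i)))

    word-•⁻ : ∀ σ F {a} → a ∈ word (σ • F) → a ∈ word F
    word-•⁻ σ F p =
      let q = VecMₚ.∈-toList⁻ p in
      subst (_∈ word F) (sym (trans (VecAnyₚ.lookup-index q) (Vecₚ.lookup∘tabulate _ (VecAny.index q))))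
        (VecMₚ.∈-toList⁺ (VecMₚ.∈-lookup (σ ⟨$⟩ˡ VecAny.index q) F))

    basis-• : ∀ σ F → IsMatroidBasis (word F) → IsMatroidBasis (word (σ • F))
    basis-• σ F (len , span) =
      trans (Vecₚ.length-toList (σ • F)) (trans (sym (Vecₚ.length-toList F)) len) ,
      trans (⋁-cong-⊆ (word-•⁻ σ F) (word-• σ F)) span

  infixr 7 _•ᵇ_
  _•ᵇ_ : Permutation′ (length D) → BasisFilling → BasisFilling
  σ •ᵇ (F , [ b ]) = σ • F , [ basis-• σ F b ]

  -- Equality modulo permutations of the entries within the rows
  infix 4 _~_
  _~_ : Rel BasisFilling (c ⊔ ℓ)
  F ~ G = ∃[ ρ ] (∀ b → row (ρ ⟨$⟩ʳ b) ≡ row b) × ρ •ᵇ F ≡ G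

  tabloids : Setoid (c ⊔ ℓ) (c ⊔ ℓ)
  tabloids = record
    { Carrier = BasisFilling
    ; _≈_     = _~_
    ; isEquivalence = record
      { refl  = idₚ , (λ _ → refl) , Refinementₚ.value-injective (Vecₚ.tabulate∘lookup _)
      ; sym   = λ { {F , _} (ρ , rows , refl) → flip ρ ,
          (λ b → trans (sym (rows _)) (cong row (inverseʳ ρ))) ,
          Refinementₚ.value-injective (trans (Vecₚ.tabulate-cong λ b →
            trans (Vecₚ.lookup∘tabulate (λ b′ → lookup F (ρ ⟨$⟩ˡ b′)) (ρ ⟨$⟩ʳ b)) (cong (lookup F) (inverseˡ ρ))) (Vecₚ.tabulate∘lookup F)) }
      ; trans = λ { {F , _} (ρ , rows , refl) (τ , rows′ , refl) → ρ ∘ₚ τ ,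
          (λ b → trans (rows′ _) (rows b)) ,
          Refinementₚ.value-injective (Vecₚ.tabulate-cong λ b → sym (Vecₚ.lookup∘tabulate (λ b′ → lookup F (ρ ⟨$⟩ˡ b′)) (τ ⟨$⟩ˡ b))) }
      }
    }

  module _ (K : CommutativeRing p q) where
    open CommutativeRing K using (1#; -_; semiring)
    open import Algebra.Properties.Semiring.Exp semiring using (_^_)

    -- v_F = ∑ sgn(σ) {σF}, the sum being over the column group
    polytabloid : BasisFilling → Free.Combination K (Setoid.Carrier tabloids)
    polytabloid F = map (λ σ → (- 1#) ^ inversions σ , σ •ᵇ F) columnGroup

lookup-++ : ∀ {A : Set a} (xs ys : List A) (b : Fin (length (xs ++ ys))) →
  (∃[ i ] List.lookup (xs ++ ys) b ≡ List.lookup xs i × toℕ b ≡ toℕ i) ⊎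
  (∃[ i ] List.lookup (xs ++ ys) b ≡ List.lookup ys i × toℕ b ≡ length xs ℕ.+ toℕ i)
lookup-++ []       ys b       = inj₂ (b , refl , refl)
lookup-++ (x ∷ xs) ys zero    = inj₁ (zero , refl , refl)
lookup-++ (x ∷ xs) ys (suc b) with lookup-++ xs ys b
... | inj₁ (i , p , q) = inj₁ (suc i , p , cong suc q)
... | inj₂ (i , p , q) = inj₂ (i , p , cong suc q)

lookup-map : ∀ {A : Set a} {B : Set c} (f : A → B) xs i → ∃[ j ] List.lookup (map f xs) i ≡ f (List.lookup xs j) × toℕ i ≡ toℕ j
lookup-map f (x ∷ xs) zero    = zero , refl , refl
lookup-map f (x ∷ xs) (suc i) = let j , p , q = lookup-map f xs i in suc j , p , cong suc q

rowAt : (D : Diagram) → Fin (length D) → ℕ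
rowAt D b = proj₁ (List.lookup D b)

row-split : ∀ r₀ c₀ r rs (b : Fin (length (ribbonFrom r₀ c₀ (r ∷ rs)))) →
  (rowAt (ribbonFrom r₀ c₀ (r ∷ rs)) b ≡ r₀ × toℕ b ℕ.< r) ⊎
  (Σ[ i ∈ Fin (length (ribbonFrom (suc r₀) (c₀ ℕ.+ (r ∸ 1)) rs)) ]
    rowAt (ribbonFrom r₀ c₀ (r ∷ rs)) b ≡ rowAt (ribbonFrom (suc r₀) (c₀ ℕ.+ (r ∸ 1)) rs) i × toℕ b ≡ r ℕ.+ toℕ i)
row-split r₀ c₀ r rs b with lookup-++ (map (λ j → r₀ , c₀ ℕ.+ j) (upTo r)) (ribbonFrom (suc r₀) (c₀ ℕ.+ (r ∸ 1)) rs) b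
... | inj₁ (i , p , q) = inj₁
  ( trans (cong proj₁ p) (cong proj₁ (proj₁ (proj₂ (lookup-map (λ j → r₀ , c₀ ℕ.+ j) (upTo r) i))))
  , subst₂ ℕ._<_ (sym q) (trans (Listₚ.length-map (λ j → r₀ , c₀ ℕ.+ j) (upTo r)) (Listₚ.length-upTo r)) (Finₚ.toℕ<n i) )
... | inj₂ (i , p , q) = inj₂
  ( i , cong proj₁ p
  , trans q (cong (ℕ._+ toℕ i) (trans (Listₚ.length-map (λ j → r₀ , c₀ ℕ.+ j) (upTo r)) (Listₚ.length-upTo r))) )

rows≥ : ∀ r₀ c₀ rs (b : Fin (length (ribbonFrom r₀ c₀ rs))) → r₀ ℕ.≤ rowAt (ribbonFrom r₀ c₀ rs) b
rows≥ r₀ c₀ (r ∷ rs) b with row-split r₀ c₀ r rs b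
... | inj₁ (p , _)     = ℕₚ.≤-reflexive (sym p)
... | inj₂ (i , p , _) = subst (r₀ ℕ.≤_) (sym p) (ℕₚ.<⇒≤ (rows≥ (suc r₀) (c₀ ℕ.+ (r ∸ 1)) rs i))

-- A box in the same row as a box of the first j rows belongs to the first j rows.
first-rows : ∀ r₀ c₀ rs j (b b′ : Fin (length (ribbonFrom r₀ c₀ rs))) →
  rowAt (ribbonFrom r₀ c₀ rs) b ≡ rowAt (ribbonFrom r₀ c₀ rs) b′ →
  toℕ b ℕ.< sum (take j rs) → toℕ b′ ℕ.< sum (take j rs)
first-rows r₀ c₀ rs       zero    b b′ same ()
first-rows r₀ c₀ (r ∷ rs) (suc j) b b′ same b< with row-split r₀ c₀ r rs b | row-split r₀ c₀ r rs b′
... | _                | inj₁ (_ , b′<r)      = ℕₚ.≤-trans b′<r (ℕₚ.m≤m+n r (sum (take j rs)))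
... | inj₁ (p , _)     | inj₂ (i′ , p′ , _)   =
  contradiction (trans (sym p) (trans same p′)) (ℕₚ.<⇒≢ (rows≥ (suc r₀) (c₀ ℕ.+ (r ∸ 1)) rs i′))
... | inj₂ (i , p , q) | inj₂ (i′ , p′ , q′) =
  subst (ℕ._< r ℕ.+ sum (take j rs)) (sym q′) (ℕₚ.+-monoʳ-< r
    (first-rows (suc r₀) (c₀ ℕ.+ (r ∸ 1)) rs j i i′ (trans (sym p) (trans same p′))
      (ℕₚ.+-cancelˡ-< r (toℕ i) (sum (take j rs)) (subst (ℕ._< r ℕ.+ sum (take j rs)) q b<))))

sum-gaps : ∀ s₀ n (S : Vec ℕ k) → AllPairs ℕ._<_ S → VecAll.All (s₀ ℕ.≤_) S → ∀ i →
  s₀ ℕ.+ sum (take (suc (toℕ i)) (gaps s₀ n S)) ≡ lookup S i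
sum-gaps s₀ n (s ∷ S) _          (s₀≤s VecAll.∷ _) zero    = trans (cong (s₀ ℕ.+_) (ℕₚ.+-identityʳ _)) (ℕₚ.m+[n∸m]≡n s₀≤s)
sum-gaps s₀ n (s ∷ S) (s< ∷ inc) (s₀≤s VecAll.∷ _) (suc i) = trans (sym (ℕₚ.+-assoc s₀ (s ∸ s₀) _))
  (trans (cong (ℕ._+ sum (take (suc (toℕ i)) (gaps s n S))) (ℕₚ.m+[n∸m]≡n s₀≤s)) (sum-gaps s n S inc (VecAll.map ℕₚ.<⇒≤ s<) i))

∈-take⁻ : ∀ {A : Set a} (F : Vec A n) s {x} → x ∈ take s (toList F) → ∃[ b ] toℕ b ℕ.< s × x ≡ lookup F b
∈-take⁻ (y ∷ F) (suc s) (here p)  = zero , s≤s z≤n , p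
∈-take⁻ (y ∷ F) (suc s) (there p) = let b , b<s , q = ∈-take⁻ F s p in suc b , s≤s b<s , q

∈-take⁺ : ∀ {A : Set a} (F : Vec A n) s b → toℕ b ℕ.< s → lookup F b ∈ take s (toList F)
∈-take⁺ (y ∷ F) (suc s) zero    _         = here refl
∈-take⁺ (y ∷ F) (suc s) (suc b) (s≤s b<s) = there (∈-take⁺ F s b b<s)

AllPairs-tabulate : ∀ {A : Set a} {_R_ : Rel A r} {S : Vec ℕ k} (f : Fin k → A) →
  (∀ i j → lookup S i ℕ.< lookup S j → f i R f j) → AllPairs ℕ._<_ S → AllPairs _R_ (tabulate f)
AllPairs-tabulate f h []       = []
AllPairs-tabulate f h (p ∷ ps) =
  VecAllₚ.tabulate⁺ (λ j → h zero (suc j) (VecAllₚ.lookup⁺ p j)) ∷ AllPairs-tabulate (f ∘ suc) (λ i j → h (suc i) (suc j)) ps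

module RankSelection (P : GeometricLattice c ℓ) (_≺_ : Rel (GeometricLattice.Atom P) ℓ₂)
                     (S : RankSet (GeometricLattice.rk P (GeometricLattice.𝟏 P)) k)
                     (K : CommutativeRing p q) where
  open GeometricLattice P
  open Matroid P
  open NBC P _≺_ public
  open RankSet S

  R : Diagram
  R = Rib (gaps 0 (rk 𝟏) ranks)

  open Fillings P _≺_ R public

  -- P^S
  Selected : Set c
  Selected = [ x ∈ Carrier ∣ rk x VecM.∈ ranks ]

  open OrderComplex K {X = Selected} (Refinementₚ._≟_ _≟_) (_<_ on value) public
  open Free K using (linearExtension; Combination; IsBasis) public

  fchain : BasisFilling → Simplex k
  fchain (F , [ basis ]) = simplex
    (tabulate λ i → ⋁ (take (lookup ranks i) (word F)) ,
                    [ subst (VecM._∈ ranks) (sym (rk-prefix basis (≤n i))) (VecMₚ.∈-lookup i ranks) ])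
    (AllPairs-tabulate _ (λ i j → prefix-< basis (≤n j)) increasing)
    where
    ≤n : ∀ i → lookup ranks i ℕ.≤ rk 𝟏
    ≤n i = ℕₚ.<⇒≤ (proj₂ (VecAllₚ.lookup⁺ bounded i))

  -- fchain only depends on the tabloid of a filling.
  fchain-cong : ∀ {F G} → F ~ G → fchain F ≡ fchain G
  fchain-cong {F , _} (ρ , rows , refl) = vertices-injective (Vecₚ.tabulate-cong λ i →
    Refinementₚ.value-injective (⋁-cong-⊆ (to i) (from i)))
    where
    initial : ∀ i {b b′} → row b ≡ row b′ → toℕ b ℕ.< lookup ranks i → toℕ b′ ℕ.< lookup ranks i
    initial i {b} {b′} same = subst (λ s → toℕ b ℕ.< s → toℕ b′ ℕ.< s)
      (sum-gaps 0 (rk 𝟏) ranks increasing (VecAll.universal (λ _ → z≤n) ranks) i)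
      (first-rows 0 0 (gaps 0 (rk 𝟏) ranks) (suc (toℕ i)) b b′ same)

    same-row : ∀ b → row b ≡ row (ρ ⟨$⟩ˡ b)
    same-row b = trans (cong row (sym (inverseʳ ρ))) (rows _)

    to : ∀ i {a} → a ∈ take (lookup ranks i) (word F) → a ∈ take (lookup ranks i) (word (ρ • F))
    to i p = let b , b< , q = ∈-take⁻ F _ p in
      subst (_∈ take (lookup ranks i) (word (ρ • F)))
        (trans (Vecₚ.lookup∘tabulate _ (ρ ⟨$⟩ʳ b)) (trans (cong (lookup F) (inverseˡ ρ)) (sym q)))
        (∈-take⁺ (ρ • F) _ (ρ ⟨$⟩ʳ b) (initial i (sym (rows b)) b<))

    from : ∀ i {a} → a ∈ take (lookup ranks i) (word (ρ • F)) → a ∈ take (lookup ranks i) (word F)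
    from i p = let b , b< , q = ∈-take⁻ (ρ • F) _ p in
      subst (_∈ take (lookup ranks i) (word F)) (sym (trans q (Vecₚ.lookup∘tabulate _ b)))
        (∈-take⁺ F _ (ρ ⟨$⟩ˡ b) (initial i (same-row b) b<))

  -- The chains of P^S obtained from tabloids, extended linearly
  f̄chain : Combination (Setoid.Carrier tabloids) → Chain k
  f̄chain = linearExtension (chains k) (λ F → (CommutativeRing.1# K , fchain F) ∷ [])

  record StandardNBC⁺ : Set (c ⊔ ℓ ⊔ ℓ₂) where
    field
      filling  : Filling
      standard : IsStandard filling
      nbc⁺     : IsNBC⁺Basis (word filling)

    basisFilling : BasisFilling
    basisFilling = filling , [ full , rk-full (trans (proj₁ nbc) full) ]
      where open IsNBC⁺Basis nbc⁺

  standardNBC⁺ : DecSetoid (c ⊔ ℓ ⊔ ℓ₂) (c ⊔ ℓ)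
  standardNBC⁺ = On.decSetoid (decSetoid (Vecₚ.≡-dec (Refinementₚ._≟_ _≟_))) StandardNBC⁺.filling

{-# OPTIONS --safe #-}

-- A chain c₁ < … < cₖ of P^S (with ranks s₁ < … < sₖ) is given the word label c of atoms whose entry at position t
-- is the least atom m outside the join x of the previous entries such that m ≤ cᵢ whenever t < sᵢ (counting positions
-- from 0). Among all bases whose prefixes join to the cᵢ it is the lexicographically least one, an NBC⁺ basis, and it
-- ascends except possibly at the positions in S; the words that descend at every position in S are exactly the
-- standard NBC⁺ fillings F, and then F is the word of the chain of F. The family is unitriangular for this order:
--
-- * A column permutation σ ≠ 1 makes F lexicographically smaller, since the first box that changes receives an entry
--   from further up its column. Hence the chain of F has coefficient 1 in the element of F, and every other chain in
--   the element has a smaller word.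
-- * If the word of a chain c ascends at some sᵢ, it is also least among the words of all chains that agree with c
--   away from rank sᵢ. Comparing coefficients of the face c ∖ cᵢ in ∂z = 0, the coefficient of c in a cycle z
--   vanishes as soon as those of all chains with larger words do.
--
-- The elements are cycles because deleting cᵢ makes the chains of σF and (sᵢ - 1 sᵢ)σF agree (positions again counted
-- from 0), while their signs are opposite.

module Submission where

open import Defs
open import Algebra.Bundles using (CommutativeRing)
open import Algebra.Module.Bundles using (Module)
import Algebra.Module.Construct.TensorUnit as TensorUnit
import Algebra.Properties.CommutativeMonoid.Sum as MonoidSum
open import Data.Bool.Base using (if_then_else_; true; false)
open import Data.Fin.Base as Fin using (Fin; zero; suc; toℕ; fromℕ<; punchIn)
open import Data.Fin.Permutation using (Permutation′; insert; _⟨$⟩ʳ_; _⟨$⟩ˡ_; inverseʳ; inverseˡ)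
import Data.Fin.Properties as Finₚ
open import Data.Irrelevant using ([_])
open import Data.List.Base as List using (List; []; _∷_; _++_; filter; length; map; take; concatMap; allFin; upTo; applyUpTo; cartesianProduct; cartesianProductWith)
open import Data.List.Membership.Propositional using (_∈_; find)
import Data.List.Membership.Propositional.Properties as ∈ₚ
import Data.List.Properties as Listₚ
import Data.List.Relation.Unary.All as All
open import Data.List.Relation.Unary.AllPairs using ([]; _∷_)
open import Data.List.Relation.Unary.Any as Any using (Any; here; there)
open import Data.List.Relation.Unary.Unique.Propositional using (Unique)
open import Data.List.Relation.Unary.Unique.Propositional.Properties using (tabulate⁺)
open import Data.Nat.Base as ℕ using (ℕ; zero; suc; pred; _∸_; s≤s; z≤n)
import Data.Nat.Properties as ℕₚ
open import Data.Product.Base using (Σ-syntax; ∃-syntax; _×_; _,_; proj₁; proj₂)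
open import Data.Refinement.Base using (value; _,_)
import Data.Refinement.Properties as Refinementₚ
open import Data.Sum.Base using (_⊎_; inj₁; inj₂; [_,_]′; map₂) renaming (map to map⊎)
open import Data.Unit.Polymorphic.Base using (⊤; tt)
open import Data.Vec.Base as Vec using (Vec; []; _∷_; lookup; removeAt; tabulate; toList)
import Data.Vec.Membership.DecPropositional ℕₚ._≟_ as VecM?
import Data.Vec.Membership.Propositional as VecM
import Data.Vec.Membership.Propositional.Properties as VecMₚ
import Data.Vec.Properties as Vecₚ
import Data.Vec.Relation.Unary.All as VecAll
import Data.Vec.Relation.Unary.All.Properties as VecAllₚ
open import Data.Vec.Relation.Unary.AllPairs as AllPairs using (AllPairs; []; _∷_)
import Data.Vec.Relation.Unary.Any as VecAny
import Data.Vec.Relation.Unary.Any.Properties as VecAnyₚ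
open import Function.Base using (_∘_; id; _on_)
open import Function.Bundles using (Inverse)
open import Level using (Level; _⊔_)
open import Relation.Binary.Bundles using (DecSetoid)
open import Relation.Binary.Core using (Rel)
open import Relation.Binary.Definitions using (DecidableEquality; Transitive; tri<; tri≈; tri>) renaming (Decidable to Decidable₂)
open import Relation.Binary.PropositionalEquality using (_≡_; _≢_; refl; sym; trans; cong; cong₂; subst; subst₂; module ≡-Reasoning)
import Relation.Binary.Reasoning.Setoid as ≈-Reasoning
open import Relation.Binary.Structures using (IsStrictTotalOrder)
open import Relation.Nullary.Decidable using (Dec; yes; no; does; map′; ¬?; _×-dec_; _→-dec_; recompute; decidable-stable)
open import Relation.Nullary.Negation using (¬_; contradiction)
open import Relation.Unary using (Pred; Decidable)

private variable
  a c p q r r′ ℓ ℓ₁ ℓ₂ ℓ₃ : Level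
  k m n : ℕ

-- Formal linear combinations and linear functionals on them.

module Linear {c ℓ : Level} (K : CommutativeRing c ℓ) where
  open CommutativeRing K hiding (zero; refl; sym; trans) renaming (Carrier to 𝕂)
  private module ≈ = CommutativeRing K
  open Free K
  open ≈-Reasoning setoid

  unit : Module K c ℓ
  unit = TensorUnit.⟨module⟩ {R = K}

  eval : {X : Set r} → (X → 𝕂) → Combination X → 𝕂
  eval = linearExtension unit

  -- Transfers a basis question from `H` to `M` along a linear map. In use `H` is a homology module,
  -- `M` the chains and `π` the first projection, so that the three laws, stated with `≡`, hold by
  -- `refl`.
  module Image (H : Module K a ℓ₁) (M : Module K p q) (I : DecSetoid r ℓ₂)
               (π : Module.Carrierᴹ H → Module.Carrierᴹ M) (e : DecSetoid.Carrier I → Module.Carrierᴹ H)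
               (π-+ : ∀ x y → π (Module._+ᴹ_ H x y) ≡ Module._+ᴹ_ M (π x) (π y))
               (π-* : ∀ k x → π (Module._*ₗ_ H k x) ≡ Module._*ₗ_ M k (π x))
               (π-0 : π (Module.0ᴹ H) ≡ Module.0ᴹ M) where
    private
      module H = Module H
      module M = Module M

    extension-image : ∀ v → π (linearExtension H e v) ≡ linearExtension M (π ∘ e) v
    extension-image []            = π-0
    extension-image ((k , i) ∷ v) = trans (π-+ (k H.*ₗ e i) _) (cong₂ M._+ᴹ_ (π-* k (e i)) (extension-image v))

    basis-by-image : (∀ x → x H.≈ᴹ H.0ᴹ → π x M.≈ᴹ M.0ᴹ) → (∀ x y → π x M.≈ᴹ π y → x H.≈ᴹ y) →
      (∀ v → linearExtension M (π ∘ e) v M.≈ᴹ M.0ᴹ → ∀ i → coefficient I v i ≈ 0#) →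
      (∀ x → ∃[ v ] linearExtension M (π ∘ e) v M.≈ᴹ π x) → IsBasis H I e
    basis-by-image preserves reflects independent spans = record
      { linearlyIndependent = λ v v≈0 → independent v (subst (M._≈ᴹ M.0ᴹ) (extension-image v) (preserves _ v≈0))
      ; spanning            = λ x → let v , Ev≈x = spans x in
          v , reflects _ x (subst (M._≈ᴹ π x) (sym (extension-image v)) Ev≈x)
      }

  eval-zero : {X : Set r} {g : X → 𝕂} → (∀ x → g x ≈ 0#) → ∀ v → eval g v ≈ 0#
  eval-zero g≈0 []            = ≈.refl
  eval-zero g≈0 ((k , x) ∷ v) = ≈.trans (+-cong (≈.trans (*-congˡ (g≈0 x)) (zeroʳ k)) (eval-zero g≈0 v)) (+-identityˡ 0#)

  eval-congˡ : {X : Set r} {g h : X → 𝕂} → (∀ x → g x ≈ h x) → ∀ v → eval g v ≈ eval h v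
  eval-congˡ g≈h []            = ≈.refl
  eval-congˡ g≈h ((k , x) ∷ v) = +-cong (*-congˡ (g≈h x)) (eval-congˡ g≈h v)

  eval-+ : {X : Set r} (g h : X → 𝕂) → ∀ v → eval (λ x → g x + h x) v ≈ eval g v + eval h v
  eval-+ g h []            = ≈.sym (+-identityˡ 0#)
  eval-+ g h ((k , x) ∷ v) = ≈.trans (+-cong (distribˡ k (g x) (h x)) (eval-+ g h v)) (interchange _ _ _ _)
    where open import Algebra.Properties.CommutativeSemigroup +-commutativeSemigroup using (interchange)

  eval-* : {X : Set r} (k : 𝕂) (g : X → 𝕂) → ∀ v → eval (λ x → k * g x) v ≈ k * eval g v
  eval-* k g []            = ≈.sym (zeroʳ k)
  eval-* k g ((l , x) ∷ v) = ≈.trans (+-cong (x∙yz≈y∙xz l k (g x)) (eval-* k g v)) (≈.sym (distribˡ k _ _))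
    where open import Algebra.Properties.CommutativeSemigroup *-commutativeSemigroup using (x∙yz≈y∙xz)

  module _ (X : DecSetoid r ℓ₂) where
    private module X = DecSetoid X

    coefficient-congʳ : ∀ v {y z} → y X.≈ z → coefficient X v y ≈ coefficient X v z
    coefficient-congʳ []            y≈z = ≈.refl
    coefficient-congʳ ((k , x) ∷ v) {y} {z} y≈z with x X.≟ y | x X.≟ z
    ... | yes _   | yes _   = +-congˡ (coefficient-congʳ v y≈z)
    ... | no  _   | no  _   = +-congˡ (coefficient-congʳ v y≈z)
    ... | yes x≈y | no  x≉z = contradiction (X.trans x≈y y≈z) x≉z
    ... | no  x≉y | yes x≈z = contradiction (X.trans x≈z (X.sym y≈z)) x≉y

    eval-linearExtension : {I : Set r′} (g : X.Carrier → 𝕂) (f : I → Combination X.Carrier) → ∀ v →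
      eval g (linearExtension (free X) f v) ≈ eval (λ i → eval g (f i)) v
    eval-linearExtension g f []            = ≈.refl
    eval-linearExtension g f ((k , i) ∷ v) = ≈.trans (extension-++ unit g (scale X k (f i)) _)
      (+-cong (extension-scale unit X g k (f i)) (eval-linearExtension g f v))

    coefficient-extension : {I : Set r′} (f : I → Combination X.Carrier) → ∀ v y →
      coefficient X (linearExtension (free X) f v) y ≈ eval (λ i → coefficient X (f i) y) v
    coefficient-extension f []            y = ≈.refl
    coefficient-extension f ((k , i) ∷ v) y =
      ≈.trans (coefficient-++ X (scale X k (f i)) _ y) (+-cong (coefficient-scale X k (f i) y) (coefficient-extension f v y))

    eval-cong : {g : X.Carrier → 𝕂} → (∀ {x y} → x X.≈ y → g x ≈ g y) → ∀ {v w} → _≋_ X v w → eval g v ≈ eval g w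
    eval-cong {g} g-cong {v} {w} = extension-cong unit X g g-cong v w

    module _ {P : Pred X.Carrier p} (P? : Decidable P) (P-resp : ∀ {x y} → x X.≈ y → P x → P y) where

      restrict : Combination X.Carrier → Combination X.Carrier
      restrict = filter (P? ∘ proj₂)

      coefficient-restrict-in : ∀ v {y} → P y → coefficient X (restrict v) y ≈ coefficient X v y
      coefficient-restrict-in []            Py = ≈.refl
      coefficient-restrict-in ((k , x) ∷ v) {y} Py with P? x
      ... | yes _  = +-congˡ (coefficient-restrict-in v Py)
      ... | no ¬Px with x X.≟ y
      ...   | yes x≈y = contradiction (P-resp (X.sym x≈y) Py) ¬Px
      ...   | no  _   = ≈.trans (coefficient-restrict-in v Py) (≈.sym (+-identityˡ _))

      coefficient-restrict-out : ∀ v {y} → ¬ P y → coefficient X (restrict v) y ≈ 0#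
      coefficient-restrict-out []            ¬Py = ≈.refl
      coefficient-restrict-out ((k , x) ∷ v) {y} ¬Py with P? x
      ... | no  _  = coefficient-restrict-out v ¬Py
      ... | yes Px with x X.≟ y
      ...   | yes x≈y = contradiction (P-resp x≈y Px) ¬Py
      ...   | no  _   = ≈.trans (+-identityˡ _) (coefficient-restrict-out v ¬Py)

      eval-restrict : ∀ {g : X.Carrier → 𝕂} {x₀} → (∀ x → P x → x X.≈ x₀ ⊎ g x ≈ 0#) → (∀ {x y} → x X.≈ y → g x ≈ g y) →
        ∀ v → eval g (restrict v) ≈ coefficient X (restrict v) x₀ * g x₀
      eval-restrict h g-cong []            = ≈.sym (zeroˡ _)
      eval-restrict {g} {x₀} h g-cong ((k , x) ∷ v) with P? x
      ... | no  _  = eval-restrict h g-cong v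
      ... | yes Px with x X.≟ x₀
      ...   | yes x≈x₀ = ≈.trans (+-cong (*-congˡ (g-cong x≈x₀)) (eval-restrict h g-cong v)) (≈.sym (distribʳ _ _ _))
      ...   | no  x≉x₀ = begin
        k * g x + eval g (restrict v)                      ≈⟨ +-cong (*-congˡ ([ (λ e → contradiction e x≉x₀) , (λ e → e) ]′ (h x Px))) (eval-restrict h g-cong v) ⟩
        k * 0# + coefficient X (restrict v) x₀ * g x₀      ≈⟨ +-congʳ (zeroʳ k) ⟩
        0# + coefficient X (restrict v) x₀ * g x₀          ≈⟨ +-identityˡ _ ⟩
        coefficient X (restrict v) x₀ * g x₀               ≈⟨ *-congʳ (+-identityˡ _) ⟨
        (0# + coefficient X (restrict v) x₀) * g x₀        ∎

      -- The list `v` may contain terms outside `P` that cancel each other, so it is first replaced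
      -- by its restriction to `P`, which has the same coefficients; there only terms at `x₀`
      -- contribute.
      eval-point : ∀ {g : X.Carrier → 𝕂} {x₀} → (∀ {x y} → x X.≈ y → g x ≈ g y) → P x₀ →
        (∀ x → P x → x X.≈ x₀ ⊎ g x ≈ 0#) → ∀ v → (∀ x → ¬ P x → coefficient X v x ≈ 0#) →
        eval g v ≈ coefficient X v x₀ * g x₀
      eval-point {g} {x₀} g-cong Px₀ h v v-out = begin
        eval g v                                  ≈⟨ eval-cong g-cong {v} {restrict v} v≋ ⟩
        eval g (restrict v)                       ≈⟨ eval-restrict h g-cong v ⟩
        coefficient X (restrict v) x₀ * g x₀      ≈⟨ *-congʳ (coefficient-restrict-in v Px₀) ⟩
        coefficient X v x₀ * g x₀                 ∎
        where
        v≋ : _≋_ X v (restrict v)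
        at v≋ y with P? y
        ... | yes Py = ≈.sym (coefficient-restrict-in v Py)
        ... | no ¬Py = ≈.trans (v-out y ¬Py) (≈.sym (coefficient-restrict-out v ¬Py))

    coefficient-here : ∀ k {x y} v → x X.≈ y → coefficient X ((k , x) ∷ v) y ≈ k + coefficient X v y
    coefficient-here k {x} {y} v x≈y with x X.≟ y
    ... | yes _   = ≈.refl
    ... | no  x≉y = contradiction x≈y x≉y

    coefficient-there : ∀ k {x y} v → ¬ x X.≈ y → coefficient X ((k , x) ∷ v) y ≈ coefficient X v y
    coefficient-there k {x} {y} v x≉y with x X.≟ y
    ... | yes x≈y = contradiction x≈y x≉y
    ... | no  _   = +-identityˡ _

    coefficient-absent : ∀ {y} v → ¬ Any (λ (_ , x) → x X.≈ y) v → coefficient X v y ≈ 0#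
    coefficient-absent []            _  = ≈.refl
    coefficient-absent ((k , x) ∷ v) y∉ = ≈.trans (coefficient-there k v (y∉ ∘ here)) (coefficient-absent v (y∉ ∘ there))

  -- Unitriangular families.

  module Triangular
    (X : DecSetoid r ℓ₂) (code : DecSetoid.Carrier X → ℕ)
    (code-cong : ∀ {x y} → DecSetoid._≈_ X x y → code x ≡ code y)
    (code-injective : ∀ {x y} → code x ≡ code y → DecSetoid._≈_ X x y)
    (bound : ℕ) (code<bound : ∀ x → code x ℕ.< bound)
    (I : DecSetoid r′ ℓ₃) (pivot : DecSetoid.Carrier I → DecSetoid.Carrier X)
    (pivot-cong : ∀ {i j} → DecSetoid._≈_ I i j → DecSetoid._≈_ X (pivot i) (pivot j))
    (pivot-injective : ∀ {i j} → DecSetoid._≈_ X (pivot i) (pivot j) → DecSetoid._≈_ I i j)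
    (e : DecSetoid.Carrier I → Combination (DecSetoid.Carrier X))
    (e-cong : ∀ {i j} → DecSetoid._≈_ I i j → _≋_ X (e i) (e j))
    (pivot-one : ∀ i → coefficient X (e i) (pivot i) ≈ 1#)
    (above-zero : ∀ i y → code (pivot i) ℕ.< code y → coefficient X (e i) y ≈ 0#)
    where
    private
      module X = DecSetoid X
      module I = DecSetoid I
      module V = Module (free X)
      E = linearExtension (free X) e

    -- Downward induction on the code of the pivot. In the coefficient of the combination at
    -- `pivot i`, every `e j` with a smaller pivot vanishes, and those with a larger pivot carry
    -- coefficient 0 by induction, which leaves `coefficient I v i`.
    independent : ∀ v → _≋_ X (E v) [] → ∀ i → coefficient I v i ≈ 0#
    independent v Ev≈0 i = claim bound i (ℕₚ.m≤m+n bound _)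
      where
      -- `d` bounds the distance from the code of the pivot up to `bound`, so `d = 0` is impossible.
      claim : ∀ d i → bound ℕ.≤ d ℕ.+ code (pivot i) → coefficient I v i ≈ 0#
      claim zero    i b≤ = contradiction (code<bound (pivot i)) (ℕₚ.≤⇒≯ b≤)
      claim (suc d) i b≤ = begin
        coefficient I v i                                        ≈⟨ *-identityʳ _ ⟨
        coefficient I v i * 1#                                   ≈⟨ *-congˡ (pivot-one i) ⟨
        coefficient I v i * coefficient X (e i) (pivot i)        ≈⟨ eval-point I (λ j → code (pivot j) ℕₚ.≤? code (pivot i))
                                                                      (λ j≈j′ → subst (ℕ._≤ code (pivot i)) (code-cong (pivot-cong j≈j′)))
                                                                      (λ j≈j′ → at (e-cong j≈j′) (pivot i)) ℕₚ.≤-refl below v above ⟨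
        eval (λ j → coefficient X (e j) (pivot i)) v             ≈⟨ coefficient-extension X e v (pivot i) ⟨
        coefficient X (E v) (pivot i)                            ≈⟨ at Ev≈0 (pivot i) ⟩
        0#                                                       ∎
        where
        below : ∀ j → code (pivot j) ℕ.≤ code (pivot i) → j I.≈ i ⊎ coefficient X (e j) (pivot i) ≈ 0#
        below j j≤i with ℕₚ.m≤n⇒m<n∨m≡n j≤i
        ... | inj₁ j<i = inj₂ (above-zero j (pivot i) j<i)
        ... | inj₂ j≡i = inj₁ (pivot-injective (code-injective j≡i))

        above : ∀ j → ¬ code (pivot j) ℕ.≤ code (pivot i) → coefficient I v j ≈ 0#
        above j j≰i = claim d j (ℕₚ.≤-trans b≤ (ℕₚ.≤-trans (ℕₚ.≤-reflexive (sym (ℕₚ.+-suc d _))) (ℕₚ.+-monoʳ-≤ d (ℕₚ.≰⇒> j≰i))))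

    module _ {Z : Pred (Combination X.Carrier) q} (isZ : IsSubmodule (free X) Z) (e∈Z : ∀ i → Z (e i))
             (eliminate : ∀ z x → Z z → (∃[ i ] pivot i X.≈ x) ⊎
                          ((∀ y → code x ℕ.< code y → coefficient X z y ≈ 0#) → coefficient X z x ≈ 0#)) where
      private module Z = IsSubmodule isZ

      -- Gaussian elimination from the top: the threshold `t`, from which on all coefficients of `z`
      -- vanish, is lowered one by one. A term of code `t` is either cancelled by a multiple of some
      -- `e i` or has total coefficient 0 already.
      spans : ∀ z → Z z → ∃[ v ] _≋_ X (E v) z
      spans z z∈Z = claim bound z z∈Z (λ y b≤ → contradiction (code<bound y) (ℕₚ.≤⇒≯ b≤))
        where
        claim : ∀ t z → Z z → (∀ y → t ℕ.≤ code y → coefficient X z y ≈ 0#) → ∃[ v ] _≋_ X (E v) z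
        claim zero    z z∈Z z-above = [] , equal (λ y → ≈.sym (z-above y ℕ.z≤n))
        -- The number `t` need not be a code at all, so an `x` of code `t` is looked for among the
        -- terms of `z`; if there is none, the coefficient is 0 anyway.
        claim (suc t) z z∈Z z-above with Any.any? (λ (_ , x) → code x ℕₚ.≟ t) z
        ... | no  absent  = claim t z z∈Z z-above′
          where
          z-above′ : ∀ y → t ℕ.≤ code y → coefficient X z y ≈ 0#
          z-above′ y t≤y with ℕₚ.m≤n⇒m<n∨m≡n t≤y
          ... | inj₁ t<y = z-above y t<y
          ... | inj₂ t≡y = coefficient-absent X z (absent ∘ Any.map (λ x≈y → trans (code-cong x≈y) (sym t≡y)))
        ... | yes present with Any.satisfied present
        ...   | (_ , x) , code-x with eliminate z x z∈Z
        ...     | inj₂ vanishing = claim t z z∈Z z-above′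
          where
          z-above′ : ∀ y → t ℕ.≤ code y → coefficient X z y ≈ 0#
          z-above′ y t≤y with ℕₚ.m≤n⇒m<n∨m≡n t≤y
          ... | inj₁ t<y = z-above y t<y
          ... | inj₂ t≡y = ≈.trans (coefficient-congʳ X z (code-injective (trans (sym t≡y) (sym code-x))))
                                 (vanishing (λ y x<y → z-above y (subst (ℕ._< code y) code-x x<y)))
        ...     | inj₁ (i , i≈x) =
          let v , Ev≈z′ = claim t z′ (Z.+-closed z∈Z (Z.*-closed (- κ) (e∈Z i))) z′-above
          in (κ , i) ∷ v , V.≈ᴹ-trans (V.+ᴹ-congˡ {scale X κ (e i)} {E v} {z′} Ev≈z′) restore
          where
          κ : 𝕂
          κ = coefficient X z x

          z′ : Combination X.Carrier
          z′ = z ++ scale X (- κ) (e i)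

          coefficient-z′ : ∀ y → coefficient X z′ y ≈ coefficient X z y + - κ * coefficient X (e i) y
          coefficient-z′ y = ≈.trans (coefficient-++ X z _ y) (+-congˡ (coefficient-scale X (- κ) (e i) y))

          restore : _≋_ X (scale X κ (e i) ++ z′) z
          at restore y = begin
            coefficient X (scale X κ (e i) ++ z′) y
              ≈⟨ ≈.trans (coefficient-++ X (scale X κ (e i)) z′ y) (+-cong (coefficient-scale X κ (e i) y) (coefficient-z′ y)) ⟩
            κ * ε + (ζ + - κ * ε)      ≈⟨ +-congˡ (+-comm _ _) ⟩
            κ * ε + (- κ * ε + ζ)      ≈⟨ +-assoc _ _ _ ⟨
            (κ * ε + - κ * ε) + ζ      ≈⟨ +-congʳ (distribʳ _ _ _) ⟨
            (κ + - κ) * ε + ζ          ≈⟨ +-congʳ (≈.trans (*-congʳ (-‿inverseʳ κ)) (zeroˡ ε)) ⟩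
            0# + ζ                     ≈⟨ +-identityˡ ζ ⟩
            ζ                          ∎
            where
            ε = coefficient X (e i) y
            ζ = coefficient X z y

          z′-above : ∀ y → t ℕ.≤ code y → coefficient X z′ y ≈ 0#
          z′-above y t≤y with ℕₚ.m≤n⇒m<n∨m≡n t≤y
          ... | inj₁ t<y = ≈.trans (coefficient-z′ y) (≈.trans (+-cong (z-above y t<y)
                             (≈.trans (*-congˡ (above-zero i y (subst (ℕ._< code y) (sym (trans (code-cong i≈x) code-x)) t<y))) (zeroʳ _)))
                             (+-identityˡ 0#))
          ... | inj₂ t≡y = begin
            coefficient X z′ y                                 ≈⟨ coefficient-z′ y ⟩
            coefficient X z y + - κ * coefficient X (e i) y    ≈⟨ +-cong (coefficient-congʳ X z y≈x)
                                                                    (*-congˡ (≈.trans (coefficient-congʳ X (e i) (X.trans y≈x (X.sym i≈x))) (pivot-one i))) ⟩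
            κ + - κ * 1#                                       ≈⟨ +-congˡ (*-identityʳ _) ⟩
            κ + - κ                                            ≈⟨ -‿inverseʳ κ ⟩
            0#                                                 ∎
            where
            y≈x : y X.≈ x
            y≈x = code-injective (trans (sym t≡y) (sym code-x))

-- Inversions and adjacent transpositions.

module ℕSum = MonoidSum ℕₚ.+-0-commutativeMonoid

module Inversions where
  open ℕSum using (sum; sum-cong-≗; sum-permute)

  -- The Iverson bracket, which turns lengths of filtered lists into sums.
  ⟦_⟧ : {A : Set a} → Dec A → ℕ
  ⟦ A? ⟧ = if does A? then 1 else 0

  ⟦⟧-cong : {A : Set a} {B : Set p} (A? : Dec A) (B? : Dec B) → (A → B) → (B → A) → ⟦ A? ⟧ ≡ ⟦ B? ⟧
  ⟦⟧-cong (yes _) (yes _) f g = refl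
  ⟦⟧-cong (no  _) (no  _) f g = refl
  ⟦⟧-cong (yes x) (no ¬y) f g = contradiction (f x) ¬y
  ⟦⟧-cong (no ¬x) (yes y) f g = contradiction (g y) ¬x

  length-filter-tabulate : {A : Set a} {P : Pred A p} (P? : Decidable P) (f : Fin n → A) →
    length (filter P? (List.tabulate f)) ≡ sum (λ i → ⟦ P? (f i) ⟧)
  length-filter-tabulate {n = zero}  P? f = refl
  length-filter-tabulate {n = suc n} P? f with does (P? (f zero))
  ... | true  = cong suc (length-filter-tabulate P? (f ∘ suc))
  ... | false = length-filter-tabulate P? (f ∘ suc)

  length-filter-product : {A : Set a} {B : Set r} {P : Pred (A × B) p} (P? : Decidable P) (f : Fin m → A) (g : Fin n → B) →
    length (filter P? (cartesianProduct (List.tabulate f) (List.tabulate g))) ≡ sum (λ i → sum (λ j → ⟦ P? (f i , g j) ⟧))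
  length-filter-product {m = zero}  P? f g = refl
  length-filter-product {m = suc m} P? f g = begin
    length (filter P? (map (f zero ,_) (List.tabulate g) ++ rest))
      ≡⟨ cong length (Listₚ.filter-++ P? (map (f zero ,_) (List.tabulate g)) rest) ⟩
    length (filter P? (map (f zero ,_) (List.tabulate g)) ++ filter P? rest)
      ≡⟨ Listₚ.length-++ (filter P? (map (f zero ,_) (List.tabulate g))) ⟩
    length (filter P? (map (f zero ,_) (List.tabulate g))) ℕ.+ length (filter P? rest)
      ≡⟨ cong₂ ℕ._+_ (trans (cong (length ∘ filter P?) (Listₚ.map-tabulate g (f zero ,_))) (length-filter-tabulate P? (λ j → f zero , g j)))
                     (length-filter-product P? (f ∘ suc) g) ⟩
    sum (λ i → sum (λ j → ⟦ P? (f i , g j) ⟧)) ∎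
    where
    open ≡-Reasoning
    rest = cartesianProduct (List.tabulate (f ∘ suc)) (List.tabulate g)

  inversion? : (σ : Permutation′ n) (i j : Fin n) → Dec (i Fin.< j × σ ⟨$⟩ʳ j Fin.< σ ⟨$⟩ʳ i)
  inversion? σ i j = i Finₚ.<? j ×-dec σ ⟨$⟩ʳ j Finₚ.<? σ ⟨$⟩ʳ i

  inversions-sum : (σ : Permutation′ n) → inversions σ ≡ sum (λ i → sum (λ j → ⟦ inversion? σ i j ⟧))
  inversions-sum σ = length-filter-product (λ (i , j) → inversion? σ i j) id id

  punchIn-< : ∀ (i : Fin (suc n)) {a b} → a Fin.< b → punchIn i a Fin.< punchIn i b
  punchIn-< i {a} {b} a<b = Finₚ.≤∧≢⇒< (Finₚ.punchIn-mono-≤ i a b (ℕₚ.<⇒≤ a<b))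
    (Finₚ.<⇒≢ a<b ∘ Finₚ.punchIn-injective i a b)

  punchIn-<⁻ : ∀ (i : Fin (suc n)) {a b} → punchIn i a Fin.< punchIn i b → a Fin.< b
  punchIn-<⁻ i {a} {b} lt = Finₚ.≤∧≢⇒< (Finₚ.punchIn-cancel-≤ i a b (ℕₚ.<⇒≤ lt))
    (λ a≡b → Finₚ.<⇒≢ lt (cong (punchIn i) a≡b))

  -- `punchIn i` enumerates all values except `i`, so each of the `toℕ i` values below `i` is met
  -- once.
  count-below : (i : Fin (suc n)) → sum (λ c → ⟦ punchIn i c Finₚ.<? i ⟧) ≡ toℕ i
  count-below {n}     zero    = sum-zero n
    where
    sum-zero : ∀ n → sum {n} (λ c → 0) ≡ 0
    sum-zero n = ℕSum.sum-replicate-zero n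
  count-below {suc n} (suc i) = cong suc (trans
    (sum-cong-≗ (λ c → ⟦⟧-cong (suc (punchIn i c) Finₚ.<? suc i) (punchIn i c Finₚ.<? i) ℕₚ.≤-pred s≤s))
    (count-below i))

  -- The inserted permutation sends 0 to `i`. Its inversions at position 0 come from the values
  -- below `i`; the others are the inversions of `π`, because `punchIn i` preserves the order.
  inversions-insert : (i : Fin (suc n)) (π : Permutation′ n) → inversions (insert zero i π) ≡ toℕ i ℕ.+ inversions π
  inversions-insert i π = trans (inversions-sum (insert zero i π)) (cong₂ ℕ._+_
    (trans (sum-cong-≗ (λ b → ⟦⟧-cong (inversion? (insert zero i π) zero (suc b)) (punchIn i (π ⟨$⟩ʳ b) Finₚ.<? i) proj₂ (s≤s z≤n ,_)))
      -- Summing over the positions of `π` is the same as summing over its values `c`.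
      (trans (sym (sum-permute (λ c → ⟦ punchIn i c Finₚ.<? i ⟧) π)) (count-below i)))
    (trans (sum-cong-≗ (λ a → sum-cong-≗ (λ b →
        ⟦⟧-cong (inversion? (insert zero i π) (suc a) (suc b)) (inversion? π a b)
          (λ (p , q) → ℕₚ.≤-pred p , punchIn-<⁻ i q) (λ (p , q) → s≤s p , punchIn-< i q))))
      (sym (inversions-sum π))))

-- As a relation, so that no case distinction on values in Fin has to compute: b is the image of a under the
-- transposition of p and p + 1.
data Swapped (p a b : ℕ) : Set where
  up   : a ≡ p → b ≡ suc p → Swapped p a b
  down : a ≡ suc p → b ≡ p → Swapped p a b
  same : a ≢ p → a ≢ suc p → a ≡ b → Swapped p a b

swapped-sym : ∀ {p a b} → Swapped p a b → Swapped p b a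
swapped-sym (up a≡ b≡)         = down b≡ a≡
swapped-sym (down a≡ b≡)       = up b≡ a≡
swapped-sym (same a≢ a≢′ refl) = same a≢ a≢′ refl

-- An initial segment of length `t` is moved only if it separates `p` from `p + 1`, that is, if `t`
-- is `p + 1`.
swapped-< : ∀ {p a b t} → t ≢ suc p → Swapped p a b → a ℕ.< t → b ℕ.< t
swapped-< t≢ (up refl refl)   a<t = ℕₚ.≤∧≢⇒< a<t (t≢ ∘ sym)
swapped-< t≢ (down refl refl) a<t = ℕₚ.<⇒≤ a<t
swapped-< t≢ (same _ _ refl)  a<t = a<t

-- Alternating sums over the symmetric group.

module SignedSum {c ℓ : Level} (K : CommutativeRing c ℓ) where
  open CommutativeRing K hiding (zero; refl; sym; trans) renaming (Carrier to 𝕂)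
  private module ≈ = CommutativeRing K
  open import Algebra.Properties.Semiring.Exp semiring using (_^_; ^-homo-*)
  open import Algebra.Properties.Ring ring using (-‿distribˡ-*; -1*x≈-x)
  open MonoidSum +-commutativeMonoid using (sum; sum-cong-≋; sum-replicate-zero)
  open Inversions using (inversions-insert)
  open ≈-Reasoning setoid

  total : {A : Set a} → (A → 𝕂) → List A → 𝕂
  total h []       = 0#
  total h (x ∷ xs) = h x + total h xs

  total-++ : {A : Set a} (h : A → 𝕂) → ∀ xs ys → total h (xs ++ ys) ≈ total h xs + total h ys
  total-++ h []       ys = ≈.sym (+-identityˡ _)
  total-++ h (x ∷ xs) ys = ≈.trans (+-congˡ (total-++ h xs ys)) (≈.sym (+-assoc _ _ _))

  total-map : {A : Set a} {B : Set r} (h : B → 𝕂) (f : A → B) → ∀ xs → total h (map f xs) ≈ total (h ∘ f) xs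
  total-map h f []       = ≈.refl
  total-map h f (x ∷ xs) = +-congˡ (total-map h f xs)

  total-cong : {A : Set a} {g h : A → 𝕂} → (∀ x → g x ≈ h x) → ∀ xs → total g xs ≈ total h xs
  total-cong g≈h []       = ≈.refl
  total-cong g≈h (x ∷ xs) = +-cong (g≈h x) (total-cong g≈h xs)

  total-* : {A : Set a} (k : 𝕂) (h : A → 𝕂) → ∀ xs → total (λ x → k * h x) xs ≈ k * total h xs
  total-* k h []       = ≈.sym (zeroʳ k)
  total-* k h (x ∷ xs) = ≈.trans (+-congˡ (total-* k h xs)) (≈.sym (distribˡ _ _ _))

  total-zero : {A : Set a} {h : A → 𝕂} → (∀ x → h x ≈ 0#) → ∀ xs → total h xs ≈ 0#
  total-zero h≈0 []       = ≈.refl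
  total-zero h≈0 (x ∷ xs) = ≈.trans (+-cong (h≈0 x) (total-zero h≈0 xs)) (+-identityˡ 0#)

  total-filter : {A : Set a} {P : Pred A p} (P? : Decidable P) (h : A → 𝕂) → ∀ xs →
    total h (filter P? xs) ≈ total (λ x → if does (P? x) then h x else 0#) xs
  total-filter P? h []       = ≈.refl
  total-filter P? h (x ∷ xs) with does (P? x)
  ... | true  = +-congˡ (total-filter P? h xs)
  ... | false = ≈.trans (total-filter P? h xs) (≈.sym (+-identityˡ _))

  total-product : {A : Set a} {B : Set r} {C : Set r′} (h : C → 𝕂) (f : A → B → C) (g : Fin n → A) → ∀ ys →
    total h (cartesianProductWith f (List.tabulate g) ys) ≈ sum (λ i → total (h ∘ f (g i)) ys)
  total-product {n = zero}  h f g ys = ≈.refl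
  total-product {n = suc n} h f g ys = ≈.trans (total-++ h (map (f (g zero)) ys) _)
    (+-cong (total-map h (f (g zero)) ys) (total-product h f (g ∘ suc) ys))

  sgn : Permutation′ n → 𝕂
  sgn σ = (- 1#) ^ inversions σ

  signedSum : ∀ n → (Permutation′ n → 𝕂) → 𝕂
  signedSum n G = total (λ σ → sgn σ * G σ) (permutations n)

  -- Laplace expansion by the image of 0, with the sign read off from `inversions-insert`.
  signedSum-suc : ∀ n (G : Permutation′ (suc n) → 𝕂) →
    signedSum (suc n) G ≈ sum (λ i → (- 1#) ^ toℕ i * signedSum n (G ∘ insert zero i))
  signedSum-suc n G = ≈.trans (total-product (λ σ → sgn σ * G σ) (insert zero) id (permutations n))
    (sum-cong-≋ (λ i → ≈.trans (total-cong (λ π → ≈.trans (*-congʳ (sgn-insert i π)) (*-assoc _ _ _)) (permutations n))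
                              (total-* ((- 1#) ^ toℕ i) (λ π → sgn π * G (insert zero i π)) (permutations n))))
    where
    sgn-insert : ∀ i π → sgn (insert zero i π) ≈ (- 1#) ^ toℕ i * sgn π
    sgn-insert i π = ≈.trans (reflexive (cong ((- 1#) ^_) (inversions-insert i π))) (^-homo-* (- 1#) (toℕ i) (inversions π))

  sum-zero : ∀ {n} {f : Fin n → 𝕂} → (∀ i → f i ≈ 0#) → sum f ≈ 0#
  sum-zero {n} f≈0 = ≈.trans (sum-cong-≋ f≈0) (sum-replicate-zero n)

  sum-cancelling : ∀ {n} p (f : Fin n → 𝕂) → (∀ i → toℕ i ≢ p → toℕ i ≢ suc p → f i ≈ 0#) →
    (∀ i j → toℕ i ≡ p → toℕ j ≡ suc p → f i + f j ≈ 0#) → suc p ℕ.< n → sum f ≈ 0#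
  sum-cancelling zero    f outside inside (s≤s (s≤s _)) = begin
    f zero + (f (suc zero) + sum (λ i → f (suc (suc i))))  ≈⟨ +-assoc _ _ _ ⟨
    (f zero + f (suc zero)) + sum (λ i → f (suc (suc i)))  ≈⟨ +-cong (inside zero (suc zero) refl refl) (sum-zero (λ i → outside (suc (suc i)) (λ ()) (λ ()))) ⟩
    0# + 0#                                                ≈⟨ +-identityˡ 0# ⟩
    0#                                                     ∎
  sum-cancelling (suc p) f outside inside (s≤s p<n) = ≈.trans (+-cong
    (outside zero (λ ()) (λ ()))
    (sum-cancelling p (f ∘ suc) (λ i i≢p i≢1+p → outside (suc i) (i≢p ∘ ℕₚ.suc-injective) (i≢1+p ∘ ℕₚ.suc-injective))
      (λ i j i≡ j≡ → inside (suc i) (suc j) (cong suc i≡) (cong suc j≡)) p<n)) (+-identityˡ 0#)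

  -- Induction through the expansion, instead of locating the identity in the list: a permutation
  -- that fixes everything occurs only in the term where 0 goes to 0, and the sign factor of that
  -- term is 1.
  signedSum-id : ∀ n (G : Permutation′ n → 𝕂) {k} → (∀ σ → (∀ b → σ ⟨$⟩ʳ b ≡ b) → G σ ≈ k) →
    (∀ σ → ¬ (∀ b → σ ⟨$⟩ʳ b ≡ b) → G σ ≈ 0#) → signedSum n G ≈ k
  signedSum-id zero    G {k} G-id G-other = ≈.trans (+-identityʳ _) (≈.trans (*-identityˡ _) (G-id _ (λ ())))
  signedSum-id (suc n) G {k} G-id G-other = begin
    signedSum (suc n) G                                             ≈⟨ signedSum-suc n G ⟩
    1# * signedSum n (G ∘ insert zero zero) + sum (λ i → (- 1#) ^ toℕ (suc i) * signedSum n (G ∘ insert zero (suc i)))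
      ≈⟨ +-cong (≈.trans (*-identityˡ _) (signedSum-id n (G ∘ insert zero zero) fixed moved)) (sum-zero (λ i →
           ≈.trans (*-congˡ (total-zero (λ π → ≈.trans (*-congˡ (G-other (insert zero (suc i) π) (λ h → contradiction (h zero) λ ()))) (zeroʳ _))
             (permutations n))) (zeroʳ _))) ⟩
    k + 0#                                                          ≈⟨ +-identityʳ k ⟩
    k                                                               ∎
    where
    fixed : ∀ π → (∀ b → π ⟨$⟩ʳ b ≡ b) → G (insert zero zero π) ≈ k
    fixed π h = G-id (insert zero zero π) λ { zero → refl ; (suc b) → cong suc (h b) }

    moved : ∀ π → ¬ (∀ b → π ⟨$⟩ʳ b ≡ b) → G (insert zero zero π) ≈ 0#
    moved π ¬h = G-other (insert zero zero π) (λ h → ¬h (λ b → Finₚ.suc-injective (h (suc b))))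

  -- Invariance under composition with the transposition of the values `p` and `p + 1`.
  Symmetric : ∀ {n} → ℕ → (Permutation′ n → 𝕂) → Set ℓ
  Symmetric p G = ∀ σ τ → (∀ b → Swapped p (toℕ (σ ⟨$⟩ʳ b)) (toℕ (τ ⟨$⟩ʳ b))) → G σ ≈ G τ

  toℕ-punchIn-< : ∀ (i : Fin (suc n)) c → toℕ c ℕ.< toℕ i → toℕ (punchIn i c) ≡ toℕ c
  toℕ-punchIn-< (suc i) zero    _         = refl
  toℕ-punchIn-< (suc i) (suc c) (s≤s c<i) = cong suc (toℕ-punchIn-< i c c<i)

  toℕ-punchIn-≥ : ∀ (i : Fin (suc n)) c → toℕ i ℕ.≤ toℕ c → toℕ (punchIn i c) ≡ suc (toℕ c)
  toℕ-punchIn-≥ zero    c       _         = refl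
  toℕ-punchIn-≥ (suc i) (suc c) (s≤s i≤c) = cong suc (toℕ-punchIn-≥ i c i≤c)

  swapped-above : ∀ (i : Fin (suc n)) p c d → suc p ℕ.< toℕ i → Swapped p (toℕ c) (toℕ d) → Swapped p (toℕ (punchIn i c)) (toℕ (punchIn i d))
  swapped-above i p c d p<i (up c≡ d≡)   = up (trans (toℕ-punchIn-< i c (subst (ℕ._< toℕ i) (sym c≡) (ℕₚ.<⇒≤ p<i))) c≡)
                                              (trans (toℕ-punchIn-< i d (subst (ℕ._< toℕ i) (sym d≡) p<i)) d≡)
  swapped-above i p c d p<i (down c≡ d≡) = down (trans (toℕ-punchIn-< i c (subst (ℕ._< toℕ i) (sym c≡) p<i)) c≡)
                                              (trans (toℕ-punchIn-< i d (subst (ℕ._< toℕ i) (sym d≡) (ℕₚ.<⇒≤ p<i))) d≡)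
  swapped-above i p c d p<i (same c≢p c≢1+p c≡d) with Finₚ.toℕ-injective c≡d | toℕ c ℕₚ.<? toℕ i
  ... | refl | yes c<i = same (c≢p ∘ trans (sym e)) (c≢1+p ∘ trans (sym e)) refl
    where e = toℕ-punchIn-< i c c<i
  ... | refl | no  c≮i = same (far (ℕₚ.<⇒≤ p<i)) (far p<i) refl
    where
    far : ∀ {q} → q ℕ.< toℕ i → toℕ (punchIn i c) ≢ q
    far q<i e = ℕₚ.<⇒≱ q<i (ℕₚ.≤-trans (ℕₚ.≮⇒≥ c≮i)
      (ℕₚ.≤-trans (ℕₚ.n≤1+n _) (ℕₚ.≤-reflexive (trans (sym (toℕ-punchIn-≥ i c (ℕₚ.≮⇒≥ c≮i))) e))))

  swapped-below : ∀ (i : Fin (suc n)) p c d → toℕ i ℕ.≤ p → Swapped p (toℕ c) (toℕ d) → Swapped (suc p) (toℕ (punchIn i c)) (toℕ (punchIn i d))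
  swapped-below i p c d i≤p (up c≡ d≡)   = up (trans (toℕ-punchIn-≥ i c (subst (toℕ i ℕ.≤_) (sym c≡) i≤p)) (cong suc c≡))
                                              (trans (toℕ-punchIn-≥ i d (subst (toℕ i ℕ.≤_) (sym d≡) (ℕₚ.m≤n⇒m≤1+n i≤p))) (cong suc d≡))
  swapped-below i p c d i≤p (down c≡ d≡) = down (trans (toℕ-punchIn-≥ i c (subst (toℕ i ℕ.≤_) (sym c≡) (ℕₚ.m≤n⇒m≤1+n i≤p))) (cong suc c≡))
                                              (trans (toℕ-punchIn-≥ i d (subst (toℕ i ℕ.≤_) (sym d≡) i≤p)) (cong suc d≡))
  swapped-below i p c d i≤p (same c≢p c≢1+p c≡d) with Finₚ.toℕ-injective c≡d | toℕ c ℕₚ.<? toℕ i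
  ... | refl | yes c<i = same (far ℕₚ.≤-refl) (far (ℕₚ.n≤1+n _)) refl
    where
    far : ∀ {q} → suc p ℕ.≤ q → toℕ (punchIn i c) ≢ q
    far p<q e = ℕₚ.<⇒≱ p<q (ℕₚ.≤-trans (ℕₚ.≤-reflexive (sym e)) (ℕₚ.≤-trans (ℕₚ.≤-reflexive (toℕ-punchIn-< i c c<i)) (ℕₚ.≤-trans (ℕₚ.<⇒≤ c<i) i≤p)))
  ... | refl | no  c≮i = same (c≢p ∘ ℕₚ.suc-injective ∘ trans (sym e)) (c≢1+p ∘ ℕₚ.suc-injective ∘ trans (sym e)) refl
    where e = toℕ-punchIn-≥ i c (ℕₚ.≮⇒≥ c≮i)

  -- Leaving out `p` and leaving out `p + 1` give embeddings that agree except at `c = p`, which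
  -- goes to `p + 1` and to `p` respectively. This matches the two terms of the expansion that have
  -- to cancel.
  swapped-between : ∀ p (i j : Fin (suc n)) → toℕ i ≡ p → toℕ j ≡ suc p → ∀ c → Swapped p (toℕ (punchIn i c)) (toℕ (punchIn j c))
  swapped-between p i j i≡ j≡ c with ℕₚ.<-cmp (toℕ c) p
  ... | tri< c<p _ _ = same (ℕₚ.<⇒≢ (subst (ℕ._< p) (sym eᵢ) c<p))
                                    (ℕₚ.<⇒≢ (subst (ℕ._< suc p) (sym eᵢ) (ℕₚ.m≤n⇒m≤1+n c<p))) (trans eᵢ (sym eⱼ))
    where
    eᵢ = toℕ-punchIn-< i c (subst (toℕ c ℕ.<_) (sym i≡) c<p)
    eⱼ = toℕ-punchIn-< j c (subst (toℕ c ℕ.<_) (sym j≡) (ℕₚ.m≤n⇒m≤1+n c<p))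
  ... | tri≈ _ c≡p _ = down (trans (toℕ-punchIn-≥ i c (ℕₚ.≤-reflexive (trans i≡ (sym c≡p)))) (cong suc c≡p))
                                    (trans (toℕ-punchIn-< j c (ℕₚ.≤-reflexive (trans (cong suc c≡p) (sym j≡)))) c≡p)
  ... | tri> _ _ p<c = same (ℕₚ.>⇒≢ (subst (p ℕ.<_) (sym eᵢ) (ℕₚ.m≤n⇒m≤1+n p<c)))
                                    (ℕₚ.>⇒≢ (subst (suc p ℕ.<_) (sym eᵢ) (s≤s p<c))) (trans eᵢ (sym eⱼ))
    where
    eᵢ = toℕ-punchIn-≥ i c (subst (ℕ._≤ toℕ c) (sym i≡) (ℕₚ.<⇒≤ p<c))
    eⱼ = toℕ-punchIn-≥ j c (subst (ℕ._≤ toℕ c) (sym j≡) p<c)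

  -- Expand by the image `i` of 0. If `i` is neither `p` nor `p + 1`, the smaller sum is again over
  -- a symmetric function and vanishes by induction; the terms for `p` and `p + 1` have equal
  -- smaller sums and opposite signs. Cancelling in pairs works in characteristic 2 as well.
  signedSum-symmetric : ∀ n p (G : Permutation′ n → 𝕂) → suc p ℕ.< n → Symmetric p G → signedSum n G ≈ 0#
  signedSum-symmetric (suc n) p G p<n G-sym = ≈.trans (signedSum-suc n G) (sum-cancelling p _ outside inside p<n)
    where
    outside : ∀ i → toℕ i ≢ p → toℕ i ≢ suc p → (- 1#) ^ toℕ i * signedSum n (G ∘ insert zero i) ≈ 0#
    outside i i≢p i≢1+p = ≈.trans (*-congˡ (go p p<n G-sym i≢p i≢1+p)) (zeroʳ _)
      where
      go : ∀ p → suc p ℕ.< suc n → Symmetric p G → toℕ i ≢ p → toℕ i ≢ suc p → signedSum n (G ∘ insert zero i) ≈ 0#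
      go p p<n G-sym i≢p i≢1+p with suc p ℕₚ.<? toℕ i
      ... | yes p<i = signedSum-symmetric n p _ (ℕₚ.≤-trans p<i (ℕₚ.≤-pred (Finₚ.toℕ<n i))) λ σ τ h →
        G-sym _ _ λ { zero → same i≢p i≢1+p refl ; (suc b) → swapped-above i p _ _ p<i (h b) }
      go zero    p<n G-sym i≢p i≢1+p | no p≮i = contradiction (ℕₚ.≤∧≢⇒< (ℕₚ.≤-pred (ℕₚ.≤∧≢⇒< (ℕₚ.≮⇒≥ p≮i) i≢1+p)) i≢p) λ ()
      -- Here `i` lies below both swapped values, so after its removal they sit one lower, at the
      -- predecessor that is now called `p`.
      go (suc p) p<n G-sym i≢p i≢1+p | no p≮i = signedSum-symmetric n p _ (ℕₚ.≤-pred p<n) λ σ τ h →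
        G-sym _ _ λ { zero → same i≢p i≢1+p refl ; (suc b) → swapped-below i p _ _
          (ℕₚ.≤-pred (ℕₚ.≤∧≢⇒< (ℕₚ.≤-pred (ℕₚ.≤∧≢⇒< (ℕₚ.≮⇒≥ p≮i) i≢1+p)) i≢p)) (h b) }

    inside : ∀ i j → toℕ i ≡ p → toℕ j ≡ suc p →
      (- 1#) ^ toℕ i * signedSum n (G ∘ insert zero i) + (- 1#) ^ toℕ j * signedSum n (G ∘ insert zero j) ≈ 0#
    inside i j i≡ j≡ = begin
      (- 1#) ^ toℕ i * T i + (- 1#) ^ toℕ j * T j         ≈⟨ +-cong (*-congʳ (reflexive (cong ((- 1#) ^_) i≡))) (*-cong (reflexive (cong ((- 1#) ^_) j≡)) (≈.sym Tᵢ≈Tⱼ)) ⟩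
      (- 1#) ^ p * T i + (- 1# * (- 1#) ^ p) * T i        ≈⟨ distribʳ _ _ _ ⟨
      ((- 1#) ^ p + - 1# * (- 1#) ^ p) * T i              ≈⟨ *-congʳ (≈.trans (+-congˡ (-1*x≈-x _)) (-‿inverseʳ _)) ⟩
      0# * T i                                            ≈⟨ zeroˡ _ ⟩
      0#                                                  ∎
      where
      T : Fin (suc n) → 𝕂
      T i = signedSum n (G ∘ insert zero i)

      Tᵢ≈Tⱼ : T i ≈ T j
      Tᵢ≈Tⱼ = total-cong (λ π → *-congˡ (G-sym _ _ λ { zero → up i≡ j≡ ; (suc b) → swapped-between p i j i≡ j≡ (π ⟨$⟩ʳ b) })) (permutations n)

-- Ribbons as lattice paths.

data Step (U : Pred ℕ p) (t : ℕ) (b b′ : ℕ × ℕ) : Set p where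
  up    : U t   → proj₁ b′ ≡ suc (proj₁ b) → proj₂ b′ ≡ proj₂ b       → Step U t b b′
  right : ¬ U t → proj₁ b′ ≡ proj₁ b       → proj₂ b′ ≡ suc (proj₂ b) → Step U t b b′

-- `t` is the position of the first box of the list. `Step` is indexed by the position of the later
-- box, so `U` collects the positions at which a new row starts.
Path : Pred ℕ p → ℕ → Diagram → Set p
Path U t []           = ⊤
Path U t (b ∷ [])     = ⊤
Path U t (b ∷ b′ ∷ D) = Step U (suc t) b b′ × Path U (suc t) (b′ ∷ D)

-- The row has `r + 1` boxes, at positions `t` to `t + r`, so `D` starts at `t + r + 1`. The
-- hypothesis `join` is the step from the row into `D`, vacuous when `D` is empty.
row-path : ∀ {U : Pred ℕ p} t r (f : ℕ → ℕ × ℕ) D →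
  (∀ j → proj₁ (f (suc j)) ≡ proj₁ (f j) × proj₂ (f (suc j)) ≡ suc (proj₂ (f j))) →
  (∀ j → t ℕ.< j → j ℕ.≤ t ℕ.+ r → ¬ U j) →
  (∀ {b D′} → D ≡ b ∷ D′ → Step U (suc (t ℕ.+ r)) (f r) b) →
  Path U (suc (t ℕ.+ r)) D → Path U t (applyUpTo f (suc r) ++ D)
row-path t zero    f []      f-right ¬U join path = tt
row-path {U = U} t zero f (b ∷ D) f-right ¬U join path =
  subst (λ t′ → Step U (suc t′) (f 0) b) (ℕₚ.+-identityʳ t) (join refl) ,
  subst (λ t′ → Path U (suc t′) (b ∷ D)) (ℕₚ.+-identityʳ t) path
row-path {U = U} t (suc r) f D f-right ¬U join path =
  right (¬U (suc t) ℕₚ.≤-refl (ℕₚ.≤-trans (s≤s (ℕₚ.m≤m+n t r)) (ℕₚ.≤-reflexive (sym (ℕₚ.+-suc t r))))) (proj₁ (f-right 0)) (proj₂ (f-right 0)) ,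
  row-path (suc t) r (f ∘ suc) D (f-right ∘ suc)
    (λ j t<j j≤ → ¬U j (ℕₚ.<-trans ℕₚ.≤-refl t<j) (ℕₚ.≤-trans j≤ (ℕₚ.≤-reflexive (sym (ℕₚ.+-suc t r)))))
    (λ {b} eq → subst (λ t′ → Step U (suc t′) (f (suc r)) b) (ℕₚ.+-suc t r) (join eq))
    (subst (λ t′ → Path U (suc t′) D) (ℕₚ.+-suc t r) path)

rowBox : ℕ → ℕ → ℕ → ℕ × ℕ
rowBox r₀ c₀ j = r₀ , c₀ ℕ.+ j

row-boxes : (r₀ c₀ r : ℕ) → map (rowBox r₀ c₀) (upTo r) ≡ applyUpTo (rowBox r₀ c₀) r
row-boxes r₀ c₀ = Listₚ.map-upTo (rowBox r₀ c₀)

gaps-head : ∀ {s₀ n r rs} (S : Vec ℕ k) → VecAll.All (s₀ ℕ.<_) S → s₀ ℕ.< n → gaps s₀ n S ≡ r ∷ rs → 0 ℕ.< r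
gaps-head []      _                  s₀<n refl = ℕₚ.m<n⇒0<n∸m s₀<n
gaps-head (s ∷ S) (s₀<s VecAll.∷ _) s₀<n refl = ℕₚ.m<n⇒0<n∸m s₀<s

ribbon-head : ∀ r₀ c₀ rs {b D} → (∀ {r rs′} → rs ≡ r ∷ rs′ → 0 ℕ.< r) → ribbonFrom r₀ c₀ rs ≡ b ∷ D → b ≡ (r₀ , c₀)
ribbon-head r₀ c₀ (zero  ∷ rs) pos eq   = contradiction (pos refl) λ ()
ribbon-head r₀ c₀ (suc r ∷ rs) pos refl = cong (r₀ ,_) (ℕₚ.+-identityʳ c₀)

-- `U` stays fixed while the recursion passes to the tail of `S`; therefore `U` is required to lie
-- in `S` only strictly between `s₀` and `n`.
ribbon-path : ∀ {U : Pred ℕ p} r₀ c₀ s₀ n (S : Vec ℕ k) → AllPairs ℕ._<_ S → VecAll.All (s₀ ℕ.<_) S → VecAll.All (ℕ._< n) S →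
  (∀ {t} → s₀ ℕ.< t → t ℕ.< n → U t → t VecM.∈ S) → (∀ {t} → t VecM.∈ S → U t) →
  Path U s₀ (ribbonFrom r₀ c₀ (gaps s₀ n S))
ribbon-path {U = U} r₀ c₀ s₀ n [] _ _ _ U⇒S S⇒U with n ∸ s₀ in eq
... | zero  = tt
... | suc r = subst (λ row → Path U s₀ (row ++ [])) (sym (row-boxes r₀ c₀ (suc r)))
  (row-path s₀ r (rowBox r₀ c₀) [] (λ j → refl , ℕₚ.+-suc c₀ j)
    (λ j s₀<j j≤ Uj → contradiction (U⇒S s₀<j (ℕₚ.≤-trans (s≤s j≤) (ℕₚ.≤-reflexive
      (trans (sym (ℕₚ.+-suc s₀ r)) (trans (cong (s₀ ℕ.+_) (sym eq)) (ℕₚ.m+[n∸m]≡n {s₀} (ℕₚ.<⇒≤ (ℕₚ.m∸n≢0⇒n<m λ z → contradiction (trans (sym z) eq) λ ()))))))) Uj) λ ())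
    (λ ()) tt)
ribbon-path {U = U} r₀ c₀ s₀ n (s ∷ S) (s<S ∷ inc) (s₀<s VecAll.∷ _) (s<n VecAll.∷ S<n) U⇒S S⇒U
  with s ∸ s₀ in eq
... | zero  = contradiction (ℕₚ.m<n⇒0<n∸m s₀<s) (ℕₚ.≤⇒≯ (ℕₚ.≤-reflexive eq))
... | suc r = subst (λ row → Path U s₀ (row ++ ribbonFrom (suc r₀) (c₀ ℕ.+ r) (gaps s n S))) (sym (row-boxes r₀ c₀ (suc r)))
  (row-path s₀ r (rowBox r₀ c₀) _ (λ j → refl , ℕₚ.+-suc c₀ j)
    (λ j s₀<j j≤ Uj → not-earlier (subst (j ℕ.<_) s≡ (s≤s j≤)) (U⇒S s₀<j (ℕₚ.<-trans (subst (j ℕ.<_) s≡ (s≤s j≤)) s<n) Uj))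
    -- The next row is nonempty, so its first box is the corner directly above the last box of this
    -- row.
    (λ eq′ → let b≡ = ribbon-head (suc r₀) (c₀ ℕ.+ r) (gaps s n S) (gaps-head S s<S s<n) eq′ in
      up (subst U (sym s≡) (S⇒U (VecAny.here refl))) (cong proj₁ b≡) (cong proj₂ b≡))
    (subst (λ t → Path U t (ribbonFrom (suc r₀) (c₀ ℕ.+ r) (gaps s n S))) (sym s≡)
      (ribbon-path (suc r₀) (c₀ ℕ.+ r) s n S inc s<S S<n
        (λ s<t t<n Ut → later s<t (U⇒S (ℕₚ.<-trans s₀<s s<t) t<n Ut)) (S⇒U ∘ VecAny.there))))
  where
  s≡ : suc (s₀ ℕ.+ r) ≡ s
  s≡ = trans (sym (ℕₚ.+-suc s₀ r)) (trans (cong (s₀ ℕ.+_) (sym eq)) (ℕₚ.m+[n∸m]≡n (ℕₚ.<⇒≤ s₀<s)))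

  not-earlier : ∀ {j} → j ℕ.< s → ¬ j VecM.∈ (s ∷ S)
  not-earlier j<s (VecAny.here refl) = ℕₚ.<-irrefl refl j<s
  not-earlier j<s (VecAny.there j∈)  = ℕₚ.<-asym j<s (VecAll.lookup s<S j∈)

  later : ∀ {t} → s ℕ.< t → t VecM.∈ (s ∷ S) → t VecM.∈ S
  later s<t (VecAny.here refl) = contradiction s<t (ℕₚ.<-irrefl refl)
  later s<t (VecAny.there t∈)  = t∈

-- The row lengths are successive differences and telescope.
ribbon-length : ∀ r₀ c₀ s₀ n (S : Vec ℕ k) → AllPairs ℕ._<_ S → VecAll.All (s₀ ℕ.≤_) S → VecAll.All (ℕ._< n) S → s₀ ℕ.≤ n →
  s₀ ℕ.+ length (ribbonFrom r₀ c₀ (gaps s₀ n S)) ≡ n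
ribbon-length r₀ c₀ s₀ n [] _ _ _ s₀≤n = trans (cong (s₀ ℕ.+_) (trans (Listₚ.length-++ (map (rowBox r₀ c₀) (upTo (n ∸ s₀))))
  (trans (ℕₚ.+-identityʳ _) (trans (Listₚ.length-map (rowBox r₀ c₀) (upTo (n ∸ s₀))) (Listₚ.length-upTo (n ∸ s₀)))))) (ℕₚ.m+[n∸m]≡n s₀≤n)
ribbon-length r₀ c₀ s₀ n (s ∷ S) (s<S ∷ inc) (s₀≤s VecAll.∷ _) (s<n VecAll.∷ S<n) s₀≤n = begin
  s₀ ℕ.+ length (map (rowBox r₀ c₀) (upTo (s ∸ s₀)) ++ rest)    ≡⟨ cong (s₀ ℕ.+_) (trans (Listₚ.length-++ (map (rowBox r₀ c₀) (upTo (s ∸ s₀))))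
                                                            (cong (ℕ._+ length rest) (trans (Listₚ.length-map (rowBox r₀ c₀) (upTo (s ∸ s₀))) (Listₚ.length-upTo (s ∸ s₀))))) ⟩
  s₀ ℕ.+ ((s ∸ s₀) ℕ.+ length rest)                  ≡⟨ ℕₚ.+-assoc s₀ (s ∸ s₀) (length rest) ⟨
  s₀ ℕ.+ (s ∸ s₀) ℕ.+ length rest                    ≡⟨ cong (ℕ._+ length rest) (ℕₚ.m+[n∸m]≡n s₀≤s) ⟩
  s ℕ.+ length rest                                  ≡⟨ ribbon-length (suc r₀) (c₀ ℕ.+ (s ∸ s₀ ∸ 1)) s n S inc (VecAll.map ℕₚ.<⇒≤ s<S) S<n (ℕₚ.<⇒≤ s<n) ⟩
  n                                                  ∎
  where
  open ≡-Reasoning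
  rest = ribbonFrom (suc r₀) (c₀ ℕ.+ (s ∸ s₀ ∸ 1)) (gaps s n S)

path-step : ∀ {U : Pred ℕ p} t D → Path U t D → ∀ b b′ → toℕ b′ ≡ suc (toℕ b) → Step U (t ℕ.+ toℕ b′) (List.lookup D b) (List.lookup D b′)
path-step {U = U} t (x ∷ y ∷ D) (st , path) zero    (suc zero) refl = subst (λ t′ → Step U t′ x y) (ℕₚ.+-comm 1 t) st
path-step {U = U} t (x ∷ y ∷ D) (st , path) (suc b) (suc b′)  eq   =
  subst (λ t′ → Step U t′ (List.lookup (y ∷ D) b) (List.lookup (y ∷ D) b′)) (sym (ℕₚ.+-suc t (toℕ b′))) (path-step (suc t) (y ∷ D) path b b′ (ℕₚ.suc-injective eq))

-- Each step, up or right, raises row plus column by 1, so the antidiagonal of a box determines its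
-- position.
path-position : ∀ {U : Pred ℕ p} t x D → Path U t (x ∷ D) → ∀ b →
  proj₁ (List.lookup (x ∷ D) b) ℕ.+ proj₂ (List.lookup (x ∷ D) b) ≡ (proj₁ x ℕ.+ proj₂ x) ℕ.+ toℕ b
path-position t x D       path        zero    = sym (ℕₚ.+-identityʳ _)
path-position t x (y ∷ D) (st , path) (suc b) = trans (path-position (suc t) y D path b)
  (trans (cong (ℕ._+ toℕ b) (next st)) (sym (ℕₚ.+-suc _ (toℕ b))))
  where
  next : ∀ {U : Pred ℕ p} → Step U (suc t) x y → proj₁ y ℕ.+ proj₂ y ≡ suc (proj₁ x ℕ.+ proj₂ x)
  next (up    _ r≡ c≡) = cong₂ ℕ._+_ r≡ c≡
  next (right _ r≡ c≡) = trans (cong₂ ℕ._+_ r≡ c≡) (ℕₚ.+-suc _ _)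

module Walk (D : Diagram) (U : Pred ℕ p)
  (step : ∀ b b′ → toℕ b′ ≡ suc (toℕ b) → Step U (toℕ b′) (List.lookup D b) (List.lookup D b′))
  (position : ∀ b → proj₁ (List.lookup D b) ℕ.+ proj₂ (List.lookup D b) ≡ toℕ b)
  where
  private
    row col : Fin (length D) → ℕ
    row b = proj₁ (List.lookup D b)
    col b = proj₂ (List.lookup D b)

  successor : ∀ {b b′ : Fin (length D)} → toℕ b ℕ.< toℕ b′ → Σ[ c ∈ Fin (length D) ] toℕ c ≡ suc (toℕ b)
  successor {b} {b′} b<b′ = fromℕ< (ℕₚ.≤-<-trans b<b′ (Finₚ.toℕ<n b′)) , Finₚ.toℕ-fromℕ< _

  adjacent : ∀ {b} (b′ : Fin (length D)) t → b ℕ.≤ t → t ℕ.< toℕ b′ →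
    Σ[ c ∈ Fin (length D) ] Σ[ c′ ∈ Fin (length D) ] b ℕ.≤ toℕ c × toℕ c′ ℕ.≤ toℕ b′ × toℕ c′ ≡ suc (toℕ c) × toℕ c′ ≡ suc t
  adjacent {b} b′ t b≤t t<b′ =
    fromℕ< t<n , fromℕ< 1+t<n , subst (b ℕ.≤_) (sym c≡) b≤t , subst (ℕ._≤ toℕ b′) (sym c′≡) t<b′ , trans c′≡ (cong suc (sym c≡)) , c′≡
    where
    t<n : t ℕ.< length D
    t<n = ℕₚ.<-trans t<b′ (Finₚ.toℕ<n b′)
    1+t<n : suc t ℕ.< length D
    1+t<n = ℕₚ.≤-<-trans t<b′ (Finₚ.toℕ<n b′)
    c≡ : toℕ (fromℕ< t<n) ≡ t
    c≡ = Finₚ.toℕ-fromℕ< t<n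
    c′≡ : toℕ (fromℕ< 1+t<n) ≡ suc t
    c′≡ = Finₚ.toℕ-fromℕ< 1+t<n

  distance : ∀ {b b′ : Fin (length D)} → toℕ b ℕ.< toℕ b′ → ∃[ d ] toℕ b′ ≡ suc (toℕ b) ℕ.+ d
  distance b<b′ = _ , sym (ℕₚ.m+[n∸m]≡n b<b′)

  monotone′ : ∀ d b b′ → toℕ b′ ≡ toℕ b ℕ.+ d → row b ℕ.≤ row b′ × col b ℕ.≤ col b′
  monotone′ zero b b′ eq with Finₚ.toℕ-injective {i = b′} {b} (trans eq (ℕₚ.+-identityʳ _))
  ... | refl = ℕₚ.≤-refl , ℕₚ.≤-refl
  monotone′ (suc d) b b′ eq with successor {b} {b′} (subst (toℕ b ℕ.<_) (sym eq) (ℕₚ.m<m+n (toℕ b) (s≤s z≤n)))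
  ... | c , c≡ with step b c c≡ | monotone′ d c b′ (trans eq (trans (ℕₚ.+-suc (toℕ b) d) (cong (ℕ._+ d) (sym c≡))))
  ...   | up    _ r≡ c≡′ | r≤ , c≤ = ℕₚ.≤-trans (ℕₚ.n≤1+n _) (subst (ℕ._≤ row b′) r≡ r≤) , subst (ℕ._≤ col b′) c≡′ c≤
  ...   | right _ r≡ c≡′ | r≤ , c≤ = subst (ℕ._≤ row b′) r≡ r≤ , ℕₚ.≤-trans (ℕₚ.n≤1+n _) (subst (ℕ._≤ col b′) c≡′ c≤)

  monotone : ∀ {b b′} → toℕ b ℕ.≤ toℕ b′ → row b ℕ.≤ row b′ × col b ℕ.≤ col b′
  monotone {b} {b′} b≤b′ = monotone′ _ b b′ (sym (ℕₚ.m+[n∸m]≡n b≤b′))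

  module _ {Q : Rel (Fin (length D)) q} (Q-trans : Transitive Q) where

    chain : (V : Pred ℕ r) → (∀ b b′ → toℕ b′ ≡ suc (toℕ b) → V (toℕ b′) → Q b b′) →
      ∀ d b b′ → toℕ b′ ≡ suc (toℕ b) ℕ.+ d → (∀ t → toℕ b ℕ.< t → t ℕ.≤ toℕ b′ → V t) → Q b b′
    chain V adj zero    b b′ eq all = adj b b′ (trans eq (ℕₚ.+-identityʳ _))
      (all (toℕ b′) (subst (toℕ b ℕ.<_) (sym eq) (s≤s (ℕₚ.m≤m+n _ 0))) ℕₚ.≤-refl)
    chain V adj (suc d) b b′ eq all with successor {b} {b′} (subst (toℕ b ℕ.<_) (sym eq) (s≤s (ℕₚ.m≤m+n _ _)))
    ... | c , c≡ = Q-trans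
      (adj b c c≡ (all (toℕ c) b<c c≤b′))
      (chain V adj d c b′ (trans eq (trans (ℕₚ.+-suc _ d) (cong (λ t → suc t ℕ.+ d) (sym c≡)))) (λ t c<t → all t (ℕₚ.<-trans b<c c<t)))
      where
      b<c : toℕ b ℕ.< toℕ c
      b<c = ℕₚ.≤-reflexive (sym c≡)
      c≤b′ : toℕ c ℕ.≤ toℕ b′
      c≤b′ = subst (toℕ c ℕ.≤_) (sym eq) (ℕₚ.≤-trans (ℕₚ.≤-reflexive c≡) (ℕₚ.m≤m+n _ _))

    -- Rows never decrease along the walk, so a single step up between the two boxes would put them
    -- in different rows. Only steps to the right remain, and `chain` composes them.
    along : (∀ b b′ → toℕ b′ ≡ suc (toℕ b) → ¬ U (toℕ b′) → Q b b′) → ∀ b b′ → row b ≡ row b′ → col b ℕ.< col b′ → Q b b′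
    along adj b b′ r≡ c< = let d , eq = distance {b} {b′} b<b′ in chain (λ t → ¬ U t) adj d b b′ eq no-up
      where
      b<b′ : toℕ b ℕ.< toℕ b′
      b<b′ = subst₂′ (position b) (position b′) (ℕₚ.≤-<-trans (ℕₚ.≤-reflexive (cong (ℕ._+ col b) r≡)) (ℕₚ.+-monoʳ-< (row b′) c<))
        where
        subst₂′ : ∀ {m n m′ n′} → m ≡ m′ → n ≡ n′ → m ℕ.< n → m′ ℕ.< n′
        subst₂′ refl refl h = h

      no-up : ∀ t → toℕ b ℕ.< t → t ℕ.≤ toℕ b′ → ¬ U t
      no-up (suc t) (s≤s b≤t) t<b′ Ut with adjacent b′ t b≤t t<b′
      ... | c , c′ , b≤c , c′≤b′ , c′≡ , st with step c c′ c′≡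
      ...   | right ¬U _ _ = ¬U (subst U (sym st) Ut)
      ...   | up _ r≡′ _   = ℕₚ.<-irrefl r≡ (ℕₚ.≤-<-trans (proj₁ (monotone b≤c))
                               (ℕₚ.≤-trans (ℕₚ.≤-reflexive (sym r≡′)) (proj₁ (monotone c′≤b′))))

    -- The counterpart for columns: a step to the right in between would raise the column for good.
    upward : (∀ b b′ → toℕ b′ ≡ suc (toℕ b) → U (toℕ b′) → Q b b′) → ∀ b b′ → col b ≡ col b′ → toℕ b ℕ.< toℕ b′ → Q b b′
    upward adj b b′ c≡₀ b<b′ = let d , eq = distance {b} {b′} b<b′ in chain U adj d b b′ eq no-right
      where
      no-right : ∀ t → toℕ b ℕ.< t → t ℕ.≤ toℕ b′ → U t
      no-right (suc t) (s≤s b≤t) t<b′ with adjacent b′ t b≤t t<b′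
      ... | c , c′ , b≤c , c′≤b′ , c′≡ , st with step c c′ c′≡
      ...   | up Ut _ _     = subst U st Ut
      ...   | right _ _ c≡′ = contradiction c≡₀ (ℕₚ.<⇒≢ (ℕₚ.≤-<-trans (proj₂ (monotone b≤c))
                                (ℕₚ.≤-trans (ℕₚ.≤-reflexive (sym c≡′)) (proj₂ (monotone c′≤b′)))))

  -- Position is row plus column, so within a column it grows with the row.
  column-order : ∀ {b b′} → col b ≡ col b′ → row b ℕ.< row b′ → toℕ b ℕ.< toℕ b′
  column-order {b} {b′} c≡ r< = ℕₚ.≤-<-trans (ℕₚ.≤-reflexive (trans (sym (position b)) (cong (row b ℕ.+_) c≡)))
    (ℕₚ.<-≤-trans (ℕₚ.+-monoˡ-< (col b′) r<) (ℕₚ.≤-reflexive (position b′)))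

  column-order⁻ : ∀ {b b′} → col b ≡ col b′ → toℕ b ℕ.< toℕ b′ → row b ℕ.< row b′
  column-order⁻ {b} {b′} c≡ b< = ℕₚ.+-cancelʳ-< (col b′) (row b) (row b′)
    (ℕₚ.≤-<-trans (ℕₚ.≤-reflexive (trans (cong (row b ℕ.+_) (sym c≡)) (position b))) (ℕₚ.<-≤-trans b< (ℕₚ.≤-reflexive (sym (position b′)))))

-- Finite total orders and the lexicographic order of words.

first-failure : {P : Pred (Fin n) p} → Decidable P → (∀ i → P i) ⊎ ∃[ j ] ¬ P j × (∀ i → toℕ i ℕ.< toℕ j → P i)
first-failure {n = zero}  P? = inj₁ λ ()
first-failure {n = suc n} P? with P? zero
... | no ¬p = inj₂ (zero , ¬p , λ _ ())
... | yes p with first-failure (P? ∘ suc)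
...   | inj₁ all            = inj₁ λ { zero → p ; (suc i) → all i }
...   | inj₂ (j , ¬q , all) = inj₂ (suc j , ¬q , λ { zero _ → p ; (suc i) (s≤s i<j) → all i i<j })

module FiniteOrder {A : Set a} {_≺_ : Rel A ℓ} (≺-isStrictTotalOrder : IsStrictTotalOrder _≡_ _≺_)
                   (elements : List A) (complete : ∀ x → x ∈ elements) where
  open IsStrictTotalOrder ≺-isStrictTotalOrder using (_≟_; _<?_; compare) renaming (trans to ≺-trans; irrefl to ≺-irrefl)

  infix 4 _≼_
  _≼_ : Rel A (a ⊔ ℓ)
  x ≼ y = x ≺ y ⊎ x ≡ y

  ≺-≼-trans : ∀ {x y z} → x ≺ y → y ≼ z → x ≺ z
  ≺-≼-trans x≺y (inj₁ y≺z)  = ≺-trans x≺y y≺z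
  ≺-≼-trans x≺y (inj₂ refl) = x≺y

  ≼-≢⇒≺ : ∀ {x y} → x ≼ y → x ≢ y → x ≺ y
  ≼-≢⇒≺ (inj₁ x≺y) _   = x≺y
  ≼-≢⇒≺ (inj₂ x≡y) x≢y = contradiction x≡y x≢y

  least : {U : Pred A p} → Decidable U → ∃[ x ] U x → ∃[ x ] U x × (∀ y → U y → x ≼ y)
  least {U = U} U? (x₀ , Ux₀) with scan elements
    where
    scan : ∀ xs → (∀ y → y ∈ xs → ¬ U y) ⊎ ∃[ x ] U x × (∀ y → y ∈ xs → U y → x ≼ y)
    scan [] = inj₁ λ _ ()
    scan (z ∷ xs) with U? z | scan xs
    ... | no ¬Uz | inj₁ none           = inj₁ λ { y (here refl) → ¬Uz ; y (there y∈) → none y y∈ }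
    ... | no ¬Uz | inj₂ (x , Ux , min) = inj₂ (x , Ux , λ { y (here refl) Uy → contradiction Uy ¬Uz ; y (there y∈) → min y y∈ })
    ... | yes Uz | inj₁ none           = inj₂ (z , Uz , λ { y (here refl) _ → inj₂ refl ; y (there y∈) Uy → contradiction Uy (none y y∈) })
    ... | yes Uz | inj₂ (x , Ux , min) with compare z x
    ...   | tri< z≺x _ _  = inj₂ (z , Uz , λ { y (here refl) _ → inj₂ refl ; y (there y∈) Uy → inj₁ (≺-≼-trans z≺x (min y y∈ Uy)) })
    ...   | tri≈ _ refl _ = inj₂ (z , Uz , λ { y (here refl) _ → inj₂ refl ; y (there y∈) Uy → min y y∈ Uy })
    ...   | tri> _ _ x≺z  = inj₂ (x , Ux , λ { y (here refl) _ → inj₁ x≺z ; y (there y∈) Uy → min y y∈ Uy })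
  ... | inj₁ none           = contradiction Ux₀ (none x₀ (complete x₀))
  ... | inj₂ (x , Ux , min) = x , Ux , λ y → min y (complete y)

  length-filter-≤ : {P : Pred A p} {Q : Pred A q} (P? : Decidable P) (Q? : Decidable Q) → (∀ {x} → P x → Q x) →
    ∀ xs → length (filter P? xs) ℕ.≤ length (filter Q? xs)
  length-filter-≤ P? Q? P⊆Q []       = z≤n
  length-filter-≤ P? Q? P⊆Q (x ∷ xs) with P? x | Q? x
  ... | yes _  | yes _  = s≤s (length-filter-≤ P? Q? P⊆Q xs)
  ... | yes Px | no ¬Qx = contradiction (P⊆Q Px) ¬Qx
  ... | no  _  | yes _  = ℕₚ.m≤n⇒m≤1+n (length-filter-≤ P? Q? P⊆Q xs)
  ... | no  _  | no  _  = length-filter-≤ P? Q? P⊆Q xs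

  length-filter-< : {P : Pred A p} {Q : Pred A q} (P? : Decidable P) (Q? : Decidable Q) → (∀ {x} → P x → Q x) →
    ∀ {y} → Q y → ¬ P y → ∀ {xs} → y ∈ xs → length (filter P? xs) ℕ.< length (filter Q? xs)
  length-filter-< P? Q? P⊆Q {y} Qy ¬Py {_ ∷ xs} (here refl) with P? y | Q? y
  ... | yes Py | _      = contradiction Py ¬Py
  ... | no  _  | no ¬Qy = contradiction Qy ¬Qy
  ... | no  _  | yes _  = s≤s (length-filter-≤ P? Q? P⊆Q xs)
  length-filter-< P? Q? P⊆Q Qy ¬Py {x ∷ xs} (there y∈) with P? x | Q? x
  ... | yes _  | yes _  = s≤s (length-filter-< P? Q? P⊆Q Qy ¬Py y∈)
  ... | yes Px | no ¬Qx = contradiction (P⊆Q Px) ¬Qx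
  ... | no  _  | yes _  = ℕₚ.m≤n⇒m≤1+n (length-filter-< P? Q? P⊆Q Qy ¬Py y∈)
  ... | no  _  | no  _  = length-filter-< P? Q? P⊆Q Qy ¬Py y∈

  ordinal : A → ℕ
  ordinal x = length (filter (_<? x) elements)

  ordinal-mono : ∀ {x y} → x ≺ y → ordinal x ℕ.< ordinal y
  ordinal-mono {x} {y} x≺y = length-filter-< (_<? x) (_<? y) (λ z≺x → ≺-trans z≺x x≺y) x≺y (≺-irrefl refl) (complete x)

  base : ℕ
  base = suc (length elements)

  ordinal<base : ∀ x → ordinal x ℕ.< base
  ordinal<base x = s≤s (Listₚ.length-filter (_<? x) elements)

  -- Words as numbers in the given base, so that the lexicographic order becomes the order of ℕ
  code : Vec A n → ℕ
  code []                = 0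
  code {suc n} (x ∷ xs) = ordinal x ℕ.* base ℕ.^ n ℕ.+ code xs

  code<base^ : (xs : Vec A n) → code xs ℕ.< base ℕ.^ n
  code<base^ []                = ℕₚ.≤-refl
  code<base^ {suc n} (x ∷ xs) = begin-strict
    ordinal x ℕ.* base ℕ.^ n ℕ.+ code xs      <⟨ ℕₚ.+-monoʳ-< (ordinal x ℕ.* base ℕ.^ n) (code<base^ xs) ⟩
    ordinal x ℕ.* base ℕ.^ n ℕ.+ base ℕ.^ n     ≡⟨ ℕₚ.+-comm (ordinal x ℕ.* base ℕ.^ n) (base ℕ.^ n) ⟩
    suc (ordinal x) ℕ.* base ℕ.^ n            ≤⟨ ℕₚ.*-monoˡ-≤ (base ℕ.^ n) (ordinal<base x) ⟩
    base ℕ.* base ℕ.^ n                       ∎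
    where open ℕₚ.≤-Reasoning

  -- Ordinals are digits below `base`, so no tail can outweigh a difference in an earlier digit.
  code-< : (u v : Vec A n) (j : Fin n) → (∀ i → toℕ i ℕ.< toℕ j → lookup u i ≡ lookup v i) →
    lookup u j ≺ lookup v j → code u ℕ.< code v
  code-< {suc n} (x ∷ u) (y ∷ v) zero agree x≺y = begin-strict
    ordinal x ℕ.* base ℕ.^ n ℕ.+ code u       <⟨ ℕₚ.+-monoʳ-< (ordinal x ℕ.* base ℕ.^ n) (code<base^ u) ⟩
    ordinal x ℕ.* base ℕ.^ n ℕ.+ base ℕ.^ n     ≡⟨ ℕₚ.+-comm (ordinal x ℕ.* base ℕ.^ n) (base ℕ.^ n) ⟩
    suc (ordinal x) ℕ.* base ℕ.^ n            ≤⟨ ℕₚ.*-monoˡ-≤ (base ℕ.^ n) (ordinal-mono x≺y) ⟩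
    ordinal y ℕ.* base ℕ.^ n                  ≤⟨ ℕₚ.m≤m+n _ (code v) ⟩
    ordinal y ℕ.* base ℕ.^ n ℕ.+ code v       ∎
    where open ℕₚ.≤-Reasoning
  code-< {suc n} (x ∷ u) (y ∷ v) (suc j) agree u≺v with agree zero (s≤s z≤n)
  ... | refl = ℕₚ.+-monoʳ-< (ordinal x ℕ.* base ℕ.^ n) (code-< u v j (λ i i<j → agree (suc i) (s≤s i<j)) u≺v)

  first-difference : (u v : Vec A n) → u ≡ v ⊎ ∃[ j ] lookup u j ≢ lookup v j × (∀ i → toℕ i ℕ.< toℕ j → lookup u i ≡ lookup v i)
  first-difference u v with first-failure (λ i → lookup u i ≟ lookup v i)
  ... | inj₁ u≗v = inj₁ (trans (sym (Vecₚ.tabulate∘lookup u)) (trans (Vecₚ.tabulate-cong u≗v) (Vecₚ.tabulate∘lookup v)))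
  ... | inj₂ d   = inj₂ d

  code-injective : (u v : Vec A n) → code u ≡ code v → u ≡ v
  code-injective u v eq with first-difference u v
  ... | inj₁ u≡v = u≡v
  ... | inj₂ (j , u≢v , agree) with compare (lookup u j) (lookup v j)
  ...   | tri< u≺v _ _ = contradiction eq (ℕₚ.<⇒≢ (code-< u v j agree u≺v))
  ...   | tri≈ _ u≡v _ = contradiction u≡v u≢v
  ...   | tri> _ _ v≺u = contradiction eq (ℕₚ.>⇒≢ (code-< v u j (λ i i<j → sym (agree i i<j)) v≺u))

-- Words of atoms in a geometric lattice.

module Words (P : GeometricLattice c ℓ) {_≺_ : Rel (GeometricLattice.Atom P) ℓ₂}
             (≺-isStrictTotalOrder : IsStrictTotalOrder _≡_ _≺_) where
  open GeometricLattice P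
  open Matroid P

  x≤y⇒x∨y≡y : ∀ {x y} → x ≤ y → x ∨ y ≡ y
  x≤y⇒x∨y≡y x≤y = ≤-antisym (∨-least x≤y ≤-refl) (y≤x∨y _ _)

  _≤?_ : Decidable₂ _≤_
  x ≤? y = map′ (λ eq → subst (x ≤_) eq (x≤x∨y x y)) x≤y⇒x∨y≡y ((x ∨ y) ≟ y)

  rk-injective : ∀ {x y} → x ≤ y → rk x ≡ rk y → x ≡ y
  rk-injective {x} {y} x≤y eq with x ≟ y
  ... | yes x≡y = x≡y
  ... | no  x≢y = contradiction eq (ℕₚ.<⇒≢ (rk-< (x≤y , x≢y)))

  rank1⇒atom : ∀ {x} → rk x ≡ 1 → 𝟎 ⋖ x
  rank1⇒atom {x} eq =
    (minimum x , λ 𝟎≡x → contradiction (trans (sym rk-𝟎) (trans (cong rk 𝟎≡x) eq)) λ ()) ,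
    λ z (𝟎<z , z<x) → ℕₚ.<⇒≱ (subst (rk z ℕ.<_) eq (rk-< z<x)) (subst (ℕ._< rk z) rk-𝟎 (rk-< 𝟎<z))

  -- Atoms are recognised by having rank 1, which is decided at once, whereas `𝟎 ⋖ x` quantifies
  -- over all elements.
  atomsAt : Carrier → List Atom
  atomsAt x with rk x ℕₚ.≟ 1
  ... | yes eq = (x , [ rank1⇒atom eq ]) ∷ []
  ... | no  _  = []

  ∈-atomsAt : ∀ a → a ∈ atomsAt (value a)
  ∈-atomsAt a with rk (value a) ℕₚ.≟ 1
  ... | yes _    = here refl
  ... | no  rk≢1 = contradiction (rk-atom a) rk≢1

  atoms : List Atom
  atoms = concatMap (atomsAt ∘ Inverse.from finite) (allFin size)

  ∈-atoms : ∀ a → a ∈ atoms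
  ∈-atoms a = ∈ₚ.∈-concatMap⁺ (atomsAt ∘ Inverse.from finite)
    (Any.map (λ { refl → subst (λ x → a ∈ atomsAt x) (sym (Inverse.strictlyInverseʳ finite (value a))) (∈-atomsAt a) })
      (∈ₚ.∈-allFin (Inverse.to finite (value a))))

  open FiniteOrder ≺-isStrictTotalOrder atoms ∈-atoms public

  -- By atomicity `y` is a join of atoms; if all of them lay below `x`, so would `y`, against the
  -- ranks.
  atom-between : ∀ {x y} → rk x ℕ.< rk y → ∃[ a ] value a ≤ y × ¬ value a ≤ x
  atom-between {x} {y} x<y with atomic y
  ... | as , refl with Any.any? (λ a → ¬? (value a ≤? x)) as
  ...   | yes some = let a , a∈ , a≰x = find some in a , ∈⇒≤⋁ a∈ , a≰x
  ...   | no  none = contradiction x<y (ℕₚ.≤⇒≯ (rk-mono (⋁-least as λ {a} a∈ → decidable-stable (value a ≤? x) λ a≰x →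
            none (Any.map (λ { refl → a≰x }) a∈))))

  -- Semimodularity lets the rank rise by at most 1, and it does rise because the join is strictly
  -- larger.
  rk-∨-atom : ∀ x a → ¬ value a ≤ x → rk (x ∨ value a) ≡ suc (rk x)
  rk-∨-atom x a a≰x = ℕₚ.≤-antisym
    (ℕₚ.≤-trans (rk-∨ x (value a)) (ℕₚ.≤-reflexive (trans (cong (rk x ℕ.+_) (rk-atom a)) (ℕₚ.+-comm (rk x) 1))))
    (rk-< (x≤x∨y x (value a) , λ eq → a≰x (subst (value a ≤_) (sym eq) (y≤x∨y x (value a)))))

  prefix : Vec Atom n → ℕ → Carrier
  prefix F t = ⋁ (take t (toList F))

  entry≤prefix : (F : Vec Atom n) → ∀ {t} b → toℕ b ℕ.< t → value (lookup F b) ≤ prefix F t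
  entry≤prefix F b b<t = ∈⇒≤⋁ (∈-take⁺ F _ b b<t)

  prefix-least : (F : Vec Atom n) → ∀ {t x} → (∀ b → toℕ b ℕ.< t → value (lookup F b) ≤ x) → prefix F t ≤ x
  prefix-least F {t} h = ⋁-least (take t (toList F)) λ a∈ → let b , b<t , eq = ∈-take⁻ F t a∈ in subst (λ a → value a ≤ _) (sym eq) (h b b<t)

  prefix-mono : (F : Vec Atom n) → ∀ {s t} → s ℕ.≤ t → prefix F s ≤ prefix F t
  prefix-mono F s≤t = prefix-least F λ b b<s → entry≤prefix F b (ℕₚ.≤-trans b<s s≤t)

  prefix-≤ : (F G : Vec Atom n) → ∀ {t} → (∀ b → toℕ b ℕ.< t → lookup F b ≡ lookup G b) → prefix F t ≤ prefix G t
  prefix-≤ F G {t} agree = prefix-least F λ b b<t → subst (λ a → value a ≤ prefix G t) (sym (agree b b<t)) (entry≤prefix G b b<t)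

  prefix-suc : (F : Vec Atom n) → ∀ j → prefix F (suc (toℕ j)) ≡ prefix F (toℕ j) ∨ value (lookup F j)
  prefix-suc F j = ≤-antisym (prefix-least F last)
    (∨-least (prefix-mono F (ℕₚ.n≤1+n _)) (entry≤prefix F j ℕₚ.≤-refl))
    where
    last : ∀ b → toℕ b ℕ.< suc (toℕ j) → value (lookup F b) ≤ prefix F (toℕ j) ∨ value (lookup F j)
    last b (s≤s b≤j) with ℕₚ.m≤n⇒m<n∨m≡n b≤j
    ... | inj₁ b<j = ≤-trans (entry≤prefix F b b<j) (x≤x∨y _ _)
    ... | inj₂ b≡j rewrite Finₚ.toℕ-injective b≡j = y≤x∨y _ _

  prefix-all : (F : Vec Atom n) → prefix F n ≡ ⋁ (toList F)
  prefix-all {n} F = cong ⋁ (Listₚ.take-all n (toList F) (ℕₚ.≤-reflexive (Vecₚ.length-toList F)))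

  -- Together with `Independent` this is the NBC⁺ condition; that an entry lies below the prefix it
  -- ends is automatic.
  Minimal : Pred (Vec Atom n) _
  Minimal F = ∀ j m → value m ≤ prefix F (suc (toℕ j)) → ¬ value m ≤ prefix F (toℕ j) → lookup F j ≼ m

  Independent : Pred (Vec Atom n) _
  Independent F = ∀ j → ¬ value (lookup F j) ≤ prefix F (toℕ j)

  AscendsOff : Vec ℕ k → Pred (Vec Atom n) _
  AscendsOff S F = ∀ j j′ → toℕ j′ ≡ suc (toℕ j) → ¬ toℕ j′ VecM.∈ S → lookup F j ≺ lookup F j′

  rk-prefix-independent : (F : Vec Atom n) → Independent F → ∀ t → t ℕ.≤ n → rk (prefix F t) ≡ t
  rk-prefix-independent F ind zero    _   = rk-𝟎
  rk-prefix-independent F ind (suc t) t<n = begin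
    rk (prefix F (suc t))                              ≡⟨ cong (rk ∘ prefix F ∘ suc) t≡ ⟨
    rk (prefix F (suc (toℕ j)))                        ≡⟨ cong rk (prefix-suc F j) ⟩
    rk (prefix F (toℕ j) ∨ value (lookup F j))         ≡⟨ rk-∨-atom _ (lookup F j) (ind j) ⟩
    suc (rk (prefix F (toℕ j)))                        ≡⟨ cong (suc ∘ rk ∘ prefix F) t≡ ⟩
    suc (rk (prefix F t))                              ≡⟨ cong suc (rk-prefix-independent F ind t (ℕₚ.<⇒≤ t<n)) ⟩
    suc t                                              ∎
    where
    open ≡-Reasoning
    j = fromℕ< t<n
    t≡ : toℕ j ≡ t
    t≡ = Finₚ.toℕ-fromℕ< t<n

  -- An entry below the join of its predecessors would leave that join unchanged, while prefixes of
  -- a basis have rank equal to their length.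
  basis⇒independent : (F : Vec Atom n) → n ≡ rk 𝟏 → IsMatroidBasis (toList F) → Independent F
  basis⇒independent {n} F n≡ basis j F≤ = ℕₚ.<-irrefl (trans (sym (at (toℕ j) (ℕₚ.<⇒≤ (Finₚ.toℕ<n j))))
    (trans (cong rk (≤-antisym (prefix-mono F (ℕₚ.n≤1+n _)) (subst (_≤ prefix F (toℕ j)) (sym (prefix-suc F j)) (∨-least ≤-refl F≤))))
      (at (suc (toℕ j)) (Finₚ.toℕ<n j)))) ℕₚ.≤-refl
    where
    at : ∀ t → t ℕ.≤ n → rk (prefix F t) ≡ t
    at t t≤n = rk-prefix basis (subst (t ℕ.≤_) n≡ t≤n)

  independent⇒basis : (F : Vec Atom n) → n ≡ rk 𝟏 → Independent F → IsMatroidBasis (toList F)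
  independent⇒basis {n} F n≡ ind = trans (Vecₚ.length-toList F) n≡ ,
    rk-full (trans (cong rk (sym (prefix-all F))) (trans (rk-prefix-independent F ind n ℕₚ.≤-refl) n≡))

  -- The entry at position t is the least atom outside the prefix of length t that lies below the prefixes
  -- at all s ∈ S beyond t: such an atom enters the prefixes before the next element of S, and the entries
  -- ascend up to there.
  greedy : (F : Vec Atom n) (S : Vec ℕ k) → prefix F n ≡ 𝟏 → Minimal F → AscendsOff S F →
    ∀ j m → (∀ i → toℕ j ℕ.< lookup S i → value m ≤ prefix F (lookup S i)) → ¬ value m ≤ prefix F (toℕ j) → lookup F j ≼ m
  greedy {n} F S full minimal asc j m below m≰ = go (n ∸ suc (toℕ j)) j (ℕₚ.m+[n∸m]≡n (Finₚ.toℕ<n j)) below m≰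
    where
    go : ∀ d j → suc (toℕ j) ℕ.+ d ≡ n → (∀ i → toℕ j ℕ.< lookup S i → value m ≤ prefix F (lookup S i)) →
         ¬ value m ≤ prefix F (toℕ j) → lookup F j ≼ m
    go zero j eq below m≰ = minimal j m (subst (value m ≤_) (sym (trans (cong (prefix F) (trans (sym (ℕₚ.+-identityʳ _)) eq)) full)) (maximum _)) m≰
    go (suc d) j eq below m≰ with value m ≤? prefix F (suc (toℕ j))
    ... | yes m≤ = minimal j m m≤ m≰
    ... | no  m≰′ = inj₁ (≺-≼-trans (asc j j′ j′≡ j′∉S)
      (go d j′ (trans (cong (λ t → suc t ℕ.+ d) j′≡) (trans (sym (ℕₚ.+-suc (suc (toℕ j)) d)) eq))
        (λ i j′<s → below i (ℕₚ.<-trans (ℕₚ.≤-reflexive (sym j′≡)) j′<s)) (m≰′ ∘ subst (λ t → value m ≤ prefix F t) j′≡)))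
      where
      1+j<n : suc (toℕ j) ℕ.< n
      1+j<n = subst (suc (toℕ j) ℕ.<_) eq (ℕₚ.m<m+n (suc (toℕ j)) (s≤s z≤n))
      j′ = fromℕ< 1+j<n
      j′≡ : toℕ j′ ≡ suc (toℕ j)
      j′≡ = Finₚ.toℕ-fromℕ< 1+j<n
      j′∉S : ¬ toℕ j′ VecM.∈ S
      j′∉S j′∈ = m≰′ (subst (λ t → value m ≤ prefix F t) s≡ (below (VecAny.index j′∈) (subst (toℕ j ℕ.<_) (sym s≡) ℕₚ.≤-refl)))
        where
        s≡ : lookup S (VecAny.index j′∈) ≡ suc (toℕ j)
        s≡ = trans (sym (VecAnyₚ.lookup-index j′∈)) j′≡

  -- At the first difference `j`, the entry of `G` competes in the greedy choice for `F`: it lies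
  -- below the common joins at later elements of `S`, and independence of `G` keeps it outside the
  -- common prefix. So the entry of `F` is smaller.
  lex-least : (F G : Vec Atom n) (S : Vec ℕ k) → prefix F n ≡ 𝟏 → Minimal F → AscendsOff S F → Independent G →
    (∀ i → prefix F (lookup S i) ≡ prefix G (lookup S i)) → F ≡ G ⊎ code F ℕ.< code G
  lex-least F G S full minimal asc ind through with first-difference F G
  ... | inj₁ F≡G = inj₁ F≡G
  ... | inj₂ (j , F≢G , agree) = inj₂ (code-< F G j agree (≼-≢⇒≺
    (greedy F S full minimal asc j (lookup G j)
      (λ i j<s → subst (value (lookup G j) ≤_) (sym (through i)) (entry≤prefix G j j<s))
      (λ G≤ → ind j (≤-trans G≤ (prefix-≤ F G agree)))) F≢G))

  module Label (S : Vec ℕ k) (S-inc : ∀ {i j} → i Fin.≤ j → lookup S i ℕ.≤ lookup S j)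
               (ys : Vec Carrier k) (ys-mono : ∀ {i j} → i Fin.≤ j → lookup ys i ≤ lookup ys j)
               (ys-rank : ∀ i → rk (lookup ys i) ≡ lookup S i) where

    -- The constraint on the join of the first `t` entries: it has to stay below every chain element
    -- of rank at least `t`.
    Below : ℕ → Pred Carrier _
    Below t x = ∀ i → t ℕ.≤ lookup S i → x ≤ lookup ys i

    below? : ∀ t → Decidable (Below t)
    below? t x = Finₚ.all? λ i → (t ℕₚ.≤? lookup S i) →-dec (x ≤? lookup ys i)

    State : ℕ → Set _
    State t = Σ[ x ∈ Carrier ] rk x ≡ t × Below t x

    Greedy : (t : ℕ) → Carrier → Pred Atom _
    Greedy t x a = (Below (suc t) (value a) × ¬ value a ≤ x) × (∀ m → Below (suc t) (value m) × ¬ value m ≤ x → a ≼ m)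

    -- A candidate exists: the binding constraint is the first chain element of rank above `t`,
    -- whose rank exceeds that of `x`, so some atom below it is not below `x`. If there is no such
    -- element, any atom outside `x` will do.
    pick : ∀ t → t ℕ.< rk 𝟏 → ((x , _) : State t) → ∃[ a ] Greedy t x a
    pick t t<n (x , rk-x , x-below) = least
      (λ a → below? (suc t) (value a) ×-dec ¬? (value a ≤? x)) candidate
      where
      candidate : ∃[ a ] Below (suc t) (value a) × ¬ value a ≤ x
      candidate with first-failure (λ i → lookup S i ℕₚ.<? suc t)
      ... | inj₁ none = let a , _ , a≰x = atom-between (subst (ℕ._< rk 𝟏) (sym rk-x) t<n) in
        a , (λ i t<s → contradiction (none i) (ℕₚ.≤⇒≯ t<s)) , a≰x
      ... | inj₂ (i , s≮ , first) =
        let a , a≤y , a≰x = atom-between (subst (λ r → r ℕ.< rk (lookup ys i)) (sym rk-x) (subst (t ℕ.<_) (sym (ys-rank i)) (ℕₚ.≮⇒≥ s≮))) in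
        a , (λ i′ t<s → ≤-trans a≤y (ys-mono (ℕₚ.≮⇒≥ λ i′<i → ℕₚ.≤⇒≯ t<s (first i′ i′<i)))) , a≰x

    start : State 0
    start = 𝟎 , rk-𝟎 , λ i _ → minimum _

    next : ∀ {t} ((x , _) : State t) → ∃[ a ] Greedy t x a → State (suc t)
    next (x , rk-x , x-below) (a , (a-below , a≰x) , _) =
      x ∨ value a , trans (rk-∨-atom x a a≰x) (cong suc rk-x) ,
      λ i t<s → ∨-least (x-below i (ℕₚ.<⇒≤ t<s)) (a-below i t<s)

    recompute-< : ∀ {t u} → .(t ℕ.< u) → t ℕ.< u
    recompute-< t<u = recompute (_ ℕₚ.<? _) t<u

    -- The bound is irrelevant, so that the state depends on `t` alone; where `pick` needs it,
    -- decidability recovers it.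
    state : ∀ t → .(t ℕ.≤ rk 𝟏) → State t
    state zero    _   = start
    state (suc t) t<n = next (state t (ℕₚ.<⇒≤ t<n)) (pick t (recompute-< t<n) (state t (ℕₚ.<⇒≤ t<n)))

    module _ (n≡ : n ≡ rk 𝟏) where
      private
        bound : (j : Fin n) → toℕ j ℕ.< rk 𝟏
        bound j = subst (toℕ j ℕ.<_) n≡ (Finₚ.toℕ<n j)

        at : (j : Fin n) → State (toℕ j)
        at j = state (toℕ j) (ℕₚ.<⇒≤ (bound j))

        picked : (j : Fin n) → ∃[ a ] Greedy (toℕ j) (proj₁ (at j)) a
        picked j = pick (toℕ j) (recompute-< (bound j)) (at j)

      label : Vec Atom n
      label = tabulate (proj₁ ∘ picked)

      prefix-label : ∀ t .(t≤ : t ℕ.≤ rk 𝟏) → t ℕ.≤ n → prefix label t ≡ proj₁ (state t t≤)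
      prefix-label zero    _   _   = refl
      prefix-label (suc t) t<r t<n = go (fromℕ< t<n) (Finₚ.toℕ-fromℕ< t<n)
        where
        go : (j : Fin n) → toℕ j ≡ t → prefix label (suc t) ≡ proj₁ (state (suc t) t<r)
        go j refl = trans (prefix-suc label j) (cong₂ _∨_ (prefix-label t (ℕₚ.<⇒≤ t<r) (ℕₚ.<⇒≤ t<n))
          (cong value (Vecₚ.lookup∘tabulate (proj₁ ∘ picked) j)))

      private
        x≡ : (j : Fin n) → prefix label (toℕ j) ≡ proj₁ (at j)
        x≡ j = prefix-label (toℕ j) (ℕₚ.<⇒≤ (bound j)) (ℕₚ.<⇒≤ (Finₚ.toℕ<n j))

        entry : (j : Fin n) → Greedy (toℕ j) (prefix label (toℕ j)) (lookup label j)
        entry j = subst₂ (Greedy (toℕ j)) (sym (x≡ j)) (sym (Vecₚ.lookup∘tabulate (proj₁ ∘ picked) j)) (proj₂ (picked j))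

        below : ∀ t → t ℕ.≤ n → Below t (prefix label t)
        below t t≤n = subst (Below t) (sym (prefix-label t t≤ t≤n)) (proj₂ (proj₂ (state t t≤)))
          where
          t≤ : t ℕ.≤ rk 𝟏
          t≤ = subst (t ℕ.≤_) n≡ t≤n

      label-independent : Independent label
      label-independent j = proj₂ (proj₁ (entry j))

      -- An atom below the new prefix is below all chain elements that constrain this prefix, so it
      -- took part in the choice of the entry.
      label-minimal : Minimal label
      label-minimal j m m≤ m≰ = proj₂ (entry j) m ((λ i t<s → ≤-trans m≤ (below (suc (toℕ j)) (Finₚ.toℕ<n j) i t<s)) , m≰)

      -- Since the position `j′` is not in `S`, no constraint expires between the two choices, so
      -- the entry at `j′` was already a candidate at `j`. Equality is excluded by independence.
      label-ascends : AscendsOff S label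
      label-ascends j j′ j′≡ j′∉S = ≼-≢⇒≺
        (proj₂ (entry j) (lookup label j′)
          ( (λ i j<s → proj₁ (proj₁ (entry j′)) i (ℕₚ.≤∧≢⇒< (subst (ℕ._≤ lookup S i) (sym j′≡) j<s)
              (λ j′≡s → j′∉S (subst (VecM._∈ S) (sym j′≡s) (VecMₚ.∈-lookup i S)))))
          , λ a≤ → label-independent j′ (≤-trans a≤ (prefix-mono label (subst (toℕ j ℕ.≤_) (sym j′≡) (ℕₚ.n≤1+n _))))))
        λ eq → label-independent j′ (subst (λ a → value a ≤ prefix label (toℕ j′)) eq (entry≤prefix label j (subst (toℕ j ℕ.<_) (sym j′≡) ℕₚ.≤-refl)))

      -- The prefix lies below the chain element, and both have the same rank.
      label-through : ∀ i → lookup S i ℕ.≤ n → prefix label (lookup S i) ≡ lookup ys i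
      label-through i s≤n = rk-injective (below (lookup S i) s≤n i ℕₚ.≤-refl)
        (trans (rk-prefix-independent label label-independent _ s≤n) (sym (ys-rank i)))

  entryAt : (F : Vec Atom n) (j : Fin (length (toList F))) → ∃[ i ] toℕ i ≡ toℕ j × List.lookup (toList F) j ≡ lookup F i
  entryAt (a ∷ F) zero    = zero , refl , refl
  entryAt (a ∷ F) (suc j) = let i , p , q = entryAt F j in suc i , cong suc p , q

  entryAt⁻ : (F : Vec Atom n) (i : Fin n) → ∃[ j ] toℕ i ≡ toℕ j × List.lookup (toList F) j ≡ lookup F i
  entryAt⁻ (a ∷ F) zero    = zero , refl , refl
  entryAt⁻ (a ∷ F) (suc i) = let j , p , q = entryAt⁻ F i in suc j , cong suc p , q

  open NBC P _≺_ using (IsNBC⁺Basis)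

  -- Descends from `t` to the position at which `m` enters the prefixes; there is one because no
  -- atom lies below `𝟎`.
  entered : (F : Vec Atom n) → ∀ m t → t ℕ.≤ n → value m ≤ prefix F t → Σ[ j ∈ Fin n ] value m ≤ prefix F (suc (toℕ j)) × ¬ value m ≤ prefix F (toℕ j)
  entered F m zero    _   m≤ = contradiction (trans (sym (rk-atom m)) (trans (cong rk (≤-antisym m≤ (minimum _))) rk-𝟎)) λ ()
  entered F m (suc t) t<n m≤ with value m ≤? prefix F t
  ... | yes m≤′ = entered F m t (ℕₚ.<⇒≤ t<n) m≤′
  ... | no  m≰  = fromℕ< t<n , subst (λ t → value m ≤ prefix F (suc t)) (sym t≡) m≤ , m≰ ∘ subst (λ t → value m ≤ prefix F t) t≡
    where
    t≡ : toℕ (fromℕ< t<n) ≡ t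
    t≡ = Finₚ.toℕ-fromℕ< t<n

  -- For the NBC clause, an atom `m` outside the word enters the prefixes at some position. The
  -- entry there is at most `m` by minimality and differs from `m`, hence precedes it.
  minimal⇒nbc⁺ : (F : Vec Atom n) → n ≡ rk 𝟏 → Independent F → Minimal F → IsNBC⁺Basis (toList F)
  minimal⇒nbc⁺ {n} F n≡ ind minimal = record
    { nbc     = trans (cong rk (sym (prefix-all F))) (trans (rk-prefix-independent F ind n ℕₚ.≤-refl) (sym (Vecₚ.length-toList F))) ,
                λ m m∉ m≤ → let j , m≤′ , m≰ = entered F m n ℕₚ.≤-refl (subst (value m ≤_) (sym (prefix-all F)) m≤)
                                F∈ = VecMₚ.∈-toList⁺ (VecMₚ.∈-lookup j F) in
                            Any.map (λ { refl → ≼-≢⇒≺ (minimal j m m≤′ m≰) (λ eq → m∉ (subst (_∈ toList F) eq F∈)) }) F∈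
    ; full    = trans (Vecₚ.length-toList F) n≡
    ; minimal = λ j → let i , i≡ , F≡ = entryAt F j in
        ( subst₂ (λ a t → value a ≤ prefix F (suc t)) (sym F≡) i≡ (entry≤prefix F i ℕₚ.≤-refl)
        , subst₂ (λ a t → ¬ value a ≤ prefix F t) (sym F≡) i≡ (ind i)) ,
        λ m (m≤ , m≰) → subst (_≼ m) (sym F≡)
          (minimal i m (subst (λ t → value m ≤ prefix F (suc t)) (sym i≡) m≤) (m≰ ∘ subst (λ t → value m ≤ prefix F t) i≡))
    }

  nbc⁺⇒minimal : (F : Vec Atom n) → IsNBC⁺Basis (toList F) → Independent F × Minimal F
  nbc⁺⇒minimal F nbc⁺ =
    (λ i → let j , i≡ , F≡ = entryAt⁻ F i in
      subst₂ (λ a t → ¬ value a ≤ prefix F t) F≡ (sym i≡) (proj₂ (proj₁ (IsNBC⁺Basis.minimal nbc⁺ j)))) ,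
    λ i m m≤ m≰ → let j , i≡ , F≡ = entryAt⁻ F i in subst (_≼ m) F≡ (proj₂ (IsNBC⁺Basis.minimal nbc⁺ j) m
      (subst (λ t → value m ≤ prefix F (suc t)) i≡ m≤ , m≰ ∘ subst (λ t → value m ≤ prefix F t) (sym i≡)))

-- Facets of simplices, and cycles in the top dimension.

-- removeAt for vectors whose length is not known to be positive
facet : {A : Set a} → Fin n → Vec A n → Vec A (pred n)
facet {n = suc n} i v = removeAt v i

skip : Fin n → Fin (pred n) → Fin n
skip {suc n} = punchIn

skip-≢ : (i : Fin n) (j : Fin (pred n)) → skip i j ≢ i
skip-≢ {suc n} i j = Finₚ.punchInᵢ≢i i j

lookup-facet : {A : Set a} (i : Fin n) (v : Vec A n) (j : Fin (pred n)) → lookup (facet i v) j ≡ lookup v (skip i j)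
lookup-facet {n = suc n}       zero    (x ∷ v)         j       = refl
lookup-facet {n = suc (suc n)} (suc i) (x ∷ v@(_ ∷ _)) zero    = refl
lookup-facet {n = suc (suc n)} (suc i) (x ∷ v@(_ ∷ _)) (suc j) = lookup-facet i v j

module Faces {c ℓ : Level} (K : CommutativeRing c ℓ) {X : Set a} (_≟_ : DecidableEquality X) (_<_ : Rel X r) where
  open CommutativeRing K hiding (zero; refl; sym; trans) renaming (Carrier to 𝕂)
  private module ≈ = CommutativeRing K
  open Free K
  open Linear K
  open OrderComplex K _≟_ _<_
  open import Algebra.Properties.Semiring.Exp semiring using (_^_)
  open import Algebra.Properties.Ring ring using (-1*x≈-x; -‿involutive; -‿distribˡ-*; -‿distribʳ-*)
  open ≈-Reasoning setoid

  faces : Simplex (suc m) → List (Fin (suc m)) → Combination (Simplex m)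
  faces x = map (λ i → (- 1#) ^ toℕ i , face i x)

  sign-square : ∀ i → (- 1#) ^ i * (- 1#) ^ i ≈ 1#
  sign-square zero    = *-identityˡ 1#
  sign-square (suc i) = begin
    (- 1# * s) * (- 1# * s)      ≈⟨ *-cong (-1*x≈-x s) (-1*x≈-x s) ⟩
    - s * - s                    ≈⟨ -‿distribˡ-* s (- s) ⟨
    - (s * - s)                  ≈⟨ -‿cong (-‿distribʳ-* s s) ⟨
    - (- (s * s))                ≈⟨ -‿involutive _ ⟩
    s * s                        ≈⟨ sign-square i ⟩
    1#                           ∎
    where
    s = (- 1#) ^ i

  coefficient-faces-absent : ∀ (x : Simplex (suc m)) {τ} is → (∀ {j} → j ∈ is → face j x ≢ τ) → coefficient (simplices m) (faces x is) τ ≈ 0#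
  coefficient-faces-absent {m} x is h = coefficient-absent (simplices m) (faces x is) (absent is h)
    where
    absent : ∀ {τ} is → (∀ {j} → j ∈ is → face j x ≢ τ) → ¬ Any (λ (_ , y) → y ≡ τ) (faces x is)
    absent (i ∷ is) h (here eq) = h (here refl) eq
    absent (i ∷ is) h (there p) = absent is (h ∘ there) p

  coefficient-faces : ∀ (x : Simplex (suc m)) i is → Unique is → i ∈ is → (∀ j → face j x ≡ face i x → j ≡ i) →
    coefficient (simplices m) (faces x is) (face i x) ≈ (- 1#) ^ toℕ i
  coefficient-faces {m} x i (j ∷ is) (j∉ ∷ uniq) (here i≡j) only = ≈.trans
    (coefficient-here (simplices m) ((- 1#) ^ toℕ j) (faces x is) (cong (λ j → face j x) (sym i≡j)))
    (≈.trans (+-cong (reflexive (cong (λ j → (- 1#) ^ toℕ j) (sym i≡j)))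
                   (coefficient-faces-absent x is λ {l} l∈ eq → All.lookup j∉ l∈ (trans (sym i≡j) (sym (only l eq)))))
           (+-identityʳ _))
  coefficient-faces {m} x i (j ∷ is) (j∉ ∷ uniq) (there i∈) only = ≈.trans
    (coefficient-there (simplices m) ((- 1#) ^ toℕ j) (faces x is) (λ eq → All.lookup j∉ i∈ (only j eq)))
    (coefficient-faces x i is uniq i∈ only)

  -- Look at the coefficient of the `i`-th face of `x` in the boundary of `z`. The coefficients of
  -- `z` vanish outside `P`, and within `P` only `x` has this face, only once, so this coefficient
  -- is that of `x` up to sign. The sign is removed by multiplying with it again.
  cycle-vanishes : (z : Chain m) → IsCycle z → (i : Fin m) (x : Simplex m) {P : Pred (Simplex m) p} → Decidable P →
    P x → (∀ y → ¬ P y → coefficient (simplices m) z y ≈ 0#) →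
    (∀ y j → P y → facet j (vertices y) ≡ facet i (vertices x) → y ≡ x × j ≡ i) → coefficient (simplices m) z x ≈ 0#
  cycle-vanishes {suc m} z cycle i x {P} P? Px z-out unique = begin
    coefficient (simplices (suc m)) z x                     ≈⟨ *-identityʳ _ ⟨
    coefficient (simplices (suc m)) z x * 1#                ≈⟨ *-congˡ (sign-square (toℕ i)) ⟨
    coefficient (simplices (suc m)) z x * (s * s)           ≈⟨ *-assoc _ _ _ ⟨
    (coefficient (simplices (suc m)) z x * s) * s           ≈⟨ *-congʳ (*-congˡ (coefficient-faces x i (allFin (suc m)) (tabulate⁺ id) (∈ₚ.∈-allFin i)
                                                                 (λ j eq → proj₂ (unique x j Px (cong vertices eq))))) ⟨
    (coefficient (simplices (suc m)) z x * H x) * s         ≈⟨ *-congʳ (eval-point (simplices (suc m)) P? (subst P) (λ { refl → ≈.refl }) Px other z z-out) ⟨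
    eval H z * s                                            ≈⟨ *-congʳ (coefficient-extension (simplices m) (λ y → faces y (allFin (suc m))) z (face i x)) ⟨
    coefficient (simplices m) (∂ z) (face i x) * s          ≈⟨ *-congʳ (at cycle (face i x)) ⟩
    0# * s                                                  ≈⟨ zeroˡ s ⟩
    0#                                                      ∎
    where
    s : 𝕂
    s = (- 1#) ^ toℕ i

    H : Simplex (suc m) → 𝕂
    H y = coefficient (simplices m) (faces y (allFin (suc m))) (face i x)

    other : ∀ y → P y → y ≡ x ⊎ H y ≈ 0#
    other y Py with DecSetoid._≟_ (simplices (suc m)) y x
    ... | yes y≡x = inj₁ y≡x
    ... | no  y≢x = inj₂ (coefficient-faces-absent y (allFin (suc m)) λ {j} _ eq → y≢x (proj₁ (unique y j Py (cong vertices eq))))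

  facet≟ : (u v : Vec X m) → Dec (u ≡ v)
  facet≟ = Vecₚ.≡-dec _≟_

  hasFacet : Fin m → Vec X (pred m) → Simplex m → 𝕂
  hasFacet i τ y = if does (facet≟ (facet i (vertices y)) τ) then 1# else 0#

  -- The coefficient of a face in the boundary is a signed sum over the deleted position `i`, so it
  -- is enough that the part for each `i` vanishes. Facets are compared as plain vectors of
  -- vertices.
  cycle-by-facets : (z : Chain m) → (∀ i τ → eval (hasFacet i τ) z ≈ 0#) → IsCycle z
  cycle-by-facets {zero}  z h = _
  cycle-by-facets {suc m} z h = equal λ τ →
    ≈.trans (coefficient-extension (simplices m) (λ y → faces y (allFin (suc m))) z τ) (go τ (allFin (suc m)))
    where
    term : ∀ b s → (if b then s else 0#) ≈ s * (if b then 1# else 0#)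
    term true  s = ≈.sym (*-identityʳ s)
    term false s = ≈.sym (zeroʳ s)

    go : ∀ τ is → eval (λ y → coefficient (simplices m) (faces y is) τ) z ≈ 0#
    go τ []       = eval-zero (λ _ → ≈.refl) z
    go τ (i ∷ is) = begin
      eval (λ y → coefficient (simplices m) (faces y (i ∷ is)) τ) z
        ≈⟨ eval-congˡ (λ y → +-congʳ (term (does (facet≟ (removeAt (vertices y) i) (vertices τ))) ((- 1#) ^ toℕ i))) z ⟩
      eval (λ y → (- 1#) ^ toℕ i * hasFacet i (vertices τ) y + coefficient (simplices m) (faces y is) τ) z
        ≈⟨ eval-+ _ _ z ⟩
      eval (λ y → (- 1#) ^ toℕ i * hasFacet i (vertices τ) y) z + eval (λ y → coefficient (simplices m) (faces y is) τ) z
        ≈⟨ +-cong (≈.trans (eval-* _ (hasFacet i (vertices τ)) z) (≈.trans (*-congˡ (h i (vertices τ))) (zeroʳ _))) (go τ is) ⟩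
      0# + 0#
        ≈⟨ +-identityˡ 0# ⟩
      0# ∎

  -- In top dimension there are no boundaries, so homology is the module of cycles.
  module _ (top : ¬ Simplex (suc m)) (code : Simplex m → ℕ) (code-injective : ∀ {x y} → code x ≡ code y → x ≡ y)
           (bound : ℕ) (code<bound : ∀ x → code x ℕ.< bound) (I : DecSetoid p ℓ₁)
           (pivot : DecSetoid.Carrier I → Simplex m)
           (pivot-cong : ∀ {i j} → DecSetoid._≈_ I i j → pivot i ≡ pivot j)
           (pivot-injective : ∀ {i j} → pivot i ≡ pivot j → DecSetoid._≈_ I i j)
           (e : DecSetoid.Carrier I → Chain m)
           (e-cong : ∀ {i j} → DecSetoid._≈_ I i j → e i ≡ e j)
           (pivot-one : ∀ i → coefficient (simplices m) (e i) (pivot i) ≈ 1#)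
           (above-zero : ∀ i y → code (pivot i) ℕ.< code y → coefficient (simplices m) (e i) y ≈ 0#)
           (e-cycle : ∀ i → IsCycle (e i))
           (eliminate : ∀ z x → IsCycle z → (∃[ i ] pivot i ≡ x) ⊎
             ((∀ y → code x ℕ.< code y → coefficient (simplices m) z y ≈ 0#) → coefficient (simplices m) z x ≈ 0#)) where
    private
      module C = Module (chains m)

      boundary⇒zero : ∀ z → IsBoundary z → z C.≈ᴹ C.0ᴹ
      boundary⇒zero z ([] , ∂w≈z)       = C.≈ᴹ-sym {C.0ᴹ} {z} ∂w≈z
      boundary⇒zero z ((_ , x) ∷ _ , _) = contradiction x top

      module H = Module H̃[ m -1]

      equal⇒homologous : ∀ (v w : H.Carrierᴹ) → proj₁ v C.≈ᴹ proj₁ w → v H.≈ᴹ w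
      equal⇒homologous (v , _) (w , _) v≈w = [] , C.≈ᴹ-sym {v C.+ᴹ C.-ᴹ w} {[]}
        (C.≈ᴹ-trans {v C.+ᴹ C.-ᴹ w} {w C.+ᴹ C.-ᴹ w} {[]} (C.+ᴹ-congʳ {C.-ᴹ w} {v} {w} v≈w) (C.-ᴹ‿inverseʳ w))

      null-homologous⇒zero : ∀ (v : H.Carrierᴹ) → v H.≈ᴹ H.0ᴹ → proj₁ v C.≈ᴹ []
      null-homologous⇒zero (v , _) v≈0 = C.≈ᴹ-trans {v} {v ++ []} {[]} (C.≈ᴹ-sym {v ++ []} {v} (C.+ᴹ-identityʳ v)) (boundary⇒zero (v ++ []) v≈0)

      module T = Triangular (simplices m) code (cong code) code-injective bound code<bound I pivot pivot-cong pivot-injective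
        e (λ eq → C.≈ᴹ-reflexive (e-cong eq)) pivot-one above-zero

    triangular-basis : IsBasis H̃[ m -1] I (λ i → e i , e-cycle i)
    triangular-basis = Image.basis-by-image H̃[ m -1] (chains m) I proj₁ (λ i → e i , e-cycle i) (λ _ _ → refl) (λ _ _ → refl) refl
      null-homologous⇒zero equal⇒homologous T.independent
      (λ (z , cycle) → T.spans {Z = IsCycle {m}} (cycles-submodule {m}) e-cycle eliminate z cycle)

-- Strictly increasing vectors of ranks.

AllPairs-lookup : {A : Set a} {R : Rel A r} {v : Vec A n} → AllPairs R v → ∀ {i j} → i Fin.< j → R (lookup v i) (lookup v j)
AllPairs-lookup (p ∷ ps) {zero}  {suc j} _         = VecAllₚ.lookup⁺ p j
AllPairs-lookup (p ∷ ps) {suc i} {suc j} (s≤s i<j) = AllPairs-lookup ps i<j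

lookup-injective : {A : Set a} (u v : Vec A n) → (∀ i → lookup u i ≡ lookup v i) → u ≡ v
lookup-injective u v eq = trans (sym (Vecₚ.tabulate∘lookup u)) (trans (Vecₚ.tabulate-cong eq) (Vecₚ.tabulate∘lookup v))

tail-member : ∀ {x s} {S : Vec ℕ k} → x VecM.∈ (s ∷ S) → s ℕ.< x → x VecM.∈ S
tail-member (VecAny.here refl) s<x = contradiction s<x (ℕₚ.<-irrefl refl)
tail-member (VecAny.there x∈)  _   = x∈

increasing-length : (v : Vec ℕ m) (S : Vec ℕ k) → AllPairs ℕ._<_ v → AllPairs ℕ._<_ S → (∀ {t} → t VecM.∈ v → t VecM.∈ S) → m ℕ.≤ k
increasing-length []      S       _ _ _ = z≤n
increasing-length (x ∷ v) []      _ _ v⊆S = contradiction (v⊆S (VecAny.here refl)) λ ()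
increasing-length (x ∷ v) (s ∷ S) (x<v ∷ v-inc) (s<S ∷ S-inc) v⊆S with v⊆S (VecAny.here refl)
... | VecAny.here refl = s≤s (increasing-length v S v-inc S-inc λ t∈ → tail-member (v⊆S (VecAny.there t∈)) (VecAll.lookup x<v t∈))
... | VecAny.there x∈S = ℕₚ.m≤n⇒m≤1+n (increasing-length (x ∷ v) S (x<v ∷ v-inc) S-inc λ where
  (VecAny.here refl) → x∈S
  (VecAny.there t∈)  → tail-member (v⊆S (VecAny.there t∈)) (ℕₚ.<-trans (VecAll.lookup s<S x∈S) (VecAll.lookup x<v t∈)))

-- Heads must agree: otherwise `v` would fit into the tail of `S`, which is too short for it.
increasing-≡ : (v S : Vec ℕ k) → AllPairs ℕ._<_ v → AllPairs ℕ._<_ S → (∀ {t} → t VecM.∈ v → t VecM.∈ S) → v ≡ S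
increasing-≡ []      []      _ _ _ = refl
increasing-≡ (x ∷ v) (s ∷ S) (x<v ∷ v-inc) (s<S ∷ S-inc) v⊆S with v⊆S (VecAny.here refl)
... | VecAny.here refl = cong (x ∷_) (increasing-≡ v S v-inc S-inc λ t∈ → tail-member (v⊆S (VecAny.there t∈)) (VecAll.lookup x<v t∈))
... | VecAny.there x∈S = contradiction (increasing-length (x ∷ v) S (x<v ∷ v-inc) S-inc λ where
  (VecAny.here refl) → x∈S
  (VecAny.there t∈)  → tail-member (v⊆S (VecAny.there t∈)) (ℕₚ.<-trans (VecAll.lookup s<S x∈S) (VecAll.lookup x<v t∈))) (ℕₚ.<-irrefl refl)

-- This lets the ranks of a facet reveal which vertex was deleted.
facet-injective : (S : Vec ℕ k) → AllPairs ℕ._<_ S → ∀ i j → facet i S ≡ facet j S → i ≡ j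
facet-injective (s ∷ S)         _              zero    zero    _  = refl
facet-injective (s ∷ t ∷ S)     (s<S ∷ _)      zero    (suc j) eq = contradiction (sym (cong Vec.head eq)) (ℕₚ.<⇒≢ (VecAll.head s<S))
facet-injective (s ∷ t ∷ S)     (s<S ∷ _)      (suc i) zero    eq = contradiction (cong Vec.head eq) (ℕₚ.<⇒≢ (VecAll.head s<S))
facet-injective (s ∷ S@(_ ∷ _)) (_ ∷ S-inc)    (suc i) (suc j) eq = cong suc (facet-injective S S-inc i j (cong Vec.tail eq))

∈-facet : {A : Set a} (i : Fin n) (v : Vec A n) {x : A} → x VecM.∈ v → x ≢ lookup v i → x VecM.∈ facet i v
∈-facet zero    (y ∷ v)         (VecAny.here x≡y) x≢ = contradiction x≡y x≢
∈-facet zero    (y ∷ v)         (VecAny.there x∈) x≢ = x∈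
∈-facet (suc i) (y ∷ v@(_ ∷ _)) (VecAny.here x≡y) x≢ = VecAny.here x≡y
∈-facet (suc i) (y ∷ v@(_ ∷ _)) (VecAny.there x∈) x≢ = VecAny.there (∈-facet i v x∈ x≢)

map-facet : {A : Set a} {B : Set r} (f : A → B) (i : Fin n) (v : Vec A n) → Vec.map f (facet i v) ≡ facet i (Vec.map f v)
map-facet f zero    (x ∷ v)         = refl
map-facet f (suc i) (x ∷ v@(_ ∷ _)) = cong (f x ∷_) (map-facet f i v)

-- Standard fillings of the ribbon and column permutations.

module RankSelectedBasis (P : GeometricLattice c ℓ) {_≺_ : Rel (GeometricLattice.Atom P) ℓ₂} (sto : IsStrictTotalOrder _≡_ _≺_)
            (S : RankSet (GeometricLattice.rk P (GeometricLattice.𝟏 P)) k) (K : CommutativeRing p q) where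
  open GeometricLattice P
  open Matroid P
  open RankSet S
  open RankSelection P _≺_ S K
  open Words P sto hiding (module Label; least)
  open IsStrictTotalOrder sto using () renaming (compare to ≺-compare; trans to ≺-trans)
  open CommutativeRing K using (1#; 0#; _≈_; _+_; _*_; zeroʳ; +-congˡ; *-congˡ; +-identityʳ) renaming (Carrier to 𝕂)
  private module ≈ = CommutativeRing K
  open Free K using (coefficient)
  open Linear K
  open SignedSum K
  open Faces K {X = Selected} (Refinementₚ._≟_ (GeometricLattice._≟_ P)) (_<_ on value)

  N : ℕ
  N = length R

  ranks<n : VecAll.All (ℕ._< rk 𝟏) ranks
  ranks<n = VecAll.map proj₂ bounded

  N≡ : N ≡ rk 𝟏
  N≡ = ribbon-length 0 0 0 (rk 𝟏) ranks increasing (VecAll.map (λ _ → z≤n) bounded) ranks<n z≤n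

  rank<N : ∀ i → lookup ranks i ℕ.< N
  rank<N i = subst (lookup ranks i ℕ.<_) (sym N≡) (VecAllₚ.lookup⁺ ranks<n i)

  ranks-mono : ∀ {i j} → i Fin.≤ j → lookup ranks i ℕ.≤ lookup ranks j
  ranks-mono {i} {j} i≤j with ℕₚ.m≤n⇒m<n∨m≡n i≤j
  ... | inj₁ i<j = ℕₚ.<⇒≤ (AllPairs-lookup increasing i<j)
  ... | inj₂ i≡j rewrite Finₚ.toℕ-injective i≡j = ℕₚ.≤-refl

  path : Path (VecM._∈ ranks) 0 R
  path = ribbon-path 0 0 0 (rk 𝟏) ranks increasing (VecAll.map proj₁ bounded) ranks<n (λ _ _ → id) id

  step : ∀ b b′ → toℕ b′ ≡ suc (toℕ b) → Step (VecM._∈ ranks) (toℕ b′) (List.lookup R b) (List.lookup R b′)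
  step = path-step 0 R path

  position : ∀ b → row b ℕ.+ col b ≡ toℕ b
  position = go R refl path
    where
    go : ∀ D → D ≡ R → Path (VecM._∈ ranks) 0 D → ∀ b → proj₁ (List.lookup D b) ℕ.+ proj₂ (List.lookup D b) ≡ toℕ b
    go (x ∷ D) eq path b = trans (path-position 0 x D path b) (cong (λ x → proj₁ x ℕ.+ proj₂ x ℕ.+ toℕ b)
      (ribbon-head 0 0 (gaps 0 (rk 𝟏) ranks) (gaps-head ranks (VecAll.map proj₁ bounded) 0<n) (sym eq)))
      where
      0<n : 0 ℕ.< rk 𝟏
      0<n = subst (0 ℕ.<_) (trans (cong length eq) N≡) (s≤s z≤n)

  open Walk R (VecM._∈ ranks) step position public

  -- Comparing consecutive boxes is enough, because rows and columns of a ribbon are runs of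
  -- consecutive boxes.
  isStandard : (F : Filling) → AscendsOff ranks F →
    (∀ b b′ → toℕ b′ ≡ suc (toℕ b) → toℕ b′ VecM.∈ ranks → lookup F b′ ≺ lookup F b) → IsStandard F
  isStandard F asc desc = record
    { along-rows   = along {Q = λ b b′ → lookup F b ≺ lookup F b′} ≺-trans asc
    -- Reading order goes up a column while standardness compares downwards, so the relation is
    -- reversed.
    ; down-columns = λ b b′ c≡ r< → upward {Q = λ b b′ → lookup F b′ ≺ lookup F b} (λ p q → ≺-trans q p) desc b′ b (sym c≡) (column-order (sym c≡) r<)
    }

  standard-ascends : ∀ {F} → IsStandard F → AscendsOff ranks F
  standard-ascends std b b′ b′≡ b′∉ with step b b′ b′≡
  ... | up b′∈ _ _      = contradiction b′∈ b′∉
  ... | right _ r≡ c≡   = IsStandard.along-rows std b b′ (sym r≡) (ℕₚ.≤-reflexive (sym c≡))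

  column-code : ∀ {F} → IsStandard F → ∀ σ → (∀ b → col (σ ⟨$⟩ʳ b) ≡ col b) → (∀ b → σ ⟨$⟩ʳ b ≡ b) ⊎ code (σ • F) ℕ.< code F
  column-code {F} std σ σ-col with first-failure (λ b → σ ⟨$⟩ˡ b Finₚ.≟ b)
  ... | inj₁ fixed = inj₁ λ b → trans (cong (σ ⟨$⟩ʳ_) (sym (fixed b))) (inverseʳ σ)
  ... | inj₂ (j , moved , fixed) = inj₂ (code-< (σ • F) F j
    (λ i i<j → trans (Vecₚ.lookup∘tabulate _ i) (cong (lookup F) (fixed i i<j)))
    (subst (_≺ lookup F j) (sym (Vecₚ.lookup∘tabulate _ j))
      (IsStandard.down-columns std (σ ⟨$⟩ˡ j) j c≡ (column-order⁻ (sym c≡) j<))))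
    where
    c≡ : col (σ ⟨$⟩ˡ j) ≡ col j
    c≡ = trans (sym (σ-col (σ ⟨$⟩ˡ j))) (cong col (inverseʳ σ))

    j< : toℕ j ℕ.< toℕ (σ ⟨$⟩ˡ j)
    j< with ℕₚ.<-cmp (toℕ j) (toℕ (σ ⟨$⟩ˡ j))
    ... | tri< lt _ _ = lt
    ... | tri≈ _ eq _ = contradiction (sym (Finₚ.toℕ-injective eq)) moved
    -- All boxes before `j` are fixed; if the preimage of `j` were one of them, it would equal `j`.
    ... | tri> _ _ gt = contradiction
      (trans (sym (inverseʳ σ)) (trans (cong (σ ⟨$⟩ʳ_) (fixed _ gt)) (inverseʳ σ))) moved

  -- Maximal chains and their labels.

  rank : Selected → ℕ
  rank = rk ∘ value

  -- The order of a simplex and the rank condition on its vertices are stored irrelevantly;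
  -- decidability makes them available again.
  chain-ranks : (x : Simplex m) → AllPairs ℕ._<_ (Vec.map rank (vertices x)) × (∀ {t} → t VecM.∈ Vec.map rank (vertices x) → t VecM.∈ ranks)
  chain-ranks x = ranks-increase (recompute-ordered x) , members (vertices x)
    where
    _⊏_ : Rel Selected _
    u ⊏ w = value u < value w

    ranks-increase : ∀ {m} {v : Vec Selected m} → AllPairs _⊏_ v → AllPairs ℕ._<_ (Vec.map rank v)
    ranks-increase []       = []
    ranks-increase (p ∷ ps) = VecAllₚ.map⁺ (VecAll.map rk-< p) ∷ ranks-increase ps

    recompute-ordered : (x : Simplex m) → AllPairs _⊏_ (vertices x)
    recompute-ordered (simplex v v<) = recompute (AllPairs.allPairs? (λ u w → (value u ≤? value w) ×-dec ¬? (value u ≟ value w)) v) v<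

    members : ∀ {m} (v : Vec Selected m) {t} → t VecM.∈ Vec.map rank v → t VecM.∈ ranks
    members ((y , [ y∈ ]) ∷ v) (VecAny.here refl) = recompute (rk y VecM?.∈? ranks) y∈
    members (y ∷ v)            (VecAny.there t∈)  = members v t∈

  -- The ranks along a chain increase strictly within a set of `k` numbers.
  no-larger-chain : ¬ Simplex (suc k)
  no-larger-chain x = let inc , ∈ranks = chain-ranks x in ℕₚ.<-irrefl refl (increasing-length _ ranks inc increasing ∈ranks)

  ranks-≡ : (x : Simplex k) → Vec.map rank (vertices x) ≡ ranks
  ranks-≡ x = let inc , ∈ranks = chain-ranks x in increasing-≡ _ ranks inc increasing ∈ranks

  joins : Simplex k → Vec Carrier k
  joins x = Vec.map value (vertices x)

  joins-injective : ∀ {x y} → (∀ i → lookup (joins x) i ≡ lookup (joins y) i) → x ≡ y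
  joins-injective {x} {y} eq = vertices-injective (lookup-injective _ _ λ i → Refinementₚ.value-injective
    (trans (sym (Vecₚ.lookup-map i value (vertices x))) (trans (eq i) (Vecₚ.lookup-map i value (vertices y)))))

  joins-rank : ∀ x i → rk (lookup (joins x) i) ≡ lookup ranks i
  joins-rank x i = trans (cong rk (Vecₚ.lookup-map i value (vertices x)))
    (trans (sym (Vecₚ.lookup-map i rank (vertices x))) (cong (λ v → lookup v i) (ranks-≡ x)))

  joins-mono : ∀ x {i j} → i Fin.≤ j → lookup (joins x) i ≤ lookup (joins x) j
  joins-mono x {i} {j} i≤j with ℕₚ.m≤n⇒m<n∨m≡n i≤j
  ... | inj₂ i≡j rewrite Finₚ.toℕ-injective i≡j = ≤-refl
  ... | inj₁ i<j = subst₂ _≤_ (sym (Vecₚ.lookup-map i value (vertices x))) (sym (Vecₚ.lookup-map j value (vertices x))) (lt x)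
    where
    lt : (x : Simplex k) → value (lookup (vertices x) i) ≤ value (lookup (vertices x) j)
    lt (simplex v v<) = recompute (_ ≤? _) (proj₁ (AllPairs-lookup v< i<j))

  module ChainLabel (x : Simplex k) = Words.Label P sto ranks ranks-mono (joins x) (joins-mono x) (joins-rank x)

  abstract
    label : Simplex k → Filling
    label x = ChainLabel.label x N≡

    label-independent : ∀ x → Independent (label x)
    label-independent x = ChainLabel.label-independent x N≡

    label-minimal : ∀ x → Minimal (label x)
    label-minimal x = ChainLabel.label-minimal x N≡

    label-ascends : ∀ x → AscendsOff ranks (label x)
    label-ascends x = ChainLabel.label-ascends x N≡

    label-through : ∀ x i → prefix (label x) (lookup ranks i) ≡ lookup (joins x) i
    label-through x i = ChainLabel.label-through x N≡ i (ℕₚ.<⇒≤ (rank<N i))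

  independent⇒full : (F : Filling) → Independent F → prefix F N ≡ 𝟏
  independent⇒full F ind = trans (prefix-all F) (proj₂ (independent⇒basis F N≡ ind))

  label-injective : ∀ {x y} → label x ≡ label y → x ≡ y
  label-injective {x} {y} eq = joins-injective λ i →
    trans (sym (label-through x i)) (trans (cong (λ F → prefix F (lookup ranks i)) eq) (label-through y i))

  chainCode : Simplex k → ℕ
  chainCode = code ∘ label

  chainCode-injective : ∀ {x y} → chainCode x ≡ chainCode y → x ≡ y
  chainCode-injective = label-injective ∘ code-injective _ _

  fchain-joins : ∀ F i → lookup (joins (fchain F)) i ≡ prefix (value F) (lookup ranks i)
  fchain-joins F i = trans (Vecₚ.lookup-map i value (vertices (fchain F))) (cong value (Vecₚ.lookup∘tabulate _ i))

  -- The word `F` passes through its own chain, so it is one of the words that the label is compared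
  -- with.
  label-least : ∀ (F : BasisFilling) → Independent (value F) → label (fchain F) ≡ value F ⊎ chainCode (fchain F) ℕ.< code (value F)
  label-least F ind = lex-least (label x) (value F) ranks (independent⇒full _ (label-independent x)) (label-minimal x) (label-ascends x) ind
    λ i → trans (label-through x i) (fchain-joins F i)
    where x = fchain F

  code-antisym : {F G : Filling} → F ≡ G ⊎ code F ℕ.< code G → G ≡ F ⊎ code G ℕ.< code F → F ≡ G
  code-antisym (inj₁ F≡G) _          = F≡G
  code-antisym (inj₂ _)   (inj₁ G≡F) = sym G≡F
  code-antisym (inj₂ F<G) (inj₂ G<F) = contradiction G<F (ℕₚ.<-asym F<G)

  -- Each of the two words is lexicographically least against the other.
  label-nbc⁺ : ∀ (F : BasisFilling) → Independent (value F) → Minimal (value F) → AscendsOff ranks (value F) → label (fchain F) ≡ value F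
  label-nbc⁺ F ind minimal asc = code-antisym (label-least F ind)
    (lex-least (value F) (label x) ranks (independent⇒full _ ind) minimal asc (label-independent x)
      (λ i → sym (trans (label-through x i) (fchain-joins F i))))
    where x = fchain F

  -- Triangularity of the elements.

  pivot : StandardNBC⁺ → Simplex k
  pivot F = fchain (StandardNBC⁺.basisFilling F)

  element : StandardNBC⁺ → Chain k
  element F = f̄chain (polytabloid K (StandardNBC⁺.basisFilling F))

  column? : ∀ σ → Dec (∀ b → col (σ ⟨$⟩ʳ b) ≡ col b)
  column? σ = Finₚ.all? λ b → col (σ ⟨$⟩ʳ b) ℕₚ.≟ col b

  -- Extension by zero to all permutations, which turns the sum over the column group into a
  -- `signedSum`.
  onColumns : (BasisFilling → 𝕂) → BasisFilling → Permutation′ N → 𝕂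
  onColumns h F σ = if does (column? σ) then h (σ •ᵇ F) else 0#

  eval-map : {A : Set a} {X : Set r} (h : X → 𝕂) (κ : A → 𝕂) (g : A → X) → ∀ xs → eval h (map (λ x → κ x , g x) xs) ≈ total (λ x → κ x * h (g x)) xs
  eval-map h κ g []       = ≈.refl
  eval-map h κ g (x ∷ xs) = +-congˡ (eval-map h κ g xs)

  if-≈ : {A : Set a} (A? : Dec A) {x y κ : 𝕂} → (A → x ≈ κ) → (¬ A → y ≈ κ) → (if does A? then x else y) ≈ κ
  if-≈ (yes p) f g = f p
  if-≈ (no ¬p) f g = g ¬p

  if-* : ∀ b (κ x : 𝕂) → (if b then κ * x else 0#) ≈ κ * (if b then x else 0#)
  if-* true  κ x = ≈.refl
  if-* false κ x = ≈.sym (zeroʳ κ)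

  eval-polytabloid : (h : BasisFilling → 𝕂) → ∀ F → eval h (polytabloid K F) ≈ signedSum N (onColumns h F)
  eval-polytabloid h F = ≈.trans (eval-map h sgn (_•ᵇ F) columnGroup)
    (≈.trans (total-filter column? (λ σ → sgn σ * h (σ •ᵇ F)) (permutations N))
      (total-cong (λ σ → if-* (does (column? σ)) (sgn σ) (h (σ •ᵇ F))) (permutations N)))

  coefficient-element : ∀ F y → coefficient (simplices k) (element F) y ≈
    signedSum N (onColumns (λ G → coefficient (simplices k) ((1# , fchain G) ∷ []) y) (StandardNBC⁺.basisFilling F))
  coefficient-element F y = ≈.trans
    (coefficient-extension (simplices k) (λ G → (1# , fchain G) ∷ []) (polytabloid K (StandardNBC⁺.basisFilling F)) y)
    (eval-polytabloid _ (StandardNBC⁺.basisFilling F))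

  module _ (F : StandardNBC⁺) where
    open StandardNBC⁺ F

    filling-independent : Independent filling
    filling-independent = proj₁ (nbc⁺⇒minimal filling nbc⁺)

    moved-independent : ∀ σ → Independent (σ • filling)
    moved-independent σ = basis⇒independent (σ • filling) N≡ (basis-• σ filling (independent⇒basis filling N≡ filling-independent))

    label-pivot : label (pivot F) ≡ filling
    label-pivot = label-nbc⁺ basisFilling filling-independent (proj₂ (nbc⁺⇒minimal filling nbc⁺)) (standard-ascends standard)

    code-pivot : chainCode (pivot F) ≡ code filling
    code-pivot = cong code label-pivot

    chainCode-moved : ∀ σ → chainCode (fchain (σ •ᵇ basisFilling)) ℕ.≤ code (σ • filling)
    chainCode-moved σ = [ (λ eq → ℕₚ.≤-reflexive (cong code eq)) , ℕₚ.<⇒≤ ]′ (label-least (σ •ᵇ basisFilling) (moved-independent σ))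

    fixed-• : ∀ σ → (∀ b → σ ⟨$⟩ʳ b ≡ b) → σ •ᵇ basisFilling ≡ basisFilling
    fixed-• σ fixed = Refinementₚ.value-injective (lookup-injective (σ • filling) filling λ b →
      trans (Vecₚ.lookup∘tabulate _ b) (cong (lookup filling) (trans (cong (σ ⟨$⟩ˡ_) (sym (fixed b))) (inverseˡ σ))))

    -- The label of the chain of `σ • F` is at most the word `σ • F`, which is strictly smaller than
    -- `F` unless `σ` is the identity.
    chainCode-column : ∀ σ → (∀ b → col (σ ⟨$⟩ʳ b) ≡ col b) →
      (∀ b → σ ⟨$⟩ʳ b ≡ b) ⊎ chainCode (fchain (σ •ᵇ basisFilling)) ℕ.< chainCode (pivot F)
    chainCode-column σ σ-col = map₂
      (λ lt → ℕₚ.≤-<-trans (chainCode-moved σ) (ℕₚ.<-≤-trans lt (ℕₚ.≤-reflexive (sym code-pivot))))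
      (column-code standard σ σ-col)

    element-pivot : coefficient (simplices k) (element F) (pivot F) ≈ 1#
    element-pivot = ≈.trans (coefficient-element F (pivot F)) (signedSum-id N _
      (λ σ fixed → if-≈ (column? σ)
        (λ _ → ≈.trans (coefficient-here (simplices k) 1# [] (cong fchain (fixed-• σ fixed))) (+-identityʳ _))
        (contradiction (λ b → cong col (fixed b))))
      (λ σ moved → if-≈ (column? σ)
        (λ σ-col → coefficient-there (simplices k) 1# [] λ eq →
          [ moved , ℕₚ.<-irrefl (cong chainCode eq) ]′ (chainCode-column σ σ-col))
        (λ _ → ≈.refl)))

    element-above : ∀ y → chainCode (pivot F) ℕ.< chainCode y → coefficient (simplices k) (element F) y ≈ 0#
    element-above y F<y = ≈.trans (coefficient-element F y) (total-zero (λ σ → ≈.trans (*-congˡ (if-≈ (column? σ)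
      (λ σ-col → coefficient-there (simplices k) 1# [] λ eq →
        [ (λ fixed → ℕₚ.<-irrefl (cong chainCode (trans (sym (cong fchain (fixed-• σ fixed))) eq)) F<y)
        , (λ lt → ℕₚ.<-asym F<y (subst (ℕ._< chainCode (pivot F)) (cong chainCode eq) lt)) ]′ (chainCode-column σ σ-col))
      (λ _ → ≈.refl))) (zeroʳ _)) (permutations N))

  -- The elements are cycles.

  if-cong : {A : Set a} {B : Set r} (A? : Dec A) (B? : Dec B) {x y : 𝕂} → (A → B) → (B → A) → x ≈ y →
    (if does A? then x else 0#) ≈ (if does B? then y else 0#)
  if-cong (yes _) (yes _) f g x≈y = x≈y
  if-cong (no  _) (no  _) f g x≈y = ≈.refl
  if-cong (yes p) (no ¬q) f g x≈y = contradiction (f p) ¬q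
  if-cong (no ¬p) (yes q) f g x≈y = contradiction (g q) ¬p

  -- A new row starts at position `p + 1`, directly above the box at position `p`, so the
  -- transposition of the two preserves columns.
  swapped-col : ∀ {p} → suc p VecM.∈ ranks → ∀ {b b′} → Swapped p (toℕ b) (toℕ b′) → col b ≡ col b′
  swapped-col p∈ {b} {b′} (up b≡ b′≡) with step b b′ (trans b′≡ (cong suc (sym b≡)))
  ... | up _ _ c≡    = sym c≡
  ... | right ∉ _ _  = contradiction (subst (VecM._∈ ranks) (sym b′≡) p∈) ∉
  swapped-col p∈ {b} {b′} (down b≡ b′≡) with step b′ b (trans b≡ (cong suc (sym b′≡)))
  ... | up _ _ c≡    = c≡
  ... | right ∉ _ _  = contradiction (subst (VecM._∈ ranks) (sym b≡) p∈) ∉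
  swapped-col p∈ (same _ _ b≡) = cong col (Finₚ.toℕ-injective b≡)

  -- The entry that `σ` puts at `b` is put by `τ` at the transposed position, which is also among
  -- the first `t` unless `t` is `p + 1`.
  swapped-prefix-≤ : ∀ (F : Filling) {p t} → t ≢ suc p → ∀ σ τ → (∀ b → Swapped p (toℕ (σ ⟨$⟩ʳ b)) (toℕ (τ ⟨$⟩ʳ b))) →
    prefix (σ • F) t ≤ prefix (τ • F) t
  swapped-prefix-≤ F {p} {t} t≢ σ τ sw = prefix-least (σ • F) λ b b<t →
    let d = σ ⟨$⟩ˡ b in
    subst (λ a → value a ≤ prefix (τ • F) t)
      (trans (Vecₚ.lookup∘tabulate _ (τ ⟨$⟩ʳ d)) (trans (cong (lookup F) (inverseˡ τ)) (sym (Vecₚ.lookup∘tabulate _ b))))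
      (entry≤prefix (τ • F) (τ ⟨$⟩ʳ d) (swapped-< t≢ (subst (λ e → Swapped p (toℕ e) (toℕ (τ ⟨$⟩ʳ d))) (inverseʳ σ) (sw d)) b<t))

  swapped-prefix : ∀ (F : Filling) {p t} → t ≢ suc p → ∀ σ τ → (∀ b → Swapped p (toℕ (σ ⟨$⟩ʳ b)) (toℕ (τ ⟨$⟩ʳ b))) →
    prefix (σ • F) t ≡ prefix (τ • F) t
  swapped-prefix F t≢ σ τ sw = ≤-antisym (swapped-prefix-≤ F t≢ σ τ sw) (swapped-prefix-≤ F t≢ τ σ (swapped-sym ∘ sw))

  ranks-distinct : ∀ {i j} → i ≢ j → lookup ranks i ≢ lookup ranks j
  ranks-distinct {i} {j} i≢j eq with ℕₚ.<-cmp (toℕ i) (toℕ j)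
  ... | tri< i<j _ _ = ℕₚ.<⇒≢ (AllPairs-lookup increasing i<j) eq
  ... | tri≈ _ i≡j _ = i≢j (Finₚ.toℕ-injective i≡j)
  ... | tri> _ _ j<i = ℕₚ.>⇒≢ (AllPairs-lookup increasing j<i) eq

  -- Deleting the `i`-th vertex removes the only prefix that the transposition can change.
  swapped-facet : ∀ F i {p} → lookup ranks i ≡ suc p → ∀ σ τ → (∀ b → Swapped p (toℕ (σ ⟨$⟩ʳ b)) (toℕ (τ ⟨$⟩ʳ b))) →
    facet i (vertices (fchain (σ •ᵇ F))) ≡ facet i (vertices (fchain (τ •ᵇ F)))
  swapped-facet F i s≡ σ τ sw = lookup-injective _ _ λ j →
    trans (lookup-facet i (vertices (fchain (σ •ᵇ F))) j) (trans (Refinementₚ.value-injective (trans (vertex σ (skip i j))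
      (trans (swapped-prefix (value F) (λ eq → ranks-distinct (skip-≢ i j) (trans eq (sym s≡))) σ τ sw)
      (sym (vertex τ (skip i j)))))) (sym (lookup-facet i (vertices (fchain (τ •ᵇ F))) j)))
    where
    vertex : ∀ σ j → value (lookup (vertices (fchain (σ •ᵇ F))) j) ≡ prefix (σ • value F) (lookup ranks j)
    vertex σ j = cong value (Vecₚ.lookup∘tabulate _ j)

  element-cycle : ∀ F → IsCycle (element F)
  element-cycle F = cycle-by-facets (element F) λ i τ → ≈.trans
    (eval-linearExtension (simplices k) (hasFacet i τ) (λ G → (1# , fchain G) ∷ []) (polytabloid K B))
    (≈.trans (eval-polytabloid (λ G → eval (hasFacet i τ) ((1# , fchain G) ∷ [])) B)
    -- The transposed boxes are the last box of a row, at position `sᵢ - 1`, and the first box of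
    -- the next row, at `sᵢ`.
    (signedSum-symmetric N (pred (lookup ranks i)) _ (subst (ℕ._< N) (s≡ i) (rank<N i))
      (λ σ σ′ sw → if-cong (column? σ) (column? σ′)
        (λ h b → trans (sym (swapped-col (p∈ i) (sw b))) (h b))
        (λ h b → trans (swapped-col (p∈ i) (sw b)) (h b))
        (≈.reflexive (cong (λ f → 1# * (if does (facet≟ f τ) then 1# else 0#) + 0#) (swapped-facet B i (s≡ i) σ σ′ sw))))))
    where
    B : BasisFilling
    B = StandardNBC⁺.basisFilling F

    s≡ : ∀ i → lookup ranks i ≡ suc (pred (lookup ranks i))
    s≡ i = sym (ℕₚ.suc-pred (lookup ranks i) {{ℕ.>-nonZero (proj₁ (VecAllₚ.lookup⁺ bounded i))}})

    p∈ : ∀ i → suc (pred (lookup ranks i)) VecM.∈ ranks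
    p∈ i = subst (VecM._∈ ranks) (s≡ i) (VecMₚ.∈-lookup i ranks)

  -- Eliminating the chains that are not pivots.

  all-or-one : ∀ {n} {A : Pred (Fin n) a} {B : Set r} → (∀ i → A i ⊎ B) → (∀ i → A i) ⊎ B
  all-or-one {n = zero}  h = inj₁ λ ()
  all-or-one {n = suc n} h with h zero | all-or-one (h ∘ suc)
  ... | inj₂ b | _      = inj₂ b
  ... | inj₁ _ | inj₂ b = inj₂ b
  ... | inj₁ x | inj₁ f = inj₁ λ { zero → x ; (suc i) → f i }

  Descends : Pred Filling _
  Descends F = ∀ b b′ → toℕ b′ ≡ suc (toℕ b) → toℕ b′ VecM.∈ ranks → lookup F b′ ≺ lookup F b

  AscendsAt : Filling → Set _
  AscendsAt F = ∃[ b ] ∃[ b′ ] toℕ b′ ≡ suc (toℕ b) × toℕ b′ VecM.∈ ranks × lookup F b ≺ lookup F b′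

  descends-or-ascends : ∀ F → Independent F → Descends F ⊎ AscendsAt F
  descends-or-ascends F ind = all-or-one λ b → all-or-one λ b′ → decide b b′
    where
    decide : ∀ b b′ → (toℕ b′ ≡ suc (toℕ b) → toℕ b′ VecM.∈ ranks → lookup F b′ ≺ lookup F b) ⊎ AscendsAt F
    decide b b′ with toℕ b′ ℕₚ.≟ suc (toℕ b) | toℕ b′ VecM?.∈? ranks | ≺-compare (lookup F b) (lookup F b′)
    ... | no ¬adj | _     | _            = inj₁ λ adj _ → contradiction adj ¬adj
    ... | yes _   | no ∉  | _            = inj₁ λ _ ∈ranks → contradiction ∈ranks ∉
    ... | yes adj | yes ∈ranks | tri< lt _ _ = inj₂ (b , b′ , adj , ∈ranks , lt)
    -- A repeated atom would lie below the join of the earlier entries.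
    ... | yes adj | yes _ | tri≈ _ eq _  = contradiction
      (subst (λ a → value a ≤ prefix F (toℕ b′)) eq (entry≤prefix F b (ℕₚ.≤-reflexive (sym adj)))) (ind b′)
    ... | yes adj | yes _ | tri> _ _ gt  = inj₁ λ _ _ → gt

  -- The label itself is the standard filling, and its chain is `x` because its prefixes join to the
  -- elements of `x`.
  descending-pivot : ∀ x → Descends (label x) → ∃[ F ] pivot F ≡ x
  descending-pivot x desc = F , joins-injective λ i → trans (fchain-joins (StandardNBC⁺.basisFilling F) i) (label-through x i)
    where
    F : StandardNBC⁺
    F = record
      { filling  = label x
      ; standard = isStandard (label x) (label-ascends x) desc
      ; nbc⁺     = minimal⇒nbc⁺ (label x) N≡ (label-independent x) (label-minimal x)
      }

  -- The ranks of a facet are all of `S` except the rank of the deleted vertex.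
  same-facet-rank : ∀ x y i j → facet j (vertices y) ≡ facet i (vertices x) → j ≡ i
  same-facet-rank x y i j eq = facet-injective ranks increasing j i (trans (facet-ranks y j) (trans (cong (Vec.map rank) eq) (sym (facet-ranks x i))))
    where
    facet-ranks : ∀ x i → facet i ranks ≡ Vec.map rank (facet i (vertices x))
    facet-ranks x i = trans (cong (facet i) (sym (ranks-≡ x))) (sym (map-facet rank i (vertices x)))

  -- With an ascent at the `i`-th rank, the label of `x` ascends off the smaller set without that
  -- rank. So `lex-least` applies to all chains that share the facet, not only to `x` itself.
  ascending-least : ∀ x i {b b′} → toℕ b′ ≡ suc (toℕ b) → toℕ b′ ≡ lookup ranks i → lookup (label x) b ≺ lookup (label x) b′ →
    ∀ y → facet i (vertices y) ≡ facet i (vertices x) → label x ≡ label y ⊎ chainCode x ℕ.< chainCode y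
  ascending-least x i {b} {b′} adj s≡ lt y eq = lex-least (label x) (label y) (facet i ranks)
    (independent⇒full _ (label-independent x)) (label-minimal x) asc (label-independent y) through
    where
    asc : AscendsOff (facet i ranks) (label x)
    asc d d′ d′≡ d′∉ = decide (toℕ d′ ℕₚ.≟ lookup ranks i)
      where
      decide : Dec (toℕ d′ ≡ lookup ranks i) → lookup (label x) d ≺ lookup (label x) d′
      decide (no  d′≢s) = label-ascends x d d′ d′≡ (λ d′∈ → d′∉ (∈-facet i ranks d′∈ d′≢s))
      decide (yes d′≡s) = subst₂ (λ d d′ → lookup (label x) d ≺ lookup (label x) d′)
        (Finₚ.toℕ-injective (ℕₚ.suc-injective (trans (sym adj) (trans s≡ (trans (sym d′≡s) d′≡)))))
        (Finₚ.toℕ-injective (trans s≡ (sym d′≡s))) lt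

    vertex : ∀ x j → prefix (label x) (lookup (facet i ranks) j) ≡ value (lookup (facet i (vertices x)) j)
    vertex x j = trans (cong (prefix (label x)) (lookup-facet i ranks j)) (trans (label-through x (skip i j))
      (trans (Vecₚ.lookup-map (skip i j) value (vertices x)) (cong value (sym (lookup-facet i (vertices x) j)))))

    through : ∀ j → prefix (label x) (lookup (facet i ranks) j) ≡ prefix (label y) (lookup (facet i ranks) j)
    through j = trans (vertex x j) (trans (cong (λ v → value (lookup v j)) (sym eq)) (sym (vertex y j)))

  eliminate : ∀ z x → IsCycle z → (∃[ F ] pivot F ≡ x) ⊎
    ((∀ y → chainCode x ℕ.< chainCode y → coefficient (simplices k) z y ≈ 0#) → coefficient (simplices k) z x ≈ 0#)
  eliminate z x cycle = map⊎ (descending-pivot x) ascending (descends-or-ascends (label x) (label-independent x))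
    where
    ascending : AscendsAt (label x) → (∀ y → chainCode x ℕ.< chainCode y → coefficient (simplices k) z y ≈ 0#) → coefficient (simplices k) z x ≈ 0#
    ascending (b , b′ , adj , b′∈ , lt) above =
      -- `P` consists of the chains with labels up to that of `x`: larger ones have coefficient 0 by
      -- assumption, and smaller ones cannot share the `i`-th facet because `x` has the least label
      -- among those that do.
      cycle-vanishes z cycle i x {P = λ y → chainCode y ℕ.≤ chainCode x} (λ y → chainCode y ℕₚ.≤? chainCode x) ℕₚ.≤-refl
        (λ y y≰x → above y (ℕₚ.≰⇒> y≰x)) unique
      where
      i : Fin k
      i = VecAny.index b′∈

      unique : ∀ y j → chainCode y ℕ.≤ chainCode x → facet j (vertices y) ≡ facet i (vertices x) → y ≡ x × j ≡ i
      unique y j y≤x eq =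
        [ (λ eq → label-injective (sym eq)) , (λ lt → contradiction y≤x (ℕₚ.<⇒≱ lt)) ]′
          (ascending-least x i adj (VecAnyₚ.lookup-index b′∈) lt y (subst (λ j → facet j (vertices y) ≡ facet i (vertices x)) j≡i eq)) ,
        j≡i
        where
        j≡i : j ≡ i
        j≡i = same-facet-rank x y i j eq

  basisFilling-cong : ∀ {F G} → StandardNBC⁺.filling F ≡ StandardNBC⁺.filling G → StandardNBC⁺.basisFilling F ≡ StandardNBC⁺.basisFilling G
  basisFilling-cong {F} {G} = Refinementₚ.value-injective {v = StandardNBC⁺.basisFilling F} {w = StandardNBC⁺.basisFilling G}

  elements-basis : IsBasis H̃[ k -1] standardNBC⁺ (λ F → element F , element-cycle F)
  elements-basis = triangular-basis no-larger-chain chainCode chainCode-injective (base ℕ.^ N) (code<base^ ∘ label) standardNBC⁺ pivot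
    (λ {F} {G} eq → cong fchain (basisFilling-cong {F} {G} eq))
    (λ {F} {G} eq → trans (sym (label-pivot F)) (trans (cong label eq) (label-pivot G)))
    element
    (λ {F} {G} eq → cong (f̄chain ∘ polytabloid K) (basisFilling-cong {F} {G} eq))
    element-pivot element-above element-cycle eliminate

theorem5p29 :
    ∀ {c ℓ ℓ₂} (P : GeometricLattice c ℓ) →
    let open GeometricLattice P in
    (_≺_ : Rel Atom ℓ₂) → IsStrictTotalOrder _≡_ _≺_ →
    ∀ {k : ℕ} (S : RankSet (rk 𝟏) k) →
    let open RankSelection P _≺_ S Reals.ℂ-commutativeRing
        element : StandardNBC⁺ → Chain k
        element = λ F → f̄chain (polytabloid Reals.ℂ-commutativeRing (StandardNBC⁺.basisFilling F))
    in Σ[ cycle ∈ (∀ F → IsCycle (element F)) ] IsBasis H̃[ k -1] standardNBC⁺ (λ F → element F , cycle F)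
theorem5p29 P _≺_ ≺-isStrictTotalOrder S = element-cycle , elements-basis
  where open RankSelectedBasis P ≺-isStrictTotalOrder S Reals.ℂ-commutativeRing
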